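{- For any integer $n\ge 0$, we have \[\mathrm{pod}(3n+2)\equiv 2(-1)^{n+1}r_{5}(8n+5) \pmod{9}.\]
   Context: For an integer $n\ge 0$, $\mathrm{pod}(n)$ denotes the number of partitions of $n$ in which the odd parts are distinct (even parts may repeat); equivalently $\sum_{n\ge 0}\mathrm{pod}(n)q^n=\prod_{i\ge 1}\frac{1+q^{2i-1}}{1-q^{2i}}$. For nonnegative integers $k,n$, $r_k(n)$ denotes the number of representations of $n$ as a sum of $k$ squares, i.e. the number of tuples $(x_1,\dots,x_k)\in\mathbb{Z}^k$ with $x_1^2+\cdots+x_k^2=n$ (order and signs count). -}

module Defs where

open import Data.Empty using (⊥-elim)
open import Data.Integer.Base as ℤ using (ℤ; +_; -[1+_]; 0ℤ; ∣_∣)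
import Data.Integer.Properties as ℤₚ
open import Data.List.Base using (List; []; _∷_; [_]; _++_; map; length; filter; upTo; cartesianProductWith)
open import Data.List.Membership.Propositional using (_∈_)
open import Data.List.Membership.Propositional.Properties
  using (∈-map⁺; ∈-map⁻; ∈-++⁺ˡ; ∈-++⁺ʳ; ∈-filter⁺; ∈-filter⁻; ∈-upTo⁺; ∈-cartesianProductWith⁺)
open import Data.List.Relation.Unary.All as All using (All; []; _∷_)
import Data.List.Relation.Unary.All.Properties as Allₚ
open import Data.List.Relation.Unary.AllPairs as AllPairs using (AllPairs; []; _∷_)
open import Data.List.Relation.Unary.Any using (here)
open import Data.List.Relation.Unary.Linked as Linked using (Linked)
open import Data.List.Relation.Unary.Linked.Properties using (Linked⇒AllPairs)
open import Data.List.Relation.Unary.Unique.Propositional using (Unique)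
import Data.List.Relation.Unary.Unique.Propositional.Properties as Uniqueₚ
open import Data.List.Properties using (∷-injectiveʳ)
open import Data.Nat.Base using (ℕ; zero; suc; _+_; _*_; _≤_; _≥_; _<_; z≤n; s≤s; s≤s⁻¹)
open import Data.Nat.Divisibility using (_∣_; _∣?_)
open import Data.Nat.ListAction using (sum)
open import Data.Nat.Properties
open import Data.List.Relation.Unary.Unique.DecPropositional _≟_ using (unique?)
open import Data.Product using (_×_; _,_; proj₁; proj₂)
open import Data.Sum.Base using (inj₁; inj₂)
open import Data.Vec.Base as Vec using (Vec; []; _∷_)
open import Data.Vec.Properties using (∷-injective)
open import Data.Vec.Relation.Unary.All as VecAll using ([]; _∷_)
open import Relation.Binary.PropositionalEquality using (_≡_; refl; sym; trans; subst)
open import Relation.Nullary.Decidable using (map′; ¬?; _×-dec_)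
open import Relation.Nullary.Negation using (¬_)
open import Relation.Unary using (Decidable)

-- The listing is unique up to permutation, so `count` is the number of elements
-- satisfying P, whichever enumeration is used.

record Enumeration {A : Set} (P : A → Set) : Set where
  field
    elements : List A
    unique   : Unique elements
    sound    : ∀ {x} → x ∈ elements → P x
    complete : ∀ {x} → P x → x ∈ elements

  count : ℕ
  count = length elements

open Enumeration public

enumerate-filter : ∀ {A : Set} {P : A → Set} (P? : Decidable P) (xs : List A) →
                   Unique xs → (∀ {x} → P x → x ∈ xs) → Enumeration P
enumerate-filter P? xs xs! P⇒∈ .elements = filter P? xs
enumerate-filter P? xs xs! P⇒∈ .unique   = Uniqueₚ.filter⁺ P? xs!
enumerate-filter P? xs xs! P⇒∈ .sound x∈ = proj₂ (∈-filter⁻ P? {xs = xs} x∈)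
enumerate-filter P? xs xs! P⇒∈ .complete Px = ∈-filter⁺ P? (P⇒∈ Px) Px

record IsPartition (n : ℕ) (parts : List ℕ) : Set where
  constructor isPartition
  field
    decreasing : Linked _≥_ parts
    positive   : All (0 <_) parts
    sum≡       : sum parts ≡ n

Odd : ℕ → Set
Odd k = ¬ (2 ∣ k)

odd? : Decidable Odd
odd? k = ¬? (2 ∣? k)

OddPartsDistinct : List ℕ → Set
OddPartsDistinct parts = Unique (filter odd? parts)

IsPodPartition : ℕ → List ℕ → Set
IsPodPartition n parts = IsPartition n parts × OddPartsDistinct parts

isPartition? : ∀ n → Decidable (IsPartition n)
isPartition? n parts = map′
  (λ (d , p , s) → isPartition d p s)
  (λ (isPartition d p s) → d , p , s)
  (Linked.linked? _≥?_ parts ×-dec All.all? (0 <?_) parts ×-dec sum parts ≟ n)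

isPodPartition? : ∀ n → Decidable (IsPodPartition n)
isPodPartition? n parts = isPartition? n parts ×-dec unique? (filter odd? parts)

-- The weakly decreasing lists of length at most l with entries in {1,…,m}.

decreasingLists : (l m : ℕ) → List (List ℕ)
decreasingLists zero    m       = [ [] ]
decreasingLists (suc l) zero    = [ [] ]
decreasingLists (suc l) (suc m) =
  map (suc m ∷_) (decreasingLists l (suc m)) ++ decreasingLists (suc l) m

decreasingLists-≤ : ∀ l m → All (All (_≤ m)) (decreasingLists l m)
decreasingLists-≤ zero    m       = [] ∷ []
decreasingLists-≤ (suc l) zero    = [] ∷ []
decreasingLists-≤ (suc l) (suc m) = Allₚ.++⁺
  (Allₚ.map⁺ (All.map (≤-refl ∷_) (decreasingLists-≤ l (suc m))))
  (All.map (All.map m≤n⇒m≤1+n) (decreasingLists-≤ (suc l) m))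

decreasingLists-unique : ∀ l m → Unique (decreasingLists l m)
decreasingLists-unique zero    m       = [] ∷ []
decreasingLists-unique (suc l) zero    = [] ∷ []
decreasingLists-unique (suc l) (suc m) = Uniqueₚ.++⁺
  (Uniqueₚ.map⁺ ∷-injectiveʳ (decreasingLists-unique l (suc m)))
  (decreasingLists-unique (suc l) m)
  disjoint
  where
  disjoint : ∀ {xs} → ¬ (xs ∈ map (suc m ∷_) (decreasingLists l (suc m)) ×
                         xs ∈ decreasingLists (suc l) m)
  disjoint (∈ˡ , ∈ʳ) with ∈-map⁻ (suc m ∷_) ∈ˡ | All.lookup (decreasingLists-≤ (suc l) m) ∈ʳ
  ... | _ , _ , refl | m<m ∷ _ = 1+n≰n m<m

[]∈decreasingLists : ∀ l m → [] ∈ decreasingLists l m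
[]∈decreasingLists zero    m       = here refl
[]∈decreasingLists (suc l) zero    = here refl
[]∈decreasingLists (suc l) (suc m) = ∈-++⁺ʳ _ ([]∈decreasingLists (suc l) m)

∈-decreasingLists : ∀ l m {xs} → AllPairs _≥_ xs → All (0 <_) xs → All (_≤ m) xs →
                    length xs ≤ l → xs ∈ decreasingLists l m
∈-decreasingLists l m [] [] [] _ = []∈decreasingLists l m
∈-decreasingLists (suc l) zero (_ ∷ _) (0<x ∷ _) (x≤0 ∷ _) _ = ⊥-elim (<⇒≱ 0<x x≤0)
∈-decreasingLists (suc l) (suc m) (x≥ ∷ dec) (0<x ∷ pos) (x≤ ∷ xs≤) (s≤s len)
  with m≤n⇒m<n∨m≡n x≤
... | inj₂ refl = ∈-++⁺ˡ (∈-map⁺ (suc m ∷_) (∈-decreasingLists l (suc m) dec pos xs≤ len))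
... | inj₁ x<   = ∈-++⁺ʳ _ (∈-decreasingLists (suc l) m (x≥ ∷ dec) (0<x ∷ pos)
                    (s≤s⁻¹ x< ∷ All.map (λ y≤x → ≤-trans y≤x (s≤s⁻¹ x<)) x≥) (s≤s len))

parts≤sum : ∀ xs → All (_≤ sum xs) xs
parts≤sum []       = []
parts≤sum (x ∷ xs) = m≤m+n x _ ∷ All.map (λ y≤ → ≤-trans y≤ (m≤n+m _ x)) (parts≤sum xs)

length≤sum : ∀ {xs} → All (0 <_) xs → length xs ≤ sum xs
length≤sum []          = z≤n
length≤sum (0<x ∷ pos) = +-mono-≤ 0<x (length≤sum pos)

podPartitions : ∀ n → Enumeration (IsPodPartition n)
podPartitions n = enumerate-filter (isPodPartition? n) (decreasingLists n n)
  (decreasingLists-unique n n) listed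
  where
  listed : ∀ {parts} → IsPodPartition n parts → parts ∈ decreasingLists n n
  listed {parts} (isPartition dec pos refl , _) =
    ∈-decreasingLists n n (Linked⇒AllPairs (λ i≥j j≥k → ≤-trans j≥k i≥j) dec)
      pos (parts≤sum parts) (length≤sum pos)

pod : ℕ → ℕ
pod n = count (podPartitions n)

sumOfSquares : ∀ {k} → Vec ℤ k → ℤ
sumOfSquares xs = Vec.foldr′ ℤ._+_ 0ℤ (Vec.map (ℤ._^ 2) xs)

IsRepresentation : (k n : ℕ) → Vec ℤ k → Set
IsRepresentation k n xs = sumOfSquares xs ≡ + n

-- The integers of absolute value at most b.

interval : ℕ → List ℤ
interval b = map +_ (upTo (suc b)) ++ map -[1+_] (upTo b)

interval-unique : ∀ b → Unique (interval b)
interval-unique b = Uniqueₚ.++⁺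
  (Uniqueₚ.map⁺ ℤₚ.+-injective (Uniqueₚ.upTo⁺ (suc b)))
  (Uniqueₚ.map⁺ ℤₚ.-[1+-injective (Uniqueₚ.upTo⁺ b))
  disjoint
  where
  disjoint : ∀ {x} → ¬ (x ∈ map +_ (upTo (suc b)) × x ∈ map -[1+_] (upTo b))
  disjoint (∈ˡ , ∈ʳ) with ∈-map⁻ +_ ∈ˡ | ∈-map⁻ -[1+_] ∈ʳ
  ... | _ , _ , refl | _ , _ , ()

∈-interval : ∀ b x → ∣ x ∣ ≤ b → x ∈ interval b
∈-interval b (+ n)    n≤b = ∈-++⁺ˡ (∈-map⁺ +_ (∈-upTo⁺ (s≤s n≤b)))
∈-interval b -[1+ n ] n<b = ∈-++⁺ʳ _ (∈-map⁺ -[1+_] (∈-upTo⁺ n<b))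

box : (k b : ℕ) → List (Vec ℤ k)
box zero    b = [ [] ]
box (suc k) b = cartesianProductWith _∷_ (interval b) (box k b)

box-unique : ∀ k b → Unique (box k b)
box-unique zero    b = [] ∷ []
box-unique (suc k) b =
  Uniqueₚ.cartesianProductWith⁺ _∷_ ∷-injective (interval-unique b) (box-unique k b)

∈-box : ∀ {k} b {xs : Vec ℤ k} → VecAll.All (λ x → ∣ x ∣ ≤ b) xs → xs ∈ box k b
∈-box b []                   = here refl
∈-box b (_∷_ {x = x} x≤ xs≤) = ∈-cartesianProductWith⁺ _∷_ (∈-interval b x x≤) (∈-box b xs≤)

square≡+ : ∀ x → x ℤ.^ 2 ≡ + (∣ x ∣ * ∣ x ∣)
square≡+ x rewrite ℤₚ.*-identityʳ x = i*i≡+ x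
  where
  i*i≡+ : ∀ i → i ℤ.* i ≡ + (∣ i ∣ * ∣ i ∣)
  i*i≡+ (+ n)    = sym (ℤₚ.pos-* n n)
  i*i≡+ -[1+ n ] = refl

sumOfSquares≡+ : ∀ {k} (xs : Vec ℤ k) →
                 sumOfSquares xs ≡ + Vec.sum (Vec.map (λ x → ∣ x ∣ * ∣ x ∣) xs)
sumOfSquares≡+ []       = refl
sumOfSquares≡+ (x ∷ xs) rewrite square≡+ x | sumOfSquares≡+ xs = refl

m≤m*m : ∀ m → m ≤ m * m
m≤m*m zero    = z≤n
m≤m*m (suc m) = m≤m+n (suc m) (m * suc m)

abs≤sum : ∀ {k} (xs : Vec ℤ k) →
          VecAll.All (λ x → ∣ x ∣ ≤ Vec.sum (Vec.map (λ y → ∣ y ∣ * ∣ y ∣) xs)) xs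
abs≤sum []       = []
abs≤sum (x ∷ xs) =
  ≤-trans (m≤m*m ∣ x ∣) (m≤m+n _ _) ∷
  VecAll.map (λ y≤ → ≤-trans y≤ (m≤n+m _ (∣ x ∣ * ∣ x ∣))) (abs≤sum xs)

representations : ∀ k n → Enumeration (IsRepresentation k n)
representations k n = enumerate-filter (λ xs → sumOfSquares xs ℤₚ.≟ + n) (box k n)
  (box-unique k n) listed
  where
  listed : ∀ {xs} → IsRepresentation k n xs → xs ∈ box k n
  listed {xs} eq = ∈-box n (subst (λ b → VecAll.All (λ x → ∣ x ∣ ≤ b) xs)
    (ℤₚ.+-injective (trans (sym (sumOfSquares≡+ xs)) eq)) (abs≤sum xs))

r : (k n : ℕ) → ℕ
r k n = count (representations k n)

{-# OPTIONS --safe #-}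
module Submission where

-- Let ψ(q) = Σ q^(n(n+1)/2).  Shanks' finite form of Gauss's identity gives Σ (-1)ⁿ pod(n) qⁿ = 1/ψ(q).
-- Write ψ(q) = A + B, where A collects the exponents divisible by 3 and B = q ψ(q⁹).  Multiplication
-- by a quaternion of norm 3 maps the quadruples of odd integers onto those that reduce modulo 3 to a
-- word of the tetracode; counting by norm, this says ψ(q³)⁴ = ψ(q⁹) (A³ + B³).  Comparing exponents
-- 3n + 2 in ψ(q³)⁴/ψ(q) = ψ(q⁹) (A² - A B + B²), the series Σ (-1)ⁿ pod(3n+2) qⁿ times ψ(q)⁴ is ψ(q³)³,
-- which is congruent to ψ(q)⁹ modulo 9 because f(q)³ ≡ f(q³) modulo 3.  So pod(3n+2) is, up to the
-- sign (-1)ⁿ, congruent to the coefficient of qⁿ in ψ(q)⁵.  On the other hand Σ r₅(8n+5) qⁿ = 112 ψ(q)⁵,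
-- by the parity dissection of φ(q) = Σ q^(x²), and 2 · 112 ≡ -1 modulo 9.

import Data.Integer.Properties as ℤₚ
import Data.Nat.Properties as ℕₚ
open import Algebra.Bundles using (CommutativeSemiring)
open import Data.Integer.Base as ℤ using (ℤ; +_; -[1+_]; 0ℤ; 1ℤ; -1ℤ; ∣_∣)
open import Data.Nat.Base as ℕ using (ℕ; zero; suc; _≤_; _<_; _≥_; z≤n; s≤s; s≤s⁻¹)
open import Data.Fin.Base using (Fin; zero; suc; toℕ; fromℕ<)
open import Data.Product using (Σ; _×_; _,_; ∃; proj₁; proj₂)
open import Function.Base using (_∘_)

-- The cubic identity helps because A³ + B³ = (A + B)(A² - A B + B²) and A + B = ψ(q). The exponents
-- of A are 0 and those of B are 1 modulo 3, so after division by ψ(q) only ψ(q⁹) B² = q² ψ(q⁹)³ has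
-- exponents 3n + 2. The tetracode has weight enumerator x⁴ + 8xy³; a zero coordinate contributes 2B
-- and a nonzero one A, whence 16 B (A³ + B³). The bijections live on ℤ, where linear changes of
-- variables are invertible. The price is θ(q), the sum of q^(k(k+1)/2) over all integers k, which
-- is 2ψ(q); the resulting powers of 2 are cancelled afterwards. The factor 112 is 7 · 16: the
-- exponents 4m + 1 of φ⁵ give 5 θ(q²) φ⁴ + q θ(q²)⁵, and for odd m the two terms become 5/2 θ⁵ and
-- θ⁵, together 7/2 · 32 ψ⁵. Identities of series are kept free of subtraction and division:
-- negative terms are moved across, and halves are avoided by doubling.

-- Polynomial identities in commutative semirings

module SemiringIdentities {c ℓ} (R : CommutativeSemiring c ℓ) where

  open CommutativeSemiring R
  open import Algebra.Solver.Ring.NaturalCoefficients.Default R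
  open import Relation.Binary.Reasoning.Setoid setoid

  double quintuple : Carrier → Carrier
  double x    = x + x
  quintuple x = x + x + x + x + x

  private
    double′ quintuple′ : ∀ {n} → Polynomial n → Polynomial n
    double′ x    = x :+ x
    quintuple′ x = x :+ x :+ x :+ x :+ x

  sixteen-fold-fourth : ∀ x y → x * (double y * (double y * (double y * double y))) ≈
                                double (double (double (double (x * (y * (y * (y * y)))))))
  sixteen-fold-fourth = solve 2 (λ x y → x :* (double′ y :* (double′ y :* (double′ y :* double′ y))) :=
    double′ (double′ (double′ (double′ (x :* (y :* (y :* (y :* y)))))))) refl

  rearrange : ∀ a b → a + (double b + (a + 0#)) ≈ double (a + b)
  rearrange = solve 2 (λ a b → a :+ (double′ b :+ (a :+ con 0)) := double′ (a :+ b)) refl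

  -- One monomial per word of the tetracode: `c` marks a coordinate divisible by 3, `a` one prime to
  -- 3. Eight words have a single zero and one has four, so the sum is 8a³c + c⁴.
  tetracode-enumerator : ∀ a b → let c = double b in
    (a * (a * (a * c)) + (a * (c * (a * a)) + (a * (a * (c * a)) + 0#))) +
    ((c * (a * (a * a)) + (c * (c * (c * c)) + (c * (a * (a * a)) + 0#))) +
    ((a * (a * (c * a)) + (a * (c * (a * a)) + (a * (a * (a * c)) + 0#))) + 0#)) ≈
    double (double (double (double (b * (a * a * a + b * b * b)))))
  tetracode-enumerator = solve 2 (λ a b → let c = double′ b in
    (a :* (a :* (a :* c)) :+ (a :* (c :* (a :* a)) :+ (a :* (a :* (c :* a)) :+ con 0))) :+
    ((c :* (a :* (a :* a)) :+ (c :* (c :* (c :* c)) :+ (c :* (a :* (a :* a)) :+ con 0))) :+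
    ((a :* (a :* (c :* a)) :+ (a :* (c :* (a :* a)) :+ (a :* (a :* (a :* c)) :+ con 0))) :+ con 0)) :=
    double′ (double′ (double′ (double′ (b :* (a :* a :* a :+ b :* b :* b)))))) refl

  -- A³ + B³ = (A + B)(A² - AB + B²), divided by A + B and without subtraction.
  inverse-cubes : ∀ {p a b} → p * (a + b) ≈ 1# →
                  p * (a * a * a + b * b * b) + a * b ≈ a * a + b * b
  inverse-cubes {p} {a} {b} inv = begin
    p * (a * a * a + b * b * b) + a * b                        ≈⟨ +-congˡ (*-identityˡ _) ⟨
    p * (a * a * a + b * b * b) + 1# * (a * b)                 ≈⟨ +-congˡ (*-congʳ inv) ⟨
    p * (a * a * a + b * b * b) + p * (a + b) * (a * b)        ≈⟨ solve 3 (λ p a b →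
        p :* (a :* a :* a :+ b :* b :* b) :+ p :* (a :+ b) :* (a :* b) :=
        p :* (a :+ b) :* (a :* a :+ b :* b)) refl p a b ⟩
    p * (a + b) * (a * a + b * b)                              ≈⟨ *-congʳ inv ⟩
    1# * (a * a + b * b)                                       ≈⟨ *-identityˡ _ ⟩
    a * a + b * b                                              ∎

  treble : Carrier → Carrier
  treble x = x + x + x

  -- If t³ and s agree modulo 3, then t⁹ and s³ agree modulo 9.
  cube-lift : ∀ {p t s y u} → p * t ≈ 1# → t * t * t ≈ s + treble y →
              t * (t * (t * (t * u))) ≈ s * (s * s) →
              let z = p * p * p * p * (s * s * y + treble (s * y * y) + treble (y * y * y)) in
              t * t * t * t * t ≈ u + treble (treble z)
  cube-lift {p} {t} {s} {y} {u} inv cube eq = begin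
    t * t * t * t * t
      ≈⟨ unit-multiple _ ⟨
    p * t * (p * t * (p * t * (p * t * (t * t * t * t * t))))
      ≈⟨ solve 2 (λ p t → p :* t :* (p :* t :* (p :* t :* (p :* t :* (t :* t :* t :* t :* t)))) :=
           p :* p :* p :* p :* (t :* t :* t :* (t :* t :* t) :* (t :* t :* t))) refl p t ⟩
    p * p * p * p * (t * t * t * (t * t * t) * (t * t * t))
      ≈⟨ *-congˡ (*-cong (*-cong cube cube) cube) ⟩
    p * p * p * p * ((s + treble y) * (s + treble y) * (s + treble y))
      ≈⟨ solve 3 (λ p s y → let treble′ = λ x → x :+ x :+ x in
           p :* p :* p :* p :* ((s :+ treble′ y) :* (s :+ treble′ y) :* (s :+ treble′ y)) :=
           p :* p :* p :* p :* (s :* (s :* s)) :+ treble′ (treble′ (p :* p :* p :* p :*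
             (s :* s :* y :+ treble′ (s :* y :* y) :+ treble′ (y :* y :* y))))) refl p s y ⟩
    p * p * p * p * (s * (s * s)) + treble (treble z)
      ≈⟨ +-congʳ (*-congˡ eq) ⟨
    p * p * p * p * (t * (t * (t * (t * u)))) + treble (treble z)
      ≈⟨ +-congʳ (solve 3 (λ p t u → p :* p :* p :* p :* (t :* (t :* (t :* (t :* u)))) :=
           p :* t :* (p :* t :* (p :* t :* (p :* t :* u)))) refl p t u) ⟩
    p * t * (p * t * (p * t * (p * t * u))) + treble (treble z)
      ≈⟨ +-congʳ (unit-multiple u) ⟩
    u + treble (treble z) ∎
    where
    z = p * p * p * p * (s * s * y + treble (s * y * y) + treble (y * y * y))
    drop : ∀ x → p * t * x ≈ x
    drop x = trans (*-congʳ inv) (*-identityˡ x)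
    unit-multiple : ∀ x → p * t * (p * t * (p * t * (p * t * x))) ≈ x
    unit-multiple x = trans (drop _) (trans (drop _) (trans (drop _) (drop x)))

  -- The binomial expansion, with every monomial nested to the right and its power of `x` last: the
  -- shape in which `section-product` strips the dilated factors one by one.
  fifth-power : ∀ e o x → let s = e + x * o in
    s * (s * (s * (s * s))) ≈
    e * (e * (e * (e * (e * 1#)))) + quintuple (e * (e * (e * (e * (o * x))))) +
    double (quintuple (e * (e * (e * (o * (o * (x * x))))))) +
    double (quintuple (e * (e * (o * (o * (o * (x * (x * x)))))))) +
    quintuple (e * (o * (o * (o * (o * (x * (x * (x * x)))))))) +
    o * (o * (o * (o * (o * (x * (x * (x * (x * x))))))))
  fifth-power = solve 3 (λ e o x → let s = e :+ x :* o in
    s :* (s :* (s :* (s :* s))) :=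
    e :* (e :* (e :* (e :* (e :* con 1)))) :+ quintuple′ (e :* (e :* (e :* (e :* (o :* x))))) :+
    double′ (quintuple′ (e :* (e :* (e :* (o :* (o :* (x :* x))))))) :+
    double′ (quintuple′ (e :* (e :* (o :* (o :* (o :* (x :* (x :* x)))))))) :+
    quintuple′ (e :* (o :* (o :* (o :* (o :* (x :* (x :* (x :* x)))))))) :+
    o :* (o :* (o :* (o :* (o :* (x :* (x :* (x :* (x :* x)))))))))  refl

  -- e, o, f stand for φ(q⁴), θ(q⁸), φ(q²), and t₂, t₄ for θ(q²), θ(q⁴).
  fourth-power-doubled : ∀ {e o x f t₂ t₄} →
    e * e + (x * o) * (x * o) ≈ f * f →
    t₄ * t₄ ≈ double (o * e) → t₂ * t₂ ≈ double (t₄ * f) →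
    ∀ w → let s = e + x * o in
    double (w * (s * (s * (s * s)))) ≈
    double (w * (e * (e * (e * (e * 1#))))) + double (double (treble (w * (e * (e * (o * (o * (x * x)))))))) +
    double (w * (o * (o * (o * (o * (x * (x * (x * x)))))))) +
    w * (t₂ * (t₂ * (t₂ * (t₂ * x))))
  fourth-power-doubled {e} {o} {x} {f} {t₂} {t₄} sum₂ pair₄ pair₂ w = begin
    double (w * (s * (s * (s * s))))
      ≈⟨ solve 4 (λ e o x w → let s = e :+ x :* o in double′ (w :* (s :* (s :* (s :* s)))) :=
           double′ (w :* (e :* (e :* (e :* (e :* con 1))))) :+
           double′ (double′ (treble′ (w :* (e :* (e :* (o :* (o :* (x :* x)))))))) :+
           double′ (w :* (o :* (o :* (o :* (o :* (x :* (x :* (x :* x)))))))) :+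
           w :* (x :* double′ (double′ (double′ (o :* e) :* (e :* e :+ (x :* o) :* (x :* o))))))
           refl e o x w ⟩
    rest + w * (x * double (double (double (o * e) * (e * e + (x * o) * (x * o)))))
      ≈⟨ +-congˡ (*-congˡ (*-congˡ odd-part)) ⟩
    rest + w * (x * (t₂ * t₂ * (t₂ * t₂)))
      ≈⟨ +-congˡ (solve 3 (λ w x t → w :* (x :* (t :* t :* (t :* t))) :=
          w :* (t :* (t :* (t :* (t :* x))))) refl w x t₂) ⟩
    rest + w * (t₂ * (t₂ * (t₂ * (t₂ * x)))) ∎
    where
    treble′ : ∀ {n} → Polynomial n → Polynomial n
    treble′ x = x :+ x :+ x
    s = e + x * o
    rest = double (w * (e * (e * (e * (e * 1#))))) +
           double (double (treble (w * (e * (e * (o * (o * (x * x)))))))) +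
           double (w * (o * (o * (o * (o * (x * (x * (x * x))))))))
    -- The odd powers of `x` in s⁴ add up to 4eox (e² + x²o²). Doubled, the factor of `x` is 8eo (e²
    -- + x²o²) = 4 t₄² f² = t₂⁴; without the doubling a half would appear.
    odd-part : double (double (double (o * e) * (e * e + (x * o) * (x * o)))) ≈ t₂ * t₂ * (t₂ * t₂)
    odd-part = begin
      double (double (double (o * e) * (e * e + (x * o) * (x * o))))
        ≈⟨ +-cong (+-cong inner inner) (+-cong inner inner) ⟩
      double (double (t₄ * t₄ * (f * f)))
        ≈⟨ solve 2 (λ t f → double′ (double′ (t :* t :* (f :* f))) :=
            double′ (t :* f) :* double′ (t :* f)) refl t₄ f ⟩
      double (t₄ * f) * double (t₄ * f)
        ≈⟨ *-cong pair₂ pair₂ ⟨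
      t₂ * t₂ * (t₂ * t₂) ∎
      where
      inner : double (o * e) * (e * e + (x * o) * (x * o)) ≈ t₄ * t₄ * (f * f)
      inner = *-cong (sym pair₄) sum₂

  -- `fifth-power` after extraction of the exponents 4m + 1: the powers 1, x², x³, x⁴ have become 0,
  -- x has become 1, and x⁵ has become x.
  fifth-power-section : ∀ f t x →
    f * (f * (f * (f * (f * 0#)))) + quintuple (f * (f * (f * (f * (t * 1#))))) +
    double (quintuple (f * (f * (f * (t * (t * 0#)))))) +
        double (quintuple (f * (f * (t * (t * (t * 0#)))))) +
    quintuple (f * (t * (t * (t * (t * 0#))))) + t * (t * (t * (t * (t * x)))) ≈
    quintuple (t * (f * (f * (f * f)))) + t * (t * (t * (t * (t * x))))
  fifth-power-section = solve 3 (λ f t x →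
    f :* (f :* (f :* (f :* (f :* con 0)))) :+ quintuple′ (f :* (f :* (f :* (f :* (t :* con 1))))) :+
    double′ (quintuple′ (f :* (f :* (f :* (t :* (t :* con 0)))))) :+
        double′ (quintuple′ (f :* (f :* (t :* (t :* (t :* con 0)))))) :+
    quintuple′ (f :* (t :* (t :* (t :* (t :* con 0))))) :+ t :* (t :* (t :* (t :* (t :* x)))) :=
    quintuple′ (t :* (f :* (f :* (f :* f)))) :+ t :* (t :* (t :* (t :* (t :* x))))) refl

  -- `fourth-power-doubled` after extraction of the odd exponents, with θ(q²) for `w`: only the term
  -- with the first power of `x` survives.
  fourth-power-section : ∀ f t u →
    double (t * (f * (f * (f * (f * 0#))))) + double (double (treble (t * (f * (f * (u * (u * 0#))))))) +
    double (t * (u * (u * (u * (u * 0#))))) + t * (t * (t * (t * (t * 1#)))) ≈ t * (t * (t * (t * t)))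
  fourth-power-section = solve 3 (λ f t u → let treble′ = λ x → x :+ x :+ x in
    double′ (t :* (f :* (f :* (f :* (f :* con 0))))) :+
        double′ (double′ (treble′ (t :* (f :* (f :* (u :* (u :* con 0))))))) :+
    double′ (t :* (u :* (u :* (u :* (u :* con 0))))) :+ t :* (t :* (t :* (t :* (t :* con 1)))) :=
        t :* (t :* (t :* (t :* t)))) refl

  double-quintuple : ∀ x y → double (quintuple x + y) ≈ quintuple (double x) + double y
  double-quintuple = solve 2 (λ x y → double′ (quintuple′ x :+ y) := quintuple′ (double′ x) :+ double′ y) refl

  -- Since s⁵ = 32t⁵ = 2w, both sides are 7 · 32 t⁵. Cancelling the outer doubling later leaves 7 ·
  -- 16 = 112.
  five-doubles : ∀ t → let s = double t ; w = double (double (double (double (t * t * t * t * t)))) in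
    quintuple (s * (s * (s * (s * s)))) + double (s * (s * (s * (s * s)))) ≈ double (quintuple w + double w)
  five-doubles = solve 1 (λ t → let s = double′ t ; w = double′ (double′ (double′ (double′ (t :* t :* t :* t :* t)))) in
    quintuple′ (s :* (s :* (s :* (s :* s)))) :+ double′ (s :* (s :* (s :* (s :* s)))) :=
    double′ (quintuple′ w :+ double′ w)) refl

  cube-of-sum : ∀ c x g → (c + x * g) * (c + x * g) * (c + x * g) ≈
    c * c * c + x * (x * (x * (g * g * g))) + treble (c * (x * g) * (c + x * g))
  cube-of-sum = solve 3 (λ c x g → (c :+ x :* g) :* (c :+ x :* g) :* (c :+ x :* g) :=
    c :* c :* c :+ x :* (x :* (x :* (g :* g :* g))) :+ (let t = c :* (x :* g) :* (c :+ x :* g) in t :+ t :+ t)) refl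

  -- Multiplying the cubic identity by p = 1/(a + bx) leaves b (a² - abx + b²x²); the negative term
  -- stands on the left. The nesting prepares the extraction of the exponents 3n + 2.
  multiply-inverse-cubes : ∀ {p a b x t} → p * (a + b * x) ≈ 1# →
    t * (t * (t * t)) ≈ b * (a * a * a + (b * x) * (b * x) * (b * x)) →
    t * (t * (t * (t * p))) + b * (a * (b * x)) ≈ b * (a * (a * 1#)) + b * (b * (b * (x * x)))
  multiply-inverse-cubes {p} {a} {b} {x} {t} inv fourth = begin
    t * (t * (t * (t * p))) + b * (a * (b * x))
      ≈⟨ +-congʳ (solve 2 (λ t p → t :* (t :* (t :* (t :* p))) := t :* (t :* (t :* t)) :* p) refl t p) ⟩
    t * (t * (t * t)) * p + b * (a * (b * x))
      ≈⟨ +-congʳ (*-congʳ fourth) ⟩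
    b * (a * a * a + (b * x) * (b * x) * (b * x)) * p + b * (a * (b * x))
      ≈⟨ solve 4 (λ p a b x → b :* (a :* a :* a :+ (b :* x) :* (b :* x) :* (b :* x)) :* p :+
          b :* (a :* (b :* x)) :=
           b :* (p :* (a :* a :* a :+ (b :* x) :* (b :* x) :* (b :* x)) :+ a :* (b :* x))) refl p a b x ⟩
    b * (p * (a * a * a + (b * x) * (b * x) * (b * x)) + a * (b * x))
      ≈⟨ *-congˡ (inverse-cubes inv) ⟩
    b * (a * a + (b * x) * (b * x))
      ≈⟨ solve 3 (λ a b x → b :* (a :* a :+ (b :* x) :* (b :* x)) :=
           b :* (a :* (a :* con 1)) :+ b :* (b :* (b :* (x :* x)))) refl a b x ⟩
    b * (a * (a * 1#)) + b * (b * (b * (x * x))) ∎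

  drop-zero : ∀ t a u → u + t * (a * (t * 0#)) ≈ u
  drop-zero = solve 3 (λ t a u → u :+ t :* (a :* (t :* con 0)) := u) refl

  collapse : ∀ t a → t * (a * (a * 0#)) + t * (t * (t * 1#)) ≈ t * (t * t)
  collapse = solve 2 (λ t a → t :* (a :* (a :* con 0)) :+ t :* (t :* (t :* con 1)) := t :* (t :* t)) refl

-- Shanks' finite form of Gauss's identity

module ShanksIdentity {c ℓ} (R : CommutativeSemiring c ℓ) where

  open CommutativeSemiring R
  open import Algebra.Solver.Ring.NaturalCoefficients.Default R
  open import Relation.Binary.Reasoning.Setoid setoid

  module Telescoping (q : Carrier)
    (+-cancel : ∀ x y z → x + z ≈ y + z → x ≈ y)
    (unit-cancel : ∀ g x y → x + q * g * y ≈ y + q * g * x → x ≈ y)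
    (p : ℕ → Carrier) where

    power : Carrier → ℕ → Carrier
    power x zero    = 1#
    power x (suc n) = x * power x n

    power-* : ∀ x y n → power (x * y) n ≈ power x n * power y n
    power-* x y zero    = sym (*-identityˡ 1#)
    power-* x y (suc n) = trans (*-congˡ (power-* x y n))
      (solve 4 (λ x y u v → x :* y :* (u :* v) := x :* u :* (y :* v)) refl x y (power x n) (power y n))

    power-cong : ∀ {x y} n → x ≈ y → power x n ≈ power y n
    power-cong zero    eq = refl
    power-cong (suc n) eq = *-cong eq (power-cong n eq)

    partialSum : Carrier → ℕ → Carrier
    partialSum x zero    = p 0
    partialSum x (suc m) = partialSum x m + p (suc m) * power x (suc m)

    oddPower : ℕ → Carrier
    oddPower m = q * power (q * q) m

    -- The hypothesis reads (1 - q^(2m+2)) p(m+1) = (1 - q^(2m+1)) p(m): up to the factor p(0), p(m)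
    -- is the product of (1 - q^(2i-1)) / (1 - q^(2i)) over 1 ≤ i ≤ m.
    module _ (step : ∀ m → p (suc m) + oddPower m * p m ≈ p m + q * oddPower m * p (suc m)) where

      -- A truncated q-difference equation. In (1 - x) S(x) - (1 - qx) S(q²x) the coefficient of x^s
      -- is (1 - q^(2s)) p(s) - (1 - q^(2s-1)) p(s-1), which `step` makes zero; only the cut at
      -- x^(m+1) leaves a boundary term, -(1 - q^(2m+1)) p(m).
      partialSum-shift : ∀ x m → let z = q * q * x in
        partialSum x m + q * x * partialSum z m + x * power x m * p m ≈
        x * partialSum x m + partialSum z m + oddPower m * (x * power x m) * p m
      partialSum-shift x zero = solve 3 (λ q x p →
        p :+ q :* x :* p :+ x :* con 1 :* p := x :* p :+ p :+ q :* con 1 :* (x :* con 1) :* p) refl q x (p 0)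
      -- The cancelled term is the left boundary term of the induction hypothesis, which must be
      -- present before the hypothesis can be applied.
      partialSum-shift x (suc m) = +-cancel _ _ (x * u * a) (begin
        s + b * (x * u) + q * x * (s′ + b * (z * power z m)) + x * (x * u) * b + x * u * a
          ≈⟨ +-congʳ (+-congʳ (+-congˡ (*-congˡ (+-congˡ (*-congˡ (*-congˡ (power-* (q * q) x m))))))) ⟩
        s + b * (x * u) + q * x * (s′ + b * (z * (v * u))) + x * (x * u) * b + x * u * a
          ≈⟨ solve 8 (λ q x s s′ u v a b →
               s :+ b :* (x :* u) :+ q :* x :* (s′ :+ b :* (q :* q :* x :* (v :* u))) :+
                   x :* (x :* u) :* b :+ x :* u :* a :=
               s :+ q :* x :* s′ :+ x :* u :* a :+
                 (b :* (x :* u) :+ q :* x :* b :* (q :* q :* x :* (v :* u)) :+ x :* (x :* u) :* b))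
               refl q x s s′ u v a b ⟩
        s + q * x * s′ + x * u * a + rest
          ≈⟨ +-congʳ (partialSum-shift x m) ⟩
        x * s + s′ + q * v * (x * u) * a + rest
          ≈⟨ solve 8 (λ q x s s′ u v a b →
               x :* s :+ s′ :+ q :* v :* (x :* u) :* a :+
                 (b :* (x :* u) :+ q :* x :* b :* (q :* q :* x :* (v :* u)) :+ x :* (x :* u) :* b) :=
               x :* s :+ s′ :+ q :* x :* b :* (q :* q :* x :* (v :* u)) :+ x :* (x :* u) :* b :+
                 x :* u :* (b :+ q :* v :* a))
               refl q x s s′ u v a b ⟩
        x * s + s′ + q * x * b * (q * q * x * (v * u)) + x * (x * u) * b + x * u * (b + q * v * a)
          ≈⟨ +-congˡ (*-congˡ (step m)) ⟩
        x * s + s′ + q * x * b * (q * q * x * (v * u)) + x * (x * u) * b + x * u * (a + q * (q * v) * b)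
          ≈⟨ solve 8 (λ q x s s′ u v a b →
               x :* s :+ s′ :+ q :* x :* b :* (q :* q :* x :* (v :* u)) :+ x :* (x :* u) :* b :+
                 x :* u :* (a :+ q :* (q :* v) :* b) :=
               x :* (s :+ b :* (x :* u)) :+ (s′ :+ b :* (q :* q :* x :* (v :* u))) :+
                 q :* (q :* q :* v) :* (x :* (x :* u)) :* b :+ x :* u :* a)
               refl q x s s′ u v a b ⟩
        x * (s + b * (x * u)) + (s′ + b * (z * (v * u))) + q * (q * q * v) * (x * (x * u)) * b + x * u * a
          ≈⟨ +-congʳ (+-congʳ (+-congˡ (+-congˡ (*-congˡ (*-congˡ (power-* (q * q) x m)))))) ⟨
        x * (s + b * (x * u)) + (s′ + b * (z * power z m)) + q * (q * q * v) * (x * (x * u)) * b +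
            x * u * a ∎)
        where
        z = q * q * x
        s = partialSum x m
        s′ = partialSum z m
        u = power x m
        v = power (q * q) m
        a = p m
        b = p (suc m)
        rest = b * (x * u) + q * x * b * (q * q * x * (v * u)) + x * (x * u) * b

      -- The exponents n(2n+1) and (n+1)(2n+1) are the triangular numbers of index 2n and 2n+1, so
      -- these are the first 2n terms of ψ.
      triangularSum : ℕ → Carrier
      triangularSum zero    = 0#
      triangularSum (suc n) = triangularSum n + (power (oddPower n) n + oddPower n * power (oddPower n) n)

      -- Shanks' sum of p(s) q^(s(2n+1)) over s < n. At n = 0 it is empty, which `partialSum` cannot
      -- express because it always contains the term s = 0.
      remainderSum : ℕ → Carrier
      remainderSum zero    = 0#
      remainderSum (suc n) = partialSum (oddPower (suc n)) n

      remainderSum-suc : ∀ n → remainderSum n + p n * power (oddPower n) n ≈ partialSum (oddPower n) n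
      remainderSum-suc zero    = trans (+-identityˡ _) (*-identityʳ (p 0))
      remainderSum-suc (suc n) = refl

      partialSum-cong : ∀ {x y} n → x ≈ y → partialSum x n ≈ partialSum y n
      partialSum-cong zero    eq = refl
      partialSum-cong (suc n) eq = +-cong (partialSum-cong n eq) (*-congˡ (power-cong (suc n) eq))

      -- Both sides for n + 1 satisfy V (1 - q x) = W (1 - x) with the same W, where x = q²ⁿ⁺¹.
      triangularSum-* : ∀ n → triangularSum n * p n ≈ remainderSum n
      triangularSum-* zero    = zeroˡ (p 0)
      triangularSum-* (suc n) = trans (unit-cancel x V Z (+-cancel _ _ (x * W + W) (begin
        V + q * x * Z + (x * W + W)
          ≈⟨ solve 5 (λ q x V Z W → V :+ q :* x :* Z :+ (x :* W :+ W) :=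
              (V :+ x :* W) :+ (W :+ q :* x :* Z)) refl q x V Z W ⟩
        (V + x * W) + (W + q * x * Z)
          ≈⟨ +-cong V-equation Z-equation ⟩
        (W + q * x * V) + (x * W + Z)
          ≈⟨ solve 5 (λ q x V Z W → (W :+ q :* x :* V) :+ (x :* W :+ Z) :=
              Z :+ q :* x :* V :+ (x :* W :+ W)) refl q x V Z W ⟩
        Z + q * x * V + (x * W + W) ∎))) (partialSum-cong n (*-assoc′ q (power (q * q) n)))
        where
        x = oddPower n
        u = power x n
        V = triangularSum (suc n) * p (suc n)
        W = partialSum x n + x * u * p n
        Z = partialSum (q * q * x) n
        *-assoc′ : ∀ q v → q * q * (q * v) ≈ q * (q * q * v)
        *-assoc′ = solve 2 (λ q v → q :* q :* (q :* v) := q :* (q :* q :* v)) refl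
        -- Of the two new triangular terms, the first extends the sum over s < n by its term s = n,
        -- and the second is a boundary term of `partialSum-shift`.
        W-equation : triangularSum (suc n) * p n ≈ W
        W-equation = begin
          (triangularSum n + (u + x * u)) * p n
            ≈⟨ solve 4 (λ t u x p → (t :+ (u :+ x :* u)) :* p := t :* p :+ p :* u :+ x :* u :* p) refl
                (triangularSum n) u x (p n) ⟩
          triangularSum n * p n + p n * u + x * u * p n
            ≈⟨ +-congʳ (+-congʳ (triangularSum-* n)) ⟩
          remainderSum n + p n * u + x * u * p n
            ≈⟨ +-congʳ (remainderSum-suc n) ⟩
          W ∎
        V-equation : V + x * W ≈ W + q * x * V
        V-equation = begin
          t * b + x * W           ≈⟨ +-congˡ (*-congˡ W-equation) ⟨
          t * b + x * (t * a)     ≈⟨ solve 4 (λ t a b x → t :* b :+ x :* (t :* a) :=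
              t :* (b :+ x :* a)) refl t a b x ⟩
          t * (b + x * a)         ≈⟨ *-congˡ (step n) ⟩
          t * (a + q * x * b)     ≈⟨ solve 5 (λ q t a b x → t :* (a :+ q :* x :* b) :=
              t :* a :+ q :* x :* (t :* b)) refl q t a b x ⟩
          t * a + q * x * (t * b) ≈⟨ +-congʳ W-equation ⟩
          W + q * x * V           ∎
          where
          t = triangularSum (suc n)
          a = p n
          b = p (suc n)
        -- At x = q^(2n+1) the factor `oddPower n` in the boundary term is x itself, so the right
        -- side collects to x W + Z.
        Z-equation : W + q * x * Z ≈ x * W + Z
        Z-equation = begin
          s + x * u * a + q * x * Z            ≈⟨ solve 6
              (λ q s x u a Z → s :+ x :* u :* a :+ q :* x :* Z :=
                  s :+ q :* x :* Z :+ x :* u :* a) refl q s x u a Z ⟩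
          s + q * x * Z + x * u * a            ≈⟨ partialSum-shift x n ⟩
          x * s + Z + x * (x * u) * a          ≈⟨ solve 5
              (λ s x u a Z → x :* s :+ Z :+ x :* (x :* u) :* a :=
                  x :* (s :+ x :* u :* a) :+ Z) refl s x u a Z ⟩
          x * (s + x * u * a) + Z              ∎
          where
          s = partialSum x n
          a = p n

-- Counting by bijections

module Enumerations where

  import Data.List.Relation.Unary.Unique.Propositional.Properties as Uniqueₚ
  open import Data.List.Base using ([]; map; _++_)
  open import Data.List.Membership.Propositional using (_∈_)
  open import Data.List.Membership.Propositional.Properties
    using (∈-map⁺; ∈-map⁻; ∈-++⁺ˡ; ∈-++⁺ʳ; ∈-++⁻)
  open import Data.List.Membership.Propositional.Properties.WithK using (unique∧set⇒bag)
  open import Data.List.Properties using (length-map; length-++)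
  open import Data.List.Relation.Binary.BagAndSetEquality using (∼bag⇒↭)
  open import Data.List.Relation.Binary.Permutation.Propositional.Properties using (↭-length)
  open import Data.List.Relation.Unary.AllPairs using ([])
  open import Data.Sum.Base as Sum using (inj₁; inj₂)
  open import Data.Sum.Properties using (inj₁-injective; inj₂-injective)
  open import Defs using (Enumeration; elements; unique; sound; complete; count)
  open import Function.Bundles using (mk⇔)
  open import Relation.Binary.PropositionalEquality
  open import Relation.Nullary.Negation using (¬_)

  private variable
    A B : Set
    P : A → Set
    Q : B → Set

  -- `g` inverts `f` everywhere, whereas `f` needs to invert `g` only on Q: the target type may
  -- contain elements that are not in the range of `f`.
  image : Enumeration P → (f : A → B) (g : B → A) → (∀ x → g (f x) ≡ x) →
          (∀ {x} → P x → Q (f x)) → (∀ {y} → Q y → P (g y)) → (∀ {y} → Q y → f (g y) ≡ y) →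
          Enumeration Q
  image E f g gf P⇒Q Q⇒P fg .elements = map f (elements E)
  image E f g gf P⇒Q Q⇒P fg .unique   =
    Uniqueₚ.map⁺ (λ {x} {y} eq → trans (sym (gf x)) (trans (cong g eq) (gf y))) (unique E)
  image E f g gf P⇒Q Q⇒P fg .sound y∈ with ∈-map⁻ f y∈
  ... | x , x∈ , refl = P⇒Q (sound E x∈)
  image E f g gf P⇒Q Q⇒P fg .complete Qy =
    subst (_∈ map f (elements E)) (fg Qy) (∈-map⁺ f (complete E (Q⇒P Qy)))

  count-⇔ : ∀ {P Q : A → Set} (E : Enumeration P) (F : Enumeration Q) →
            (∀ {x} → P x → Q x) → (∀ {x} → Q x → P x) → count E ≡ count F
  count-⇔ E F P⇒Q Q⇒P = ↭-length (∼bag⇒↭ (unique∧set⇒bag (unique E) (unique F)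
    (mk⇔ (λ x∈ → complete F (P⇒Q (sound E x∈))) (λ x∈ → complete E (Q⇒P (sound F x∈))))))

  count-≡ : (E : Enumeration P) (F : Enumeration Q) (f : A → B) (g : B → A) →
            (∀ x → g (f x) ≡ x) → (∀ {x} → P x → Q (f x)) → (∀ {y} → Q y → P (g y)) →
            (∀ {y} → Q y → f (g y) ≡ y) → count E ≡ count F
  count-≡ {P = P} {Q = Q} E F f g gf P⇒Q Q⇒P fg = trans (sym (length-map f (elements E)))
    (count-⇔ (image {P = P} {Q = Q} E f g gf P⇒Q Q⇒P fg) F (λ Qy → Qy) (λ Qy → Qy))

  empty : (∀ {x} → ¬ P x) → Enumeration P
  empty ¬P .elements    = []
  empty ¬P .unique      = []
  empty ¬P .sound ()
  empty ¬P .complete Px with () ← ¬P Px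

  count-empty : (E : Enumeration P) → (∀ {x} → ¬ P x) → count E ≡ 0
  count-empty E ¬P = count-⇔ E (empty ¬P) (λ Px → Px) (λ Px → Px)

  disjointUnion : Enumeration P → Enumeration Q → Enumeration Sum.[ P , Q ]
  disjointUnion E F .elements = map inj₁ (elements E) ++ map inj₂ (elements F)
  disjointUnion E F .unique   = Uniqueₚ.++⁺
    (Uniqueₚ.map⁺ inj₁-injective (unique E)) (Uniqueₚ.map⁺ inj₂-injective (unique F)) disjoint
    where
    disjoint : ∀ {z} → ¬ (z ∈ map inj₁ (elements E) × z ∈ map inj₂ (elements F))
    disjoint (∈ˡ , ∈ʳ) with ∈-map⁻ inj₁ ∈ˡ | ∈-map⁻ inj₂ ∈ʳ
    ... | _ , _ , refl | _ , _ , ()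
  disjointUnion E F .sound z∈ with ∈-++⁻ (map inj₁ (elements E)) z∈
  ... | inj₁ ∈ˡ with _ , x∈ , refl ← ∈-map⁻ inj₁ ∈ˡ = sound E x∈
  ... | inj₂ ∈ʳ with _ , y∈ , refl ← ∈-map⁻ inj₂ ∈ʳ = sound F y∈
  disjointUnion E F .complete {inj₁ x} Px = ∈-++⁺ˡ (∈-map⁺ inj₁ (complete E Px))
  disjointUnion E F .complete {inj₂ y} Qy = ∈-++⁺ʳ _ (∈-map⁺ inj₂ (complete F Qy))

  count-disjointUnion : (E : Enumeration P) (F : Enumeration Q) →
                        count (disjointUnion E F) ≡ count E ℕ.+ count F
  count-disjointUnion E F = trans (length-++ (map inj₁ (elements E)))
    (cong₂ ℕ._+_ (length-map inj₁ (elements E)) (length-map inj₂ (elements F)))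

open Enumerations

-- Formal power series with integer coefficients

module PowerSeries where

  open import Algebra.Structures using (IsCommutativeSemiring)
  open import Algebra.Structures.Biased using (isCommutativeSemiringˡ)
  open import Data.Integer.Tactic.RingSolver using (solve-∀)
  open import Relation.Binary.PropositionalEquality
  open import Relation.Binary.Structures using (IsEquivalence)

  Series : Set
  Series = ℕ → ℤ

  infix 4 _≈_
  infixl 6 _⊕_
  infixl 7 _⊗_

  _≈_ : Series → Series → Set
  f ≈ g = ∀ n → f n ≡ g n

  _⊕_ : Series → Series → Series
  (f ⊕ g) n = f n ℤ.+ g n

  -- The recursion runs along the tail of `f`. On lists `convolve` follows the same recursion, so
  -- that counting turns products of sets into this product.
  _⊗_ : Series → Series → Series
  (f ⊗ g) zero    = f 0 ℤ.* g 0
  (f ⊗ g) (suc n) = f 0 ℤ.* g (suc n) ℤ.+ (f ∘ suc ⊗ g) n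

  X·_ : Series → Series
  (X· f) zero    = 0ℤ
  (X· f) (suc n) = f n

  const : ℤ → Series
  const a zero    = a
  const a (suc n) = 0ℤ

  𝟘 𝟙 X : Series
  𝟘 _ = 0ℤ
  𝟙   = const 1ℤ
  X   = X· 𝟙

  ≈-isEquivalence : IsEquivalence _≈_
  ≈-isEquivalence = record
    { refl  = λ _ → refl
    ; sym   = λ p n → sym (p n)
    ; trans = λ p q n → trans (p n) (q n)
    }

  -- Allows a truncation to replace an infinite sum or product when a single coefficient is
  -- computed.
  ⊗-local : ∀ {f f′ g g′} n → (∀ {i} → i ≤ n → f i ≡ f′ i) → (∀ {i} → i ≤ n → g i ≡ g′ i) →
            (f ⊗ g) n ≡ (f′ ⊗ g′) n
  ⊗-local zero    p q = cong₂ ℤ._*_ (p z≤n) (q z≤n)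
  ⊗-local (suc n) p q = cong₂ ℤ._+_ (cong₂ ℤ._*_ (p z≤n) (q ℕₚ.≤-refl))
    (⊗-local n (p ∘ s≤s) (q ∘ ℕₚ.m≤n⇒m≤1+n))

  ⊗-cong : ∀ {f f′ g g′} → f ≈ f′ → g ≈ g′ → f ⊗ g ≈ f′ ⊗ g′
  ⊗-cong p q n = ⊗-local n (λ {i} _ → p i) (λ {i} _ → q i)

  ⊗-zeroˡ : ∀ f → 𝟘 ⊗ f ≈ 𝟘
  ⊗-zeroˡ f zero    = refl
  ⊗-zeroˡ f (suc n) = trans (ℤₚ.+-identityˡ _) (⊗-zeroˡ f n)

  ⊗-distribʳ : ∀ f g h → (g ⊕ h) ⊗ f ≈ g ⊗ f ⊕ h ⊗ f
  ⊗-distribʳ f g h zero    = ℤₚ.*-distribʳ-+ (f 0) (g 0) (h 0)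
  ⊗-distribʳ f g h (suc n) = trans
    (cong₂ ℤ._+_ (ℤₚ.*-distribʳ-+ (f (suc n)) (g 0) (h 0)) (⊗-distribʳ f (g ∘ suc) (h ∘ suc) n))
    (lemma (g 0 ℤ.* f (suc n)) (h 0 ℤ.* f (suc n)) ((g ∘ suc ⊗ f) n) ((h ∘ suc ⊗ f) n))
    where
    lemma : ∀ a b c d → (a ℤ.+ b) ℤ.+ (c ℤ.+ d) ≡ (a ℤ.+ c) ℤ.+ (b ℤ.+ d)
    lemma = solve-∀

  ⊗-sucʳ : ∀ f g n → (f ⊗ g) (suc n) ≡ f (suc n) ℤ.* g 0 ℤ.+ (f ⊗ (g ∘ suc)) n
  ⊗-sucʳ f g zero    = ℤₚ.+-comm (f 0 ℤ.* g 1) (f 1 ℤ.* g 0)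
  ⊗-sucʳ f g (suc n) = trans (cong (ℤ._+_ (f 0 ℤ.* g (suc (suc n)))) (⊗-sucʳ (f ∘ suc) g n))
    (lemma (f 0 ℤ.* g (suc (suc n))) (f (suc (suc n)) ℤ.* g 0) _)
    where
    lemma : ∀ a b c → a ℤ.+ (b ℤ.+ c) ≡ b ℤ.+ (a ℤ.+ c)
    lemma = solve-∀

  ⊗-comm : ∀ f g → f ⊗ g ≈ g ⊗ f
  ⊗-comm f g zero    = ℤₚ.*-comm (f 0) (g 0)
  ⊗-comm f g (suc n) = trans (cong₂ ℤ._+_ (ℤₚ.*-comm (f 0) (g (suc n))) (⊗-comm (f ∘ suc) g n))
    (sym (⊗-sucʳ g f n))

  scale-⊗ : ∀ a f g n → ((λ i → a ℤ.* f i) ⊗ g) n ≡ a ℤ.* (f ⊗ g) n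
  scale-⊗ a f g zero    = ℤₚ.*-assoc a (f 0) (g 0)
  scale-⊗ a f g (suc n) = trans (cong₂ ℤ._+_ (ℤₚ.*-assoc a (f 0) (g (suc n))) (scale-⊗ a (f ∘ suc) g n))
    (sym (ℤₚ.*-distribˡ-+ a _ _))

  ⊗-assoc : ∀ f g h → (f ⊗ g) ⊗ h ≈ f ⊗ (g ⊗ h)
  ⊗-assoc f g h zero    = ℤₚ.*-assoc (f 0) (g 0) (h 0)
  ⊗-assoc f g h (suc n) = begin
    f 0 ℤ.* g 0 ℤ.* h (suc n) ℤ.+ (((λ i → f 0 ℤ.* g (suc i)) ⊕ f ∘ suc ⊗ g) ⊗ h) n
      ≡⟨ cong (ℤ._+_ (f 0 ℤ.* g 0 ℤ.* h (suc n)))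
           (trans (⊗-distribʳ h (λ i → f 0 ℤ.* g (suc i)) (f ∘ suc ⊗ g) n)
             (cong₂ ℤ._+_ (scale-⊗ (f 0) (g ∘ suc) h n) (⊗-assoc (f ∘ suc) g h n))) ⟩
    f 0 ℤ.* g 0 ℤ.* h (suc n) ℤ.+ (f 0 ℤ.* (g ∘ suc ⊗ h) n ℤ.+ (f ∘ suc ⊗ (g ⊗ h)) n)
      ≡⟨ lemma (f 0) (g 0) (h (suc n)) ((g ∘ suc ⊗ h) n) ((f ∘ suc ⊗ (g ⊗ h)) n) ⟩
    f 0 ℤ.* (g ⊗ h) (suc n) ℤ.+ (f ∘ suc ⊗ (g ⊗ h)) n ∎
    where
    open ≡-Reasoning
    lemma : ∀ a b c d e → a ℤ.* b ℤ.* c ℤ.+ (a ℤ.* d ℤ.+ e) ≡ a ℤ.* (b ℤ.* c ℤ.+ d) ℤ.+ e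
    lemma = solve-∀

  const-⊗ : ∀ a f n → (const a ⊗ f) n ≡ a ℤ.* f n
  const-⊗ a f zero    = refl
  const-⊗ a f (suc n) = trans (cong (ℤ._+_ (a ℤ.* f (suc n))) (⊗-zeroˡ f n)) (ℤₚ.+-identityʳ _)

  X-⊗ : ∀ f → X ⊗ f ≈ X· f
  X-⊗ f zero    = refl
  X-⊗ f (suc n) = trans (ℤₚ.+-identityˡ _) (trans (const-⊗ 1ℤ f n) (ℤₚ.*-identityˡ (f n)))

  seriesIsCommutativeSemiring : IsCommutativeSemiring _≈_ _⊕_ _⊗_ 𝟘 𝟙
  seriesIsCommutativeSemiring = isCommutativeSemiringˡ record
    { +-isCommutativeMonoid = record
      { isMonoid = record
        { isSemigroup = record
          { isMagma = record { isEquivalence = ≈-isEquivalence ; ∙-cong = λ p q n → cong₂ ℤ._+_ (p n) (q n) }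
          ; assoc = λ f g h n → ℤₚ.+-assoc (f n) (g n) (h n)
          }
        ; identity = (λ f n → ℤₚ.+-identityˡ (f n)) , (λ f n → ℤₚ.+-identityʳ (f n))
        }
      ; comm = λ f g n → ℤₚ.+-comm (f n) (g n)
      }
    ; *-isCommutativeMonoid = record
      { isMonoid = record
        { isSemigroup = record
          { isMagma = record { isEquivalence = ≈-isEquivalence ; ∙-cong = ⊗-cong }
          ; assoc = ⊗-assoc
          }
        ; identity = ⊗-identityˡ , (λ f n → trans (⊗-comm f 𝟙 n) (⊗-identityˡ f n))
        }
      ; comm = ⊗-comm
      }
    ; distribʳ = ⊗-distribʳ
    ; zeroˡ = ⊗-zeroˡ
    }
    where
    ⊗-identityˡ : ∀ f → 𝟙 ⊗ f ≈ f
    ⊗-identityˡ f n = trans (const-⊗ 1ℤ f n) (ℤₚ.*-identityˡ (f n))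

  seriesSemiring : CommutativeSemiring _ _
  seriesSemiring = record { isCommutativeSemiring = seriesIsCommutativeSemiring }

  -- spread k j f is q^j f(q^(k+1)), and section k j extracts the exponents j + (k+1) n.

  spread : ∀ {A : Set} → A → (k j : ℕ) → (ℕ → A) → ℕ → A
  spread z k zero    f zero    = f 0
  spread z k zero    f (suc n) = spread z k k (f ∘ suc) n
  spread z k (suc j) f zero    = z
  spread z k (suc j) f (suc n) = spread z k j f n

  dilate : ℕ → Series → Series
  dilate k = spread 0ℤ k 0

  section : (k j : ℕ) → Series → Series
  section k j f n = f (j ℕ.+ n ℕ.* suc k)

  ⊗-spread-+ : ∀ k j f g n → (spread 0ℤ k j f ⊗ g) (j ℕ.+ n) ≡ (dilate k f ⊗ g) n
  ⊗-spread-+ k zero    f g n = refl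
  ⊗-spread-+ k (suc j) f g n = trans (ℤₚ.+-identityˡ _) (⊗-spread-+ k j f g n)

  ⊗-spread-< : ∀ {k j} f g {n} → n < j → (spread 0ℤ k j f ⊗ g) n ≡ 0ℤ
  ⊗-spread-< f g {zero}  (s≤s _)   = refl
  ⊗-spread-< f g {suc n} (s≤s n<j) = trans (ℤₚ.+-identityˡ _) (⊗-spread-< f g n<j)

  -- All exponents of `dilate k f` are multiples of k + 1, so multiplication by it keeps every
  -- residue class and acts there as multiplication by `f`.
  section-dilate-⊗ : ∀ {k j} → j ≤ k → ∀ f g → section k j (dilate k f ⊗ g) ≈ f ⊗ section k j g
  -- The rest of `dilate k f` starts in degree k + 1, which exceeds j, so only `f 0` reaches the
  -- lowest coefficient of the class.
  section-dilate-⊗ {k} {j} j≤k f g zero rewrite ℕₚ.+-identityʳ j = lemma j j≤k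
    where
    lemma : ∀ j → j ≤ k → (dilate k f ⊗ g) j ≡ f 0 ℤ.* g j
    lemma zero    _   = refl
    lemma (suc j) j<k = trans (cong (ℤ._+_ (f 0 ℤ.* g (suc j))) (⊗-spread-< (f ∘ suc) g j<k))
        (ℤₚ.+-identityʳ _)
  section-dilate-⊗ {k} {j} j≤k f g (suc n) = begin
    (dilate k f ⊗ g) (j ℕ.+ suc (k ℕ.+ n ℕ.* suc k))
      ≡⟨ cong (dilate k f ⊗ g) shuffle ⟩
    f 0 ℤ.* g (suc (k ℕ.+ (j ℕ.+ n ℕ.* suc k))) ℤ.+
      (spread 0ℤ k k (f ∘ suc) ⊗ g) (k ℕ.+ (j ℕ.+ n ℕ.* suc k))
      ≡⟨ cong₂ ℤ._+_ (cong (λ i → f 0 ℤ.* g i) (sym shuffle))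
           (trans (⊗-spread-+ k k (f ∘ suc) g _) (section-dilate-⊗ j≤k (f ∘ suc) g n)) ⟩
    f 0 ℤ.* section k j g (suc n) ℤ.+ (f ∘ suc ⊗ section k j g) n ∎
    where
    open ≡-Reasoning
    shuffle : j ℕ.+ suc (k ℕ.+ n ℕ.* suc k) ≡ suc (k ℕ.+ (j ℕ.+ n ℕ.* suc k))
    shuffle = trans (ℕₚ.+-suc j _) (cong suc (trans (sym (ℕₚ.+-assoc j k _))
      (trans (cong (ℕ._+ n ℕ.* suc k) (ℕₚ.+-comm j k)) (ℕₚ.+-assoc k j _))))

  spread-cong : ∀ k j {f g} → f ≈ g → spread 0ℤ k j f ≈ spread 0ℤ k j g
  spread-cong k zero    eq zero    = eq 0
  spread-cong k zero    eq (suc n) = spread-cong k k (eq ∘ suc) n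
  spread-cong k (suc j) eq zero    = refl
  spread-cong k (suc j) eq (suc n) = spread-cong k j eq n

  spread-⊕ : ∀ k j f g → spread 0ℤ k j (f ⊕ g) ≈ spread 0ℤ k j f ⊕ spread 0ℤ k j g
  spread-⊕ k zero    f g zero    = refl
  spread-⊕ k zero    f g (suc n) = spread-⊕ k k (f ∘ suc) (g ∘ suc) n
  spread-⊕ k (suc j) f g zero    = refl
  spread-⊕ k (suc j) f g (suc n) = spread-⊕ k j f g n

  spread-scale : ∀ k j a f n → spread 0ℤ k j (λ i → a ℤ.* f i) n ≡ a ℤ.* spread 0ℤ k j f n
  spread-scale k zero    a f zero    = refl
  spread-scale k zero    a f (suc n) = spread-scale k k a (f ∘ suc) n
  spread-scale k (suc j) a f zero    = sym (ℤₚ.*-zeroʳ a)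
  spread-scale k (suc j) a f (suc n) = spread-scale k j a f n

  spread-⊗ : ∀ k j f g → spread 0ℤ k j (f ⊗ g) ≈ spread 0ℤ k j f ⊗ dilate k g
  spread-⊗ k zero    f g zero    = refl
  spread-⊗ k zero    f g (suc n) = trans (spread-⊕ k k (λ i → f 0 ℤ.* g (suc i)) (f ∘ suc ⊗ g) n)
    (cong₂ ℤ._+_ (spread-scale k k (f 0) (g ∘ suc) n) (spread-⊗ k k (f ∘ suc) g n))
  spread-⊗ k (suc j) f g zero    = refl
  spread-⊗ k (suc j) f g (suc n) = trans (spread-⊗ k j f g n) (sym (ℤₚ.+-identityˡ _))

  dilate-⊗ : ∀ k f g → dilate k (f ⊗ g) ≈ dilate k f ⊗ dilate k g
  dilate-⊗ k = spread-⊗ k 0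

open PowerSeries

-- Weighted sets and their generating functions

module WeightedSets where

  import Data.List.Relation.Unary.Unique.Propositional.Properties as Uniqueₚ
  open import Data.List.Base using (List; []; _∷_; map; _++_; length; cartesianProduct; upTo)
  open import Data.List.Membership.Propositional using (_∈_)
  open import Data.List.Membership.Propositional.Properties
    using (∈-++⁺ˡ; ∈-++⁺ʳ; ∈-++⁻; ∈-cartesianProduct⁺; ∈-cartesianProduct⁻; ∈-upTo⁺)
  open import Data.List.Properties using (length-map; length-++)
  open import Data.List.Relation.Unary.AllPairs using ([]; _∷_)
  open import Data.List.Relation.Unary.Unique.Propositional using (Unique)
  open import Data.Sum.Base as Sum using (_⊎_; inj₁; inj₂)
  open import Defs
    using (Enumeration; elements; unique; sound; complete; count; enumerate-filter; interval;
        interval-unique; ∈-interval)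
  open import Function.Bundles using (_↔_; Inverse)
  open import Relation.Binary.PropositionalEquality
  open import Relation.Nullary.Negation using (¬_)

  private variable
    A B : Set

  -- The index set of a theta series. Enumerated fibres make the generating function exist, and
  -- weight-preserving bijections then prove identities of series.
  record Weighted : Set₁ where
    field
      Carrier : Set
      weight  : Carrier → ℕ
      fibre   : ∀ n → Enumeration (λ x → weight x ≡ n)

  open Weighted public

  gf : Weighted → Series
  gf W n = + count (fibre W n)

  gf-↔ : (V W : Weighted) (i : Carrier V ↔ Carrier W) →
         (∀ x → weight W (Inverse.to i x) ≡ weight V x) → gf V ≈ gf W
  gf-↔ V W i w n = cong +_ (count-≡ (fibre V n) (fibre W n) to from (λ x → strictlyInverseʳ x)
    (λ {x} eq → trans (w x) eq)
    (λ {y} eq → trans (trans (sym (w (from y))) (cong (weight W) (strictlyInverseˡ y))) eq)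
    (λ {y} _ → strictlyInverseˡ y))
    where open Inverse i

  convolve : (ℕ → List A) → (ℕ → List B) → ℕ → List (A × B)
  convolve F G zero    = cartesianProduct (F 0) (G 0)
  convolve F G (suc n) = cartesianProduct (F 0) (G (suc n)) ++ convolve (F ∘ suc) G n

  ∈-convolve⁻ : ∀ (F : ℕ → List A) (G : ℕ → List B) n {x y} → (x , y) ∈ convolve F G n →
                ∃ λ i → ∃ λ j → i ℕ.+ j ≡ n × x ∈ F i × y ∈ G j
  ∈-convolve⁻ F G zero    xy∈ = 0 , 0 , refl , ∈-cartesianProduct⁻ (F 0) (G 0) xy∈
  ∈-convolve⁻ F G (suc n) xy∈ with ∈-++⁻ (cartesianProduct (F 0) (G (suc n))) xy∈
  ... | inj₁ ∈ˡ = 0 , suc n , refl , ∈-cartesianProduct⁻ (F 0) (G (suc n)) ∈ˡ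
  ... | inj₂ ∈ʳ with i , j , eq , x∈ , y∈ ← ∈-convolve⁻ (F ∘ suc) G n ∈ʳ = suc i , j , cong suc eq , x∈ , y∈

  ∈-convolve⁺ : ∀ (F : ℕ → List A) (G : ℕ → List B) i j {x y} → x ∈ F i → y ∈ G j →
                (x , y) ∈ convolve F G (i ℕ.+ j)
  ∈-convolve⁺ F G zero    zero    x∈ y∈ = ∈-cartesianProduct⁺ x∈ y∈
  ∈-convolve⁺ F G zero    (suc j) x∈ y∈ = ∈-++⁺ˡ (∈-cartesianProduct⁺ x∈ y∈)
  ∈-convolve⁺ F G (suc i) j       x∈ y∈ = ∈-++⁺ʳ _ (∈-convolve⁺ (F ∘ suc) G i j x∈ y∈)

  -- The last hypothesis says that an element of `F` determines its degree; otherwise one pair could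
  -- occur in two blocks.
  convolve-unique : ∀ (F : ℕ → List A) (G : ℕ → List B) n → (∀ i → Unique (F i)) → (∀ j → Unique (G j)) →
                    (∀ {i j x} → x ∈ F i → x ∈ F j → i ≡ j) → Unique (convolve F G n)
  convolve-unique F G zero    F! G! F# = Uniqueₚ.cartesianProduct⁺ (F! 0) (G! 0)
  convolve-unique F G (suc n) F! G! F# = Uniqueₚ.++⁺ (Uniqueₚ.cartesianProduct⁺ (F! 0) (G! (suc n)))
    (convolve-unique (F ∘ suc) G n (F! ∘ suc) G! (λ p q → ℕₚ.suc-injective (F# p q))) disjoint
    where
    disjoint : ∀ {z} → ¬ (z ∈ cartesianProduct (F 0) (G (suc n)) × z ∈ convolve (F ∘ suc) G n)
    disjoint (∈ˡ , ∈ʳ) with ∈-convolve⁻ (F ∘ suc) G n ∈ʳ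
    ... | i , _ , _ , x∈ , _ with () ← F# (proj₁ (∈-cartesianProduct⁻ (F 0) (G (suc n)) ∈ˡ)) x∈

  length-cartesianProduct : ∀ (xs : List A) (ys : List B) →
                            length (cartesianProduct xs ys) ≡ length xs ℕ.* length ys
  length-cartesianProduct []       ys = refl
  length-cartesianProduct (x ∷ xs) ys = trans (length-++ (map (x ,_) ys))
    (cong₂ ℕ._+_ (length-map (x ,_) ys) (length-cartesianProduct xs ys))

  length-convolve : ∀ (F : ℕ → List A) (G : ℕ → List B) n →
                    + length (convolve F G n) ≡ ((λ i → + length (F i)) ⊗ (λ j → + length (G j))) n
  length-convolve F G zero    = trans (cong +_ (length-cartesianProduct (F 0) (G 0)))
      (ℤₚ.pos-* (length (F 0)) _)
  length-convolve F G (suc n) = begin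
    + length (convolve F G (suc n))
      ≡⟨ cong +_ (length-++ (cartesianProduct (F 0) (G (suc n)))) ⟩
    + length (cartesianProduct (F 0) (G (suc n))) ℤ.+ + length (convolve (F ∘ suc) G n)
      ≡⟨ cong₂ ℤ._+_ (trans (cong +_ (length-cartesianProduct (F 0) (G (suc n)))) (ℤₚ.pos-* (length (F 0)) _))
           (length-convolve (F ∘ suc) G n) ⟩
    _ ∎
    where open ≡-Reasoning

  infixr 7 _⊠_

  _⊠_ : Weighted → Weighted → Weighted
  (V ⊠ W) .Carrier = Carrier V × Carrier W
  (V ⊠ W) .weight (x , y) = weight V x ℕ.+ weight W y
  (V ⊠ W) .fibre n .elements = convolve (elements ∘ fibre V) (elements ∘ fibre W) n
  (V ⊠ W) .fibre n .unique = convolve-unique _ _ n (unique ∘ fibre V) (unique ∘ fibre W)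
    (λ {i} {j} p q → trans (sym (sound (fibre V i) p)) (sound (fibre V j) q))
  (V ⊠ W) .fibre n .sound {x , y} xy∈
    with i , j , refl , x∈ , y∈ ← ∈-convolve⁻ _ _ n xy∈ = cong₂ ℕ._+_ (sound (fibre V i) x∈)
        (sound (fibre W j) y∈)
  (V ⊠ W) .fibre n .complete {x , y} refl =
    ∈-convolve⁺ _ _ (weight V x) (weight W y) (complete (fibre V _) refl) (complete (fibre W _) refl)

  gf-⊠ : ∀ V W → gf (V ⊠ W) ≈ gf V ⊗ gf W
  gf-⊠ V W = length-convolve (elements ∘ fibre V) (elements ∘ fibre W)

  ⨄-fibre : ∀ {k} (W : Fin k → Weighted) n → Enumeration {A = Σ (Fin k) (Carrier ∘ W)}
      (λ (i , x) → weight (W i) x ≡ n)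
  ⨄-fibre {zero}  W n = empty (λ { {()} })
  ⨄-fibre {suc k} W n = image (disjointUnion (fibre (W zero) n) (⨄-fibre (W ∘ suc) n))
    to from from∘to (λ { {inj₁ _} p → p ; {inj₂ _} p → p }) (λ { {zero , _} p → p ; {suc _ , _} p → p })
    (λ { {zero , _} _ → refl ; {suc _ , _} _ → refl })
    where
    to : Carrier (W zero) ⊎ Σ (Fin k) (Carrier ∘ W ∘ suc) → Σ (Fin (suc k)) (Carrier ∘ W)
    to (inj₁ x)       = zero , x
    to (inj₂ (i , x)) = suc i , x
    from : Σ (Fin (suc k)) (Carrier ∘ W) → Carrier (W zero) ⊎ Σ (Fin k) (Carrier ∘ W ∘ suc)
    from (zero , x)  = inj₁ x
    from (suc i , x) = inj₂ (i , x)
    from∘to : ∀ z → from (to z) ≡ z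
    from∘to (inj₁ _) = refl
    from∘to (inj₂ _) = refl

  ⨄ : ∀ {k} → (Fin k → Weighted) → Weighted
  ⨄ {k} W .Carrier      = Σ (Fin k) (Carrier ∘ W)
  ⨄ W .weight (i , x)   = weight (W i) x
  ⨄ W .fibre            = ⨄-fibre W

  ∑ : ∀ {k} → (Fin k → Series) → Series
  ∑ {zero}  f = 𝟘
  ∑ {suc k} f = f zero ⊕ ∑ (f ∘ suc)

  gf-⨄ : ∀ {k} (W : Fin k → Weighted) → gf (⨄ W) ≈ ∑ (gf ∘ W)
  gf-⨄ {zero}  W n = refl
  gf-⨄ {suc k} W n = trans (cong +_ (trans (length-map _
      (elements (disjointUnion (fibre (W zero) n) (⨄-fibre (W ∘ suc) n))))
    (count-disjointUnion (fibre (W zero) n) (⨄-fibre (W ∘ suc) n))))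
    (cong (λ z → gf (W zero) n ℤ.+ z) (gf-⨄ (W ∘ suc) n))

  ∈-spread⁻ : ∀ k j (F : ℕ → List A) n {x} → x ∈ spread [] k j F n → ∃ λ i → j ℕ.+ i ℕ.* suc k ≡ n × x ∈ F i
  ∈-spread⁻ k zero    F zero    x∈ = 0 , refl , x∈
  ∈-spread⁻ k zero    F (suc n) x∈ with i , eq , x∈F ← ∈-spread⁻ k k (F ∘ suc) n x∈ = suc i ,
      cong suc eq , x∈F
  ∈-spread⁻ k (suc j) F (suc n) x∈ with i , eq , x∈F ← ∈-spread⁻ k j F n x∈ = i , cong suc eq , x∈F

  ∈-spread⁺ : ∀ k j (F : ℕ → List A) i {x} → x ∈ F i → x ∈ spread [] k j F (j ℕ.+ i ℕ.* suc k)
  ∈-spread⁺ k zero    F zero    x∈ = x∈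
  ∈-spread⁺ k zero    F (suc i) x∈ = ∈-spread⁺ k k (F ∘ suc) i x∈
  ∈-spread⁺ k (suc j) F i       x∈ = ∈-spread⁺ k j F i x∈

  spread-unique : ∀ k j (F : ℕ → List A) n → (∀ i → Unique (F i)) → Unique (spread [] k j F n)
  spread-unique k zero    F zero    F! = F! 0
  spread-unique k zero    F (suc n) F! = spread-unique k k (F ∘ suc) n (F! ∘ suc)
  spread-unique k (suc j) F zero    F! = []
  spread-unique k (suc j) F (suc n) F! = spread-unique k j F n F!

  length-spread : ∀ k j (F : ℕ → List A) n → + length (spread [] k j F n) ≡
      spread 0ℤ k j (λ i → + length (F i)) n
  length-spread k zero    F zero    = refl
  length-spread k zero    F (suc n) = length-spread k k (F ∘ suc) n
  length-spread k (suc j) F zero    = refl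
  length-spread k (suc j) F (suc n) = length-spread k j F n

  -- The fibres are the old ones moved to new degrees; `spread` is polymorphic so that it moves
  -- lists in the same way as coefficients.
  affine : (k j : ℕ) → Weighted → Weighted
  affine k j W .Carrier  = Carrier W
  affine k j W .weight x = j ℕ.+ weight W x ℕ.* suc k
  affine k j W .fibre n .elements = spread [] k j (elements ∘ fibre W) n
  affine k j W .fibre n .unique = spread-unique k j _ n (unique ∘ fibre W)
  affine k j W .fibre n .sound x∈ with i , refl , x∈F ← ∈-spread⁻ k j _ n x∈ =
    cong (λ w → j ℕ.+ w ℕ.* suc k) (sound (fibre W i) x∈F)
  affine k j W .fibre n .complete refl = ∈-spread⁺ k j _ _ (complete (fibre W _) refl)

  gf-affine : ∀ k j W → gf (affine k j W) ≈ spread 0ℤ k j (gf W)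
  gf-affine k j W = length-spread k j (elements ∘ fibre W)

  weightedℕ : (w : ℕ → ℕ) → (∀ x → x ≤ w x) → Weighted
  weightedℕ w bound .Carrier = ℕ
  weightedℕ w bound .weight  = w
  weightedℕ w bound .fibre n = enumerate-filter (λ x → w x ℕₚ.≟ n) (upTo (suc n)) (Uniqueₚ.upTo⁺ (suc n))
    (λ { {x} refl → ∈-upTo⁺ (s≤s (bound x)) })

  -- The `suc` in the bound makes room for the index -1, whose triangular weight is 0.
  weightedℤ : (w : ℤ → ℕ) → (∀ x → ∣ x ∣ ≤ suc (w x)) → Weighted
  weightedℤ w bound .Carrier = ℤ
  weightedℤ w bound .weight  = w
  weightedℤ w bound .fibre n = enumerate-filter (λ x → w x ℕₚ.≟ n) (interval (suc n))
      (interval-unique (suc n))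
    (λ { {x} refl → ∈-interval (suc n) x (bound x) })

open WeightedSets

-- Bijections behind the theta identities

module ThetaSeries where

  open import Algebra.Properties.AbelianGroup ℤₚ.+-0-abelianGroup using (∙-cancelʳ)
  open import Data.Empty using (⊥-elim)
  open import Data.Fin.Properties using (toℕ-fromℕ<; toℕ<n; toℕ-injective)
  open import Data.Integer.DivMod using (_/ℕ_; n%ℕd<d; a≡a%ℕn+[a/ℕn]*n)
  open import Data.Integer.Tactic.RingSolver using (solve-∀)
  open import Data.Vec.Base using (Vec; []; _∷_)
  open import Defs using (m≤m*m; r; representations; sumOfSquares; square≡+; sumOfSquares≡+)
  open import Function.Bundles using (_↔_; Inverse; mk↔ₛ′)
  open import Function.Properties.Inverse using (↔-trans)
  open import Relation.Binary.Definitions using (tri<; tri≈; tri>)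
  open import Relation.Binary.PropositionalEquality
  open import Data.Integer.Base using (_+_; _*_; _-_; -_)

  recompose : ∀ {m} → Fin m × ℤ → ℤ
  recompose {m} (r , q) = + toℕ r + q * + m

  residue : ∀ m .{{_ : ℕ.NonZero m}} → ℤ → Fin m × ℤ
  residue m x = fromℕ< (n%ℕd<d x m) , x /ℕ m

  recompose-residue : ∀ m .{{_ : ℕ.NonZero m}} x → recompose (residue m x) ≡ x
  recompose-residue m x = trans (cong (λ r → + r + (x /ℕ m) * + m) (toℕ-fromℕ< (n%ℕd<d x m)))
    (sym (a≡a%ℕn+[a/ℕn]*n x m))

  recompose-< : ∀ {m} (r r′ : Fin m) {q q′} → q ℤ.< q′ → recompose (r , q) ℤ.< recompose (r′ , q′)
  recompose-< {m} r r′ {q} {q′} q<q′ = begin-strict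
    + toℕ r + q * + m   <⟨ ℤₚ.+-monoˡ-< (q * + m) (ℤ.+<+ (toℕ<n r)) ⟩
    + m + q * + m       ≡⟨ ℤₚ.suc-* q (+ m) ⟨
    ℤ.suc q * + m       ≤⟨ ℤₚ.*-monoʳ-≤-nonNeg (+ m) (ℤₚ.i<j⇒suc[i]≤j q<q′) ⟩
    q′ * + m            ≡⟨ ℤₚ.+-identityˡ _ ⟨
    0ℤ + q′ * + m       ≤⟨ ℤₚ.+-monoˡ-≤ (q′ * + m) (ℤ.+≤+ z≤n) ⟩
    + toℕ r′ + q′ * + m ∎
    where open ℤₚ.≤-Reasoning

  recompose-injective : ∀ {m} (x y : Fin m × ℤ) → recompose x ≡ recompose y → x ≡ y
  recompose-injective {m} (r , q) (r′ , q′) eq with ℤₚ.<-cmp q q′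
  ... | tri< q<q′ _ _ = ⊥-elim (ℤₚ.<-irrefl eq (recompose-< r r′ q<q′))
  ... | tri> _ _ q′<q = ⊥-elim (ℤₚ.<-irrefl (sym eq) (recompose-< r′ r q′<q))
  ... | tri≈ _ refl _ = cong (_, q) (toℕ-injective (ℤₚ.+-injective (∙-cancelʳ (q * + m) _ _ eq)))

  residue-recompose : ∀ m .{{_ : ℕ.NonZero m}} x → residue m (recompose x) ≡ x
  residue-recompose m x = recompose-injective _ x (recompose-residue m (recompose x))

  split : ∀ m .{{_ : ℕ.NonZero m}} → (Fin m × ℤ) ↔ ℤ
  split m = mk↔ₛ′ recompose (residue m) (recompose-residue m) (residue-recompose m)

  triangle : ℕ → ℕ
  triangle zero    = 0
  triangle (suc n) = suc n ℕ.+ triangle n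

  -- This is k(k+1)/2 for every integer k. It is invariant under k ↦ -1 - k, so every triangular
  -- number occurs twice.
  T : ℤ → ℕ
  T (+ n)    = triangle n
  T -[1+ n ] = triangle n

  sq : ℤ → ℕ
  sq x = ∣ x ∣ ℕ.* ∣ x ∣

  triangle-* : ∀ n → + triangle n * + 2 ≡ + n * (+ n + 1ℤ)
  triangle-* zero    = refl
  triangle-* (suc n) = begin
    (+ suc n + + triangle n) * + 2        ≡⟨ ℤₚ.*-distribʳ-+ (+ 2) (+ suc n) (+ triangle n) ⟩
    + suc n * + 2 + + triangle n * + 2    ≡⟨ cong (λ z → + suc n * + 2 + z) (triangle-* n) ⟩
    (1ℤ + + n) * + 2 + + n * (+ n + 1ℤ)   ≡⟨ lemma (+ n) ⟩
    + suc n * (+ suc n + 1ℤ)              ∎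
    where
    open ≡-Reasoning
    lemma : ∀ n → (1ℤ + n) * + 2 + n * (n + 1ℤ) ≡ (1ℤ + n) * (1ℤ + n + 1ℤ)
    lemma = solve-∀

  -- Clears the denominator of k(k+1)/2, which turns identities between triangular numbers into
  -- polynomial ones for the ring solver.
  T-* : ∀ x → + T x * + 2 ≡ x * (x + 1ℤ)
  T-* (+ n)    = triangle-* n
  T-* -[1+ n ] = trans (triangle-* n) (lemma (+ n))
    where
    lemma : ∀ n → n * (n + 1ℤ) ≡ (- (1ℤ + n)) * (- (1ℤ + n) + 1ℤ)
    lemma = solve-∀

  sq-* : ∀ x → + sq x ≡ x * x
  sq-* x = trans (sym (square≡+ x)) (cong (x *_) (ℤₚ.*-identityʳ x))

  pos-affine : ∀ j w k → + (j ℕ.+ w ℕ.* k) ≡ + j + + w * + k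
  pos-affine j w k = cong (λ z → + j + z) (ℤₚ.pos-* w k)

  halve : ∀ {m n} → + m * + 2 ≡ + n * + 2 → m ≡ n
  halve eq = ℤₚ.+-injective (ℤₚ.*-cancelʳ-≡ _ _ (+ 2) eq)

  n≤triangle : ∀ n → n ≤ triangle n
  n≤triangle zero    = z≤n
  n≤triangle (suc n) = ℕₚ.m≤m+n (suc n) _

  abs≤T : ∀ x → ∣ x ∣ ≤ suc (T x)
  abs≤T (+ n)    = ℕₚ.m≤n⇒m≤1+n (n≤triangle n)
  abs≤T -[1+ n ] = s≤s (n≤triangle n)

  abs≤sq : ∀ x → ∣ x ∣ ≤ suc (sq x)
  abs≤sq x = ℕₚ.m≤n⇒m≤1+n (m≤m*m ∣ x ∣)

  -- T(n) + n² = n(3n+1)/2 runs through the generalized pentagonal numbers; T(3n) is three times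
  -- this number.
  Triangularsℕ Triangularsℤ Squares Pentagonals : Weighted
  Triangularsℕ = weightedℕ triangle n≤triangle
  Triangularsℤ = weightedℤ T abs≤T
  Squares      = weightedℤ sq abs≤sq
  Pentagonals  = weightedℤ (λ n → T n ℕ.+ sq n) (λ n → ℕₚ.≤-trans (abs≤T n) (s≤s (ℕₚ.m≤m+n (T n) _)))

  ψ θ φ : Series
  ψ = gf Triangularsℕ
  θ = gf Triangularsℤ
  φ = gf Squares

  θ≈ψ⊕ψ : θ ≈ ψ ⊕ ψ
  θ≈ψ⊕ψ n = trans (sym (gf-↔ (⨄ sides) Triangularsℤ signed
      (λ { (zero , _) → refl ; (suc zero , _) → refl }) n))
    (trans (gf-⨄ sides n) (cong (λ z → ψ n + z) (ℤₚ.+-identityʳ (ψ n))))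
    where
    sides : Fin 2 → Weighted
    sides _ = Triangularsℕ
    to : Fin 2 × ℕ → ℤ
    to (zero , n)  = + n
    to (suc _ , n) = -[1+ n ]
    from : ℤ → Fin 2 × ℕ
    from (+ n)    = zero , n
    from -[1+ n ] = suc zero , n
    signed : (Fin 2 × ℕ) ↔ ℤ
    signed = mk↔ₛ′ to from (λ { (+ n) → refl ; -[1+ n ] → refl })
        (λ { (zero , n) → refl ; (suc zero , n) → refl })

  -- Replacing n by -1-n gives the residue class 2 modulo 3 the same weights as the class 0.

  flip : Fin 3 → ℤ → ℤ
  flip zero             n = n
  flip (suc zero)       n = n
  flip (suc (suc zero)) n = ℤ.-1ℤ - n

  flip-involutive : ∀ s n → flip s (flip s n) ≡ n
  flip-involutive zero             n = refl
  flip-involutive (suc zero)       n = refl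
  flip-involutive (suc (suc zero)) n = lemma n
    where
    lemma : ∀ n → ℤ.-1ℤ - (ℤ.-1ℤ - n) ≡ n
    lemma = solve-∀

  ι : Fin 3 → ℤ → ℤ
  ι s n = recompose (s , flip s n)

  -- Given field by field so that the carrier reduces to ℤ even for a variable `s`. The index 3n + 1
  -- has weight 1 + 9 T(n).
  slice : Fin 3 → Weighted
  slice s .Carrier = ℤ
  slice zero             .weight = weight (affine 2 0 Pentagonals)
  slice (suc zero)       .weight = weight (affine 8 1 Triangularsℤ)
  slice (suc (suc zero)) .weight = weight (affine 2 0 Pentagonals)
  slice zero             .fibre  = fibre (affine 2 0 Pentagonals)
  slice (suc zero)       .fibre  = fibre (affine 8 1 Triangularsℤ)
  slice (suc (suc zero)) .fibre  = fibre (affine 2 0 Pentagonals)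

  T-pentagonal : ∀ n k → k * (k + 1ℤ) ≡ (n * (n + 1ℤ) + n * n * + 2) * + 3 →
                 T k ≡ weight (affine 2 0 Pentagonals) n
  T-pentagonal n k eq = halve (begin
    + T k * + 2                                      ≡⟨ T-* k ⟩
    k * (k + 1ℤ)                                     ≡⟨ eq ⟩
    (n * (n + 1ℤ) + n * n * + 2) * + 3               ≡⟨ cong₂ (λ u v → (u + v * + 2) * + 3) (T-* n) (sq-* n) ⟨
    (+ T n * + 2 + + sq n * + 2) * + 3               ≡⟨ lemma (+ T n) (+ sq n) ⟩
    (0ℤ + (+ T n + + sq n) * + 3) * + 2              ≡⟨ cong (_* + 2) (pos-affine 0 (T n ℕ.+ sq n) 3) ⟨
    + weight (affine 2 0 Pentagonals) n * + 2        ∎)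
    where
    open ≡-Reasoning
    lemma : ∀ t s → (t * + 2 + s * + 2) * + 3 ≡ (0ℤ + (t + s) * + 3) * + 2
    lemma = solve-∀

  T-ι : ∀ s n → T (ι s n) ≡ weight (slice s) n
  T-ι zero n = T-pentagonal n (ι zero n) (lemma n)
    where
    lemma : ∀ n → (0ℤ + n * + 3) * (0ℤ + n * + 3 + 1ℤ) ≡ (n * (n + 1ℤ) + n * n * + 2) * + 3
    lemma = solve-∀
  T-ι (suc zero) n = halve (begin
    + T (1ℤ + n * + 3) * + 2                         ≡⟨ T-* (1ℤ + n * + 3) ⟩
    (1ℤ + n * + 3) * (1ℤ + n * + 3 + 1ℤ)             ≡⟨ lemma₁ n ⟩
    + 2 + n * (n + 1ℤ) * + 9                         ≡⟨ cong (λ u → + 2 + u * + 9) (T-* n) ⟨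
    + 2 + + T n * + 2 * + 9                          ≡⟨ lemma₂ (+ T n) ⟩
    (1ℤ + + T n * + 9) * + 2                         ≡⟨ cong (_* + 2) (pos-affine 1 (T n) 9) ⟨
    + (1 ℕ.+ T n ℕ.* 9) * + 2                        ∎)
    where
    open ≡-Reasoning
    lemma₁ : ∀ n → (1ℤ + n * + 3) * (1ℤ + n * + 3 + 1ℤ) ≡ + 2 + n * (n + 1ℤ) * + 9
    lemma₁ = solve-∀
    lemma₂ : ∀ t → + 2 + t * + 2 * + 9 ≡ (1ℤ + t * + 9) * + 2
    lemma₂ = solve-∀
  T-ι (suc (suc zero)) n = T-pentagonal n (ι (suc (suc zero)) n) (lemma n)
    where
    lemma : ∀ n → (+ 2 + (ℤ.-1ℤ - n) * + 3) * (+ 2 + (ℤ.-1ℤ - n) * + 3 + 1ℤ) ≡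
                  (n * (n + 1ℤ) + n * n * + 2) * + 3
    lemma = solve-∀

  flips : (Fin 3 × ℤ) ↔ (Fin 3 × ℤ)
  flips = mk↔ₛ′ (λ (s , n) → s , flip s n) (λ (s , n) → s , flip s n)
    (λ (s , n) → cong (s ,_) (flip-involutive s n)) (λ (s , n) → cong (s ,_) (flip-involutive s n))

  θ-slices : θ ≈ ∑ (gf ∘ slice)
  θ-slices n = trans (sym (gf-↔ (⨄ slice) Triangularsℤ (↔-trans flips (split 3)) (λ (s , n) → T-ι s n) n))
    (gf-⨄ slice n)

  -- The tetracode.  Multiplication by a quaternion of norm 3 maps the quadruples of odd integers
  -- bijectively onto those whose residues modulo 3 form a word of the tetracode, and it
  -- multiplies the norm by 3.  Everything is expressed in terms of k for the odd number 2k+1.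

  T-quaternion : ∀ a b c d → let k₁ = a + b + c + 1ℤ ; k₄ = b - c + d in
    T k₁ ℕ.+ (T k₄ ℕ.+ (T (k₁ + k₄ - 1ℤ - b * + 3) ℕ.+ T (k₁ - k₄ - + 2 - c * + 3))) ≡
    1 ℕ.+ (T a ℕ.+ (T b ℕ.+ (T c ℕ.+ T d))) ℕ.* 3
  -- With A = 2a + 1 and likewise B, C, D, the odd numbers on the left are A + B + C, B - C + D, A -
  -- B + D and A - C - D: an orthogonal transformation times the square root of 3. As (2k+1)² = 8
  -- T(k) + 1, the four units become the summand 1 = (3 · 4 - 4) / 8.
  T-quaternion a b c d = halve (begin
    (+ T k₁ + (+ T k₄ + (+ T k₂ + + T k₃))) * + 2
      ≡⟨ distrib (+ T k₁) (+ T k₄) (+ T k₂) (+ T k₃) ⟩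
    + T k₁ * + 2 + (+ T k₄ * + 2 + (+ T k₂ * + 2 + + T k₃ * + 2))
      ≡⟨ cong₂ _+_ (T-* k₁) (cong₂ _+_ (T-* k₄) (cong₂ _+_ (T-* k₂) (T-* k₃))) ⟩
    k₁ * (k₁ + 1ℤ) + (k₄ * (k₄ + 1ℤ) + (k₂ * (k₂ + 1ℤ) + k₃ * (k₃ + 1ℤ)))
      ≡⟨ lemma a b c d ⟩
    + 2 + (a * (a + 1ℤ) + (b * (b + 1ℤ) + (c * (c + 1ℤ) + d * (d + 1ℤ)))) * + 3
      ≡⟨ cong (λ z → + 2 + z * + 3) (cong₂ _+_ (T-* a) (cong₂ _+_ (T-* b) (cong₂ _+_ (T-* c) (T-* d)))) ⟨
    + 2 + (+ T a * + 2 + (+ T b * + 2 + (+ T c * + 2 + + T d * + 2))) * + 3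
      ≡⟨ collect (+ T a) (+ T b) (+ T c) (+ T d) ⟩
    (1ℤ + (+ T a + (+ T b + (+ T c + + T d))) * + 3) * + 2
      ≡⟨ cong (_* + 2) (pos-affine 1 (T a ℕ.+ (T b ℕ.+ (T c ℕ.+ T d))) 3) ⟨
    + (1 ℕ.+ (T a ℕ.+ (T b ℕ.+ (T c ℕ.+ T d))) ℕ.* 3) * + 2 ∎)
    where
    open ≡-Reasoning
    k₁ = a + b + c + 1ℤ
    k₄ = b - c + d
    k₂ = k₁ + k₄ - 1ℤ - b * + 3
    k₃ = k₁ - k₄ - + 2 - c * + 3
    distrib : ∀ p q r s → (p + (q + (r + s))) * + 2 ≡ p * + 2 + (q * + 2 + (r * + 2 + s * + 2))
    distrib = solve-∀
    collect : ∀ p q r s → + 2 + (p * + 2 + (q * + 2 + (r * + 2 + s * + 2))) * + 3 ≡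
        (1ℤ + (p + (q + (r + s))) * + 3) * + 2
    collect = solve-∀
    lemma : ∀ a b c d → let k₁ = a + b + c + 1ℤ ; k₄ = b - c + d ; k₂ = k₁ + k₄ - 1ℤ - b * + 3 ; k₃ = k₁ - k₄ - + 2 - c * + 3 in
      k₁ * (k₁ + 1ℤ) + (k₄ * (k₄ + 1ℤ) + (k₂ * (k₂ + 1ℤ) + k₃ * (k₃ + 1ℤ))) ≡
      + 2 + (a * (a + 1ℤ) + (b * (b + 1ℤ) + (c * (c + 1ℤ) + d * (d + 1ℤ)))) * + 3
    lemma = solve-∀

  -- For the odd numbers themselves the last two coordinates are the sum and the difference of the
  -- first two modulo 3. Passing from 2k + 1 to k produces the shifts by 1 and 2. The quotients are
  -- kept because the preimage depends on them.
  sumResidue differenceResidue : Fin 3 → Fin 3 → Fin 3 × ℤ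
  sumResidue s t        = residue 3 (+ toℕ s + + toℕ t - 1ℤ)
  differenceResidue s t = residue 3 (+ toℕ s - + toℕ t - + 2)

  codeword : (s t : Fin 3) → Weighted
  codeword s t = slice s ⊠ slice t ⊠ slice (proj₁ (sumResidue s t)) ⊠ slice (proj₁ (differenceResidue s t))

  tetracode : Weighted
  tetracode = ⨄ λ s → ⨄ λ t → codeword s t

  ℤ⁴ : Set
  ℤ⁴ = ℤ × ℤ × ℤ × ℤ

  -- Once the residues are fixed, the quotients n and p of the last two entries determine, and are
  -- determined by, the coordinates b and c of the preimage.
  codewordPreimage : (Fin 3 × Fin 3 × ℤ⁴) ↔ (Fin 3 × Fin 3 × ℤ⁴)
  codewordPreimage = mk↔ₛ′ to from to∘from from∘to
    where
    to from : Fin 3 × Fin 3 × ℤ⁴ → Fin 3 × Fin 3 × ℤ⁴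
    to (s , t , m , l , n , p) = s , t , flip s m , flip t l ,
      flip s m + flip t l + proj₂ (sumResidue s t) - flip (proj₁ (sumResidue s t)) n ,
      flip s m - flip t l + proj₂ (differenceResidue s t) - flip (proj₁ (differenceResidue s t)) p
    from (s , t , M , L , b , c) = s , t , flip s M , flip t L ,
      flip (proj₁ (sumResidue s t)) (M + L + proj₂ (sumResidue s t) - b) ,
      flip (proj₁ (differenceResidue s t)) (M - L + proj₂ (differenceResidue s t) - c)
    subtract-twice : ∀ x y → x - (x - y) ≡ y
    subtract-twice = solve-∀
    to∘from : ∀ x → to (from x) ≡ x
    to∘from (s , t , M , L , b , c)
      rewrite flip-involutive s M | flip-involutive t L
            | flip-involutive (proj₁ (sumResidue s t)) (M + L + proj₂ (sumResidue s t) - b)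
            | flip-involutive (proj₁ (differenceResidue s t)) (M - L + proj₂ (differenceResidue s t) - c)
            | subtract-twice (M + L + proj₂ (sumResidue s t)) b
            | subtract-twice (M - L + proj₂ (differenceResidue s t)) c = refl
    from∘to : ∀ x → from (to x) ≡ x
    from∘to (s , t , m , l , n , p)
      rewrite subtract-twice (flip s m + flip t l + proj₂ (sumResidue s t)) (flip (proj₁ (sumResidue s t)) n)
            | subtract-twice (flip s m - flip t l + proj₂ (differenceResidue s t))
                (flip (proj₁ (differenceResidue s t)) p)
            | flip-involutive s m | flip-involutive t l
            | flip-involutive (proj₁ (sumResidue s t)) n
            | flip-involutive (proj₁ (differenceResidue s t)) p = refl

  splitTwo : (Fin 3 × Fin 3 × ℤ⁴) ↔ ℤ⁴
  splitTwo = mk↔ₛ′ to from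
    (λ (x , y , b , c) → cong₂ (λ x y → x , y , b , c) (recompose-residue 3 x) (recompose-residue 3 y))
    (λ (s , t , M , L , b , c) → cong₂ (λ (s , M) (t , L) → s , t , M , L , b , c)
       (residue-recompose 3 (s , M)) (residue-recompose 3 (t , L)))
    where
    to : Fin 3 × Fin 3 × ℤ⁴ → ℤ⁴
    to (s , t , M , L , b , c) = recompose (s , M) , recompose (t , L) , b , c
    from : ℤ⁴ → Fin 3 × Fin 3 × ℤ⁴
    from (x , y , b , c) = let s , M = residue 3 x ; t , L = residue 3 y in s , t , M , L , b , c

  -- In k₁ = a + b + c + 1 and k₄ = b - c + d the unknowns a and d have coefficient 1, so they are
  -- recovered once b and c are known.
  shear : ℤ⁴ ↔ ℤ⁴
  shear = mk↔ₛ′ to from to∘from from∘to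
    where
    to from : ℤ⁴ → ℤ⁴
    to   (x , y , b , c) = x - b - c - 1ℤ , b , c , y - b + c
    from (a , b , c , d) = a + b + c + 1ℤ , b - c + d , b , c
    to∘from : ∀ x → to (from x) ≡ x
    to∘from (a , b , c , d) = cong₂ (λ a d → a , b , c , d) (lemma₁ a b c) (lemma₂ b c d)
      where
      lemma₁ : ∀ a b c → a + b + c + 1ℤ - b - c - 1ℤ ≡ a
      lemma₁ = solve-∀
      lemma₂ : ∀ b c d → b - c + d - b + c ≡ d
      lemma₂ = solve-∀
    from∘to : ∀ x → from (to x) ≡ x
    from∘to (x , y , b , c) = cong₂ (λ x y → x , y , b , c) (lemma₁ x b c) (lemma₂ y b c)
      where
      lemma₁ : ∀ x b c → x - b - c - 1ℤ + b + c + 1ℤ ≡ x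
      lemma₁ = solve-∀
      lemma₂ : ∀ y b c → b - c + (y - b + c) ≡ y
      lemma₂ = solve-∀

  tetracode↔ℤ⁴ : (Fin 3 × Fin 3 × ℤ⁴) ↔ ℤ⁴
  tetracode↔ℤ⁴ = ↔-trans codewordPreimage (↔-trans splitTwo shear)

  fourTriangularsℤ : Weighted
  fourTriangularsℤ = Triangularsℤ ⊠ Triangularsℤ ⊠ Triangularsℤ ⊠ Triangularsℤ

  tetracode-weight : ∀ x → weight (affine 2 1 fourTriangularsℤ) (Inverse.to tetracode↔ℤ⁴ x) ≡
      weight tetracode x
  tetracode-weight (s , t , m , l , n , p) = begin
    1 ℕ.+ (T a ℕ.+ (T b ℕ.+ (T c ℕ.+ T d))) ℕ.* 3
      ≡⟨ T-quaternion a b c d ⟨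
    T k₁ ℕ.+ (T k₄ ℕ.+ (T (k₁ + k₄ - 1ℤ - b * + 3) ℕ.+ T (k₁ - k₄ - + 2 - c * + 3)))
      ≡⟨ cong₂ (λ k₁ k₄ → T k₁ ℕ.+ (T k₄ ℕ.+ (T (k₁ + k₄ - 1ℤ - b * + 3) ℕ.+
          T (k₁ - k₄ - + 2 - c * + 3)))) eq₁ eq₄ ⟩
    T (ι s m) ℕ.+ (T (ι t l) ℕ.+ (T (ι s m + ι t l - 1ℤ - b * + 3) ℕ.+ T (ι s m - ι t l - + 2 - c * + 3)))
      ≡⟨ cong₂ (λ k₂ k₃ → T (ι s m) ℕ.+ (T (ι t l) ℕ.+ (T k₂ ℕ.+ T k₃))) eq₂ eq₃ ⟩
    T (ι s m) ℕ.+ (T (ι t l) ℕ.+ (T (ι s₂ n) ℕ.+ T (ι s₃ p)))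
      ≡⟨ cong₂ ℕ._+_ (T-ι s m) (cong₂ ℕ._+_ (T-ι t l) (cong₂ ℕ._+_ (T-ι s₂ n) (T-ι s₃ p))) ⟩
    weight tetracode (s , t , m , l , n , p) ∎
    where
    open ≡-Reasoning
    s₂ = proj₁ (sumResidue s t)
    s₃ = proj₁ (differenceResidue s t)
    h₂ = proj₂ (sumResidue s t)
    h₃ = proj₂ (differenceResidue s t)
    M = flip s m
    L = flip t l
    b = M + L + h₂ - flip s₂ n
    c = M - L + h₃ - flip s₃ p
    a = ι s m - b - c - 1ℤ
    d = ι t l - b + c
    k₁ = a + b + c + 1ℤ
    k₄ = b - c + d
    eq₁ : k₁ ≡ ι s m
    eq₁ = lemma (ι s m) b c
      where
      lemma : ∀ x b c → x - b - c - 1ℤ + b + c + 1ℤ ≡ x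
      lemma = solve-∀
    eq₄ : k₄ ≡ ι t l
    eq₄ = lemma (ι t l) b c
      where
      lemma : ∀ y b c → b - c + (y - b + c) ≡ y
      lemma = solve-∀
    -- Subtracting 3b removes the quotients M and L of the first two entries; the residue equation
    -- then replaces s + t - 1 by s₂ + 3h₂, and h₂ cancels as well.
    eq₂ : ι s m + ι t l - 1ℤ - b * + 3 ≡ ι s₂ n
    eq₂ = begin
      + toℕ s + M * + 3 + (+ toℕ t + L * + 3) - 1ℤ - b * + 3
        ≡⟨ lemma₁ (+ toℕ s) (+ toℕ t) M L h₂ (flip s₂ n) ⟩
      + toℕ s + + toℕ t - 1ℤ + (flip s₂ n - h₂) * + 3
        ≡⟨ cong (_+ (flip s₂ n - h₂) * + 3) (recompose-residue 3 (+ toℕ s + + toℕ t - 1ℤ)) ⟨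
      recompose (sumResidue s t) + (flip s₂ n - h₂) * + 3
        ≡⟨ lemma₂ (+ toℕ s₂) h₂ (flip s₂ n) ⟩
      ι s₂ n ∎
      where
      lemma₁ : ∀ s t M L h N → s + M * + 3 + (t + L * + 3) - 1ℤ - (M + L + h - N) * + 3 ≡
          s + t - 1ℤ + (N - h) * + 3
      lemma₁ = solve-∀
      lemma₂ : ∀ s h N → s + h * + 3 + (N - h) * + 3 ≡ s + N * + 3
      lemma₂ = solve-∀
    eq₃ : ι s m - ι t l - + 2 - c * + 3 ≡ ι s₃ p
    eq₃ = begin
      + toℕ s + M * + 3 - (+ toℕ t + L * + 3) - + 2 - c * + 3
        ≡⟨ lemma₁ (+ toℕ s) (+ toℕ t) M L h₃ (flip s₃ p) ⟩
      + toℕ s - + toℕ t - + 2 + (flip s₃ p - h₃) * + 3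
        ≡⟨ cong (_+ (flip s₃ p - h₃) * + 3) (recompose-residue 3 (+ toℕ s - + toℕ t - + 2)) ⟨
      recompose (differenceResidue s t) + (flip s₃ p - h₃) * + 3
        ≡⟨ lemma₂ (+ toℕ s₃) h₃ (flip s₃ p) ⟩
      ι s₃ p ∎
      where
      lemma₁ : ∀ s t M L h N → s + M * + 3 - (t + L * + 3) - + 2 - (M - L + h - N) * + 3 ≡
          s - t - + 2 + (N - h) * + 3
      lemma₁ = solve-∀
      lemma₂ : ∀ s h N → s + h * + 3 + (N - h) * + 3 ≡ s + N * + 3
      lemma₂ = solve-∀

  -- Here (2n)² = 4n² and (2n+1)² = 1 + 8 T(n). The 8 is split as 2 · 4 so that both classes are
  -- dilations by 4.
  parity : Fin 2 → Weighted
  parity s .Carrier = ℤ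
  parity zero       .weight = weight (affine 3 0 Squares)
  parity (suc zero) .weight = weight (affine 3 1 (affine 1 0 Triangularsℤ))
  parity zero       .fibre  = fibre (affine 3 0 Squares)
  parity (suc zero) .fibre  = fibre (affine 3 1 (affine 1 0 Triangularsℤ))

  sq-recompose : ∀ s n → sq (recompose (s , n)) ≡ weight (parity s) n
  sq-recompose zero n = ℤₚ.+-injective (begin
    + sq (0ℤ + n * + 2)               ≡⟨ sq-* (0ℤ + n * + 2) ⟩
    (0ℤ + n * + 2) * (0ℤ + n * + 2)   ≡⟨ lemma n ⟩
    0ℤ + n * n * + 4                  ≡⟨ cong (λ u → 0ℤ + u * + 4) (sq-* n) ⟨
    0ℤ + + sq n * + 4                 ≡⟨ pos-affine 0 (sq n) 4 ⟨
    + (0 ℕ.+ sq n ℕ.* 4)              ∎)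
    where
    open ≡-Reasoning
    lemma : ∀ n → (0ℤ + n * + 2) * (0ℤ + n * + 2) ≡ 0ℤ + n * n * + 4
    lemma = solve-∀
  sq-recompose (suc zero) n = ℤₚ.+-injective (begin
    + sq (1ℤ + n * + 2)                       ≡⟨ sq-* (1ℤ + n * + 2) ⟩
    (1ℤ + n * + 2) * (1ℤ + n * + 2)           ≡⟨ lemma n ⟩
    1ℤ + (0ℤ + n * (n + 1ℤ)) * + 4            ≡⟨ cong (λ u → 1ℤ + (0ℤ + u) * + 4) (T-* n) ⟨
    1ℤ + (0ℤ + + T n * + 2) * + 4             ≡⟨ cong (λ u → 1ℤ + u * + 4) (pos-affine 0 (T n) 2) ⟨
    1ℤ + + (0 ℕ.+ T n ℕ.* 2) * + 4            ≡⟨ pos-affine 1 (0 ℕ.+ T n ℕ.* 2) 4 ⟨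
    + (1 ℕ.+ (0 ℕ.+ T n ℕ.* 2) ℕ.* 4)         ∎)
    where
    open ≡-Reasoning
    lemma : ∀ n → (1ℤ + n * + 2) * (1ℤ + n * + 2) ≡ 1ℤ + (0ℤ + n * (n + 1ℤ)) * + 4
    lemma = solve-∀

  φ-parities : φ ≈ ∑ (gf ∘ parity)
  φ-parities n = trans (sym (gf-↔ (⨄ parity) Squares (split 2) (λ (s , n) → sq-recompose s n) n))
      (gf-⨄ parity n)

  ℤ² : Set
  ℤ² = ℤ × ℤ

  splitOne : (Fin 2 × ℤ²) ↔ ℤ²
  splitOne = mk↔ₛ′ (λ (s , m , l) → recompose (s , m) , l) (λ (x , l) → let s , m = residue 2 x in s , m , l)
    (λ (x , l) → cong (_, l) (recompose-residue 2 x))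
    (λ (s , m , l) → cong (λ (s , m) → s , m , l) (residue-recompose 2 (s , m)))

  -- Pairs (x, y) of equal parity are the pairs (u + v, u - v).

  equalParity : Weighted
  equalParity = ⨄ λ s → parity s ⊠ parity s

  equalParity↔ℤ² : (Fin 2 × ℤ²) ↔ ℤ²
  equalParity↔ℤ² = ↔-trans
    (mk↔ₛ′ f f (λ (s , i , j) → cong (λ j → s , i , j) (lemma i j))
        (λ (s , i , j) → cong (λ j → s , i , j) (lemma i j)))
    (↔-trans splitOne
      (mk↔ₛ′ (λ (x , v) → x - v , v) (λ (u , v) → u + v , v)
        (λ (u , v) → cong (_, v) (lemma₁ u v)) (λ (x , v) → cong (_, v) (lemma₂ x v))))
    where
    -- For the numbers s + 2i and s + 2j of equal parity, half the difference is v = i - j.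
    f : Fin 2 × ℤ² → Fin 2 × ℤ²
    f (s , i , j) = s , i , i - j
    lemma : ∀ i j → i - (i - j) ≡ j
    lemma = solve-∀
    lemma₁ : ∀ u v → u + v - v ≡ u
    lemma₁ = solve-∀
    lemma₂ : ∀ x v → x - v + v ≡ x
    lemma₂ = solve-∀

  sq-parallelogram : ∀ x v → (sq (x - v) ℕ.+ sq v) ℕ.* 2 ≡ sq x ℕ.+ sq (x - v * + 2)
  sq-parallelogram x v = ℤₚ.+-injective (begin
    + ((sq (x - v) ℕ.+ sq v) ℕ.* 2)        ≡⟨ ℤₚ.pos-* (sq (x - v) ℕ.+ sq v) 2 ⟩
    (+ sq (x - v) + + sq v) * + 2          ≡⟨ cong₂ (λ p q → (p + q) * + 2) (sq-* (x - v)) (sq-* v) ⟩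
    ((x - v) * (x - v) + v * v) * + 2      ≡⟨ lemma x v ⟩
    x * x + (x - v * + 2) * (x - v * + 2)  ≡⟨ cong₂ _+_ (sq-* x) (sq-* (x - v * + 2)) ⟨
    + (sq x ℕ.+ sq (x - v * + 2))          ∎)
    where
    open ≡-Reasoning
    lemma : ∀ x v → ((x - v) * (x - v) + v * v) * + 2 ≡ x * x + (x - v * + 2) * (x - v * + 2)
    lemma = solve-∀

  equalParity-weight : ∀ x → weight (affine 1 0 (Squares ⊠ Squares)) (Inverse.to equalParity↔ℤ² x) ≡
      weight equalParity x
  equalParity-weight (s , i , j) = begin
    (sq (x - (i - j)) ℕ.+ sq (i - j)) ℕ.* 2     ≡⟨ sq-parallelogram x (i - j) ⟩
    sq x ℕ.+ sq (x - (i - j) * + 2)             ≡⟨ cong (λ y → sq x ℕ.+ sq y) (lemma (+ toℕ s) i j) ⟩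
    sq x ℕ.+ sq (recompose (s , j))             ≡⟨ cong₂ ℕ._+_ (sq-recompose s i) (sq-recompose s j) ⟩
    weight equalParity (s , i , j)              ∎
    where
    open ≡-Reasoning
    x = recompose (s , i)
    lemma : ∀ s i j → s + i * + 2 - (i - j) * + 2 ≡ s + j * + 2
    lemma = solve-∀

  -- A pair (k, l) is (x + y, x - y) or (x + y, y - 1 - x) according to the parity of k - l.

  trianglePairs : Fin 2 → Weighted
  trianglePairs _ = affine 1 0 Triangularsℤ ⊠ Squares

  trianglePairs↔ℤ² : (Fin 2 × ℤ²) ↔ ℤ²
  trianglePairs↔ℤ² = ↔-trans (mk↔ₛ′ to from to∘from from∘to) (↔-trans splitOne
    (mk↔ₛ′ (λ (x , l) → x + l , l) (λ (k , l) → k - l , l)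
        (λ (k , l) → cong (_, l) (lemma₁ k l)) (λ (x , l) → cong (_, l) (lemma₂ x l))))
    where
    to from : Fin 2 × ℤ² → Fin 2 × ℤ²
    to (zero  , x , y) = zero , y , x - y
    to (suc s , x , y) = suc s , x , y - 1ℤ - x
    from (zero  , w , l) = zero , l + w , w
    from (suc s , w , l) = suc s , w , l + w + 1ℤ
    lemma₁ : ∀ k l → k - l + l ≡ k
    lemma₁ = solve-∀
    lemma₂ : ∀ x l → x + l - l ≡ x
    lemma₂ = solve-∀
    lemma₃ : ∀ l w → l + w + 1ℤ - 1ℤ - w ≡ l
    lemma₃ = solve-∀
    lemma₄ : ∀ x y → y - 1ℤ - x + x + 1ℤ ≡ y
    lemma₄ = solve-∀
    to∘from : ∀ z → to (from z) ≡ z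
    to∘from (zero  , w , l) = cong (λ l → zero , w , l) (lemma₂ l w)
    to∘from (suc s , w , l) = cong (λ l → suc s , w , l) (lemma₃ l w)
    from∘to : ∀ z → from (to z) ≡ z
    from∘to (zero  , x , y) = cong (λ x → zero , x , y) (lemma₁ x y)
    from∘to (suc s , x , y) = cong (λ y → suc s , x , y) (lemma₄ x y)

  -- Both parity classes of k - l lead to the same weight 2 T(x) + y², which is why θ² is twice a
  -- product.
  T-pair : ∀ x y k l → k * (k + 1ℤ) + l * (l + 1ℤ) ≡ (x * (x + 1ℤ) + y * y) * + 2 →
           T k ℕ.+ T l ≡ 0 ℕ.+ T x ℕ.* 2 ℕ.+ sq y
  T-pair x y k l eq = halve (begin
    (+ T k + + T l) * + 2                    ≡⟨ ℤₚ.*-distribʳ-+ (+ 2) (+ T k) (+ T l) ⟩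
    + T k * + 2 + + T l * + 2                ≡⟨ cong₂ _+_ (T-* k) (T-* l) ⟩
    k * (k + 1ℤ) + l * (l + 1ℤ)              ≡⟨ eq ⟩
    (x * (x + 1ℤ) + y * y) * + 2             ≡⟨ cong₂ (λ u v → (u + v) * + 2) (T-* x) (sq-* y) ⟨
    (+ T x * + 2 + + sq y) * + 2             ≡⟨ cong (λ u → (u + + sq y) * + 2) (ℤₚ.pos-* (T x) 2) ⟨
    + (T x ℕ.* 2 ℕ.+ sq y) * + 2             ∎)
    where open ≡-Reasoning

  trianglePairs-weight : ∀ z → weight (Triangularsℤ ⊠ Triangularsℤ) (Inverse.to trianglePairs↔ℤ² z) ≡
      weight (⨄ trianglePairs) z
  trianglePairs-weight (zero , x , y) = T-pair x y (0ℤ + y * + 2 + (x - y)) (x - y) (lemma x y)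
    where
    lemma : ∀ x y → (0ℤ + y * + 2 + (x - y)) * (0ℤ + y * + 2 + (x - y) + 1ℤ) + (x - y) * (x - y + 1ℤ) ≡
        (x * (x + 1ℤ) + y * y) * + 2
    lemma = solve-∀
  trianglePairs-weight (suc zero , x , y) =
    T-pair x y (1ℤ + x * + 2 + (y - 1ℤ - x)) (y - 1ℤ - x) (lemma x y)
    where
    lemma : ∀ x y → (1ℤ + x * + 2 + (y - 1ℤ - x)) * (1ℤ + x * + 2 + (y - 1ℤ - x) + 1ℤ) +
            (y - 1ℤ - x) * (y - 1ℤ - x + 1ℤ) ≡ (x * (x + 1ℤ) + y * y) * + 2
    lemma = solve-∀

  fiveSquares : Weighted
  fiveSquares = Squares ⊠ Squares ⊠ Squares ⊠ Squares ⊠ Squares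

  r₅-gf : ∀ n → + r 5 n ≡ gf fiveSquares n
  r₅-gf n = cong +_ (count-≡ (representations 5 n) (fibre fiveSquares n) to from from∘to
    (λ {xs} eq → ℤₚ.+-injective (trans (sym (weight-to xs)) eq))
    (λ {y} eq → trans (weight-to (from y)) (cong +_ eq))
    (λ _ → refl))
    where
    to : Vec ℤ 5 → Carrier fiveSquares
    to (a ∷ b ∷ c ∷ d ∷ e ∷ []) = a , b , c , d , e
    from : Carrier fiveSquares → Vec ℤ 5
    from (a , b , c , d , e) = a ∷ b ∷ c ∷ d ∷ e ∷ []
    from∘to : ∀ xs → from (to xs) ≡ xs
    from∘to (a ∷ b ∷ c ∷ d ∷ e ∷ []) = refl
    weight-to : ∀ xs → sumOfSquares xs ≡ + weight fiveSquares (to xs)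
    weight-to xs@(a ∷ b ∷ c ∷ d ∷ e ∷ []) = trans (sumOfSquares≡+ xs)
      (cong (λ z → + (sq a ℕ.+ (sq b ℕ.+ (sq c ℕ.+ (sq d ℕ.+ z))))) (ℕₚ.+-identityʳ (sq e)))

open ThetaSeries

-- Dissections of ψ and φ, and the congruence modulo 9

module Dissections where

  open import Data.Integer.Tactic.RingSolver using (solve-∀)
  open import Data.List.Base using ([]; _∷_; foldr)
  open import Data.Nat.Tactic.RingSolver using () renaming (solve-∀ to solveℕ-∀)
  open import Defs using (r)
  open import Function.Construct.Identity using (↔-id)
  open import Relation.Binary.PropositionalEquality as ≡ using (_≡_)
  open SemiringIdentities seriesSemiring
  open CommutativeSemiring seriesSemiring
    using (setoid; refl; sym; trans; +-cong; +-congˡ; +-congʳ; *-cong; *-congˡ; *-congʳ; *-assoc; *-comm;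
        *-identityʳ)
  open import Relation.Binary.Reasoning.Setoid setoid

  double-cancel : ∀ f g → double f ≈ double g → f ≈ g
  double-cancel f g eq n = ℤₚ.*-cancelʳ-≡ (f n) (g n) (+ 2)
      (≡.trans (i*2 (f n)) (≡.trans (eq n) (≡.sym (i*2 (g n)))))
    where
    i*2 : ∀ i → i ℤ.* + 2 ≡ i ℤ.+ i
    i*2 = solve-∀

  X-cancel : ∀ f g → X ⊗ f ≈ X ⊗ g → f ≈ g
  X-cancel f g eq n = ≡.trans (≡.sym (X-⊗ f (suc n))) (≡.trans (eq (suc n)) (X-⊗ g (suc n)))

  spread-suc : ∀ k j f → spread 0ℤ k (suc j) f ≈ X ⊗ spread 0ℤ k j f
  spread-suc k j f zero    = ≡.refl
  spread-suc k j f (suc n) = ≡.sym (X-⊗ (spread 0ℤ k j f) (suc n))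

  -- Proved on weights instead of coefficients: there a composite of dilations only reassociates a
  -- product of natural numbers.
  dilate-gf-double : ∀ j k l W → suc l ≡ suc j ℕ.* suc k → dilate k (dilate j (gf W)) ≈ dilate l (gf W)
  dilate-gf-double j k l W eq = begin
    dilate k (dilate j (gf W))           ≈⟨ spread-cong k 0 (gf-affine j 0 W) ⟨
    dilate k (gf (affine j 0 W))         ≈⟨ gf-affine k 0 (affine j 0 W) ⟨
    gf (affine k 0 (affine j 0 W))       ≈⟨ gf-↔ (affine k 0 (affine j 0 W)) (affine l 0 W) (↔-id _)
         (λ x → ≡.trans (≡.cong (weight W x ℕ.*_) eq) (≡.sym (ℕₚ.*-assoc (weight W x) (suc j) (suc k)))) ⟩
    gf (affine l 0 W)                    ≈⟨ gf-affine l 0 W ⟩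
    dilate l (gf W)                      ∎

  ψ₃ ψ₉ a₃ : Series
  ψ₃ = dilate 2 ψ
  ψ₉ = dilate 2 ψ₃
  a₃ = dilate 2 (gf Pentagonals)

  slice₁ : gf (slice (suc zero)) ≈ double (ψ₉ ⊗ X)
  slice₁ = begin
    gf (affine 8 1 Triangularsℤ)               ≈⟨ gf-affine 8 1 Triangularsℤ ⟩
    spread 0ℤ 8 1 θ                       ≈⟨ spread-cong 8 1 θ≈ψ⊕ψ ⟩
    spread 0ℤ 8 1 (ψ ⊕ ψ)                 ≈⟨ spread-⊕ 8 1 ψ ψ ⟩
    double (spread 0ℤ 8 1 ψ)              ≈⟨ +-cong lemma lemma ⟩
    double (ψ₉ ⊗ X)                       ∎
    where
    lemma : spread 0ℤ 8 1 ψ ≈ ψ₉ ⊗ X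
    lemma = begin
      spread 0ℤ 8 1 ψ   ≈⟨ spread-suc 8 0 ψ ⟩
      X ⊗ dilate 8 ψ    ≈⟨ *-congˡ (dilate-gf-double 2 2 8 Triangularsℕ ≡.refl) ⟨
      X ⊗ ψ₉            ≈⟨ *-comm X ψ₉ ⟩
      ψ₉ ⊗ X            ∎

  slice₀ : gf (slice zero) ≈ a₃
  slice₀ = gf-affine 2 0 Pentagonals

  slice₂ : gf (slice (suc (suc zero))) ≈ a₃
  slice₂ = gf-affine 2 0 Pentagonals

  ψ-dissection : ψ ≈ a₃ ⊕ ψ₉ ⊗ X
  ψ-dissection = double-cancel ψ (a₃ ⊕ ψ₉ ⊗ X) (begin
    double ψ                                  ≈⟨ θ≈ψ⊕ψ ⟨
    θ                                         ≈⟨ θ-slices ⟩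
    ∑ (gf ∘ slice)                            ≈⟨ +-cong slice₀ (+-cong slice₁ (+-congʳ slice₂)) ⟩
    a₃ ⊕ (double (ψ₉ ⊗ X) ⊕ (a₃ ⊕ 𝟘))         ≈⟨ rearrange a₃ (ψ₉ ⊗ X) ⟩
    double (a₃ ⊕ ψ₉ ⊗ X)                      ∎)

  gf-⊠₄ : ∀ U V W Z → gf (U ⊠ V ⊠ W ⊠ Z) ≈ gf U ⊗ (gf V ⊗ (gf W ⊗ gf Z))
  gf-⊠₄ U V W Z = trans (gf-⊠ U (V ⊠ W ⊠ Z)) (*-congˡ {gf U}
      (trans (gf-⊠ V (W ⊠ Z)) (*-congˡ {gf V} (gf-⊠ W Z))))

  ∑-cong : ∀ {k} {f g : Fin k → Series} → (∀ i → f i ≈ g i) → ∑ f ≈ ∑ g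
  ∑-cong {zero}  eq = refl
  ∑-cong {suc k} eq = +-cong (eq zero) (∑-cong (eq ∘ suc))

  sliceSeries : Fin 3 → Series
  sliceSeries zero             = a₃
  sliceSeries (suc zero)       = double (ψ₉ ⊗ X)
  sliceSeries (suc (suc zero)) = a₃

  gf-slice : ∀ s → gf (slice s) ≈ sliceSeries s
  gf-slice zero             = slice₀
  gf-slice (suc zero)       = slice₁
  gf-slice (suc (suc zero)) = slice₂

  gf-codeword : ∀ s t → gf (codeword s t) ≈
    sliceSeries s ⊗ (sliceSeries t ⊗
      (sliceSeries (proj₁ (sumResidue s t)) ⊗ sliceSeries (proj₁ (differenceResidue s t))))
  gf-codeword s t = trans
    (gf-⊠₄ (slice s) (slice t) (slice (proj₁ (sumResidue s t))) (slice (proj₁ (differenceResidue s t))))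
    (*-cong (gf-slice s) (*-cong (gf-slice t) (*-cong (gf-slice (proj₁ (sumResidue s t)))
        (gf-slice (proj₁ (differenceResidue s t))))))

  dilated-fourth : dilate 2 (gf fourTriangularsℤ) ≈ double ψ₃ ⊗ (double ψ₃ ⊗ (double ψ₃ ⊗ double ψ₃))
  dilated-fourth = begin
    dilate 2 (gf fourTriangularsℤ)           ≈⟨ step (Triangularsℤ ⊠ Triangularsℤ ⊠ Triangularsℤ) ⟩
    double ψ₃ ⊗ dilate 2 (gf (Triangularsℤ ⊠ Triangularsℤ ⊠ Triangularsℤ))
      ≈⟨ *-congˡ (trans (step (Triangularsℤ ⊠ Triangularsℤ))
          (*-congˡ (trans (step Triangularsℤ) (*-congˡ θ₃)))) ⟩
    double ψ₃ ⊗ (double ψ₃ ⊗ (double ψ₃ ⊗ double ψ₃)) ∎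
    where
    θ₃ : dilate 2 θ ≈ double ψ₃
    θ₃ = trans (spread-cong 2 0 θ≈ψ⊕ψ) (spread-⊕ 2 0 ψ ψ)
    step : ∀ W → dilate 2 (gf (Triangularsℤ ⊠ W)) ≈ double ψ₃ ⊗ dilate 2 (gf W)
    step W = trans (spread-cong 2 0 (gf-⊠ Triangularsℤ W)) (trans (dilate-⊗ 2 θ (gf W)) (*-congʳ θ₃))

  -- The tetracode bijection gives this identity multiplied by 16q: on the left 16 comes from θ = 2ψ
  -- in four factors and q from the summand 1 in `T-quaternion`; on the right both come out of the
  -- enumerator.
  ψ₃-fourth : ψ₃ ⊗ (ψ₃ ⊗ (ψ₃ ⊗ ψ₃)) ≈ ψ₉ ⊗ (a₃ ⊗ a₃ ⊗ a₃ ⊕ (ψ₉ ⊗ X) ⊗ (ψ₉ ⊗ X) ⊗ (ψ₉ ⊗ X))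
  ψ₃-fourth = X-cancel _ _ (double-cancel _ _ (double-cancel _ _ (double-cancel _ _ (double-cancel _ _ (begin
    double (double (double (double (X ⊗ (ψ₃ ⊗ (ψ₃ ⊗ (ψ₃ ⊗ ψ₃)))))))
      ≈⟨ sixteen-fold-fourth X ψ₃ ⟨
    X ⊗ (double ψ₃ ⊗ (double ψ₃ ⊗ (double ψ₃ ⊗ double ψ₃)))
      ≈⟨ *-congˡ dilated-fourth ⟨
    X ⊗ dilate 2 (gf fourTriangularsℤ)
      ≈⟨ spread-suc 2 0 (gf fourTriangularsℤ) ⟨
    spread 0ℤ 2 1 (gf fourTriangularsℤ)
      ≈⟨ gf-affine 2 1 fourTriangularsℤ ⟨
    gf (affine 2 1 fourTriangularsℤ)
      ≈⟨ gf-↔ tetracode (affine 2 1 fourTriangularsℤ) tetracode↔ℤ⁴ tetracode-weight ⟨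
    gf tetracode
      ≈⟨ trans (gf-⨄ (λ s → ⨄ (codeword s))) (∑-cong (λ s →
          trans (gf-⨄ (codeword s)) (∑-cong (gf-codeword s)))) ⟩
    ∑ (λ s → ∑ (λ t → sliceSeries s ⊗ (sliceSeries t ⊗
      (sliceSeries (proj₁ (sumResidue s t)) ⊗ sliceSeries (proj₁ (differenceResidue s t))))))
      ≈⟨ tetracode-enumerator a₃ (ψ₉ ⊗ X) ⟩
    double (double (double (double ((ψ₉ ⊗ X) ⊗ (a₃ ⊗ a₃ ⊗ a₃ ⊕ (ψ₉ ⊗ X) ⊗ (ψ₉ ⊗ X) ⊗ (ψ₉ ⊗ X))))))
      ≈⟨ (let e = trans (*-congʳ (*-comm ψ₉ X)) (*-assoc X ψ₉ _) ; d = λ {f g} (p : f ≈ g) → +-cong p p in d (d (d (d e)))) ⟩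
    double (double (double (double (X ⊗ (ψ₉ ⊗ (a₃ ⊗ a₃ ⊗ a₃ ⊕ (ψ₉ ⊗ X) ⊗ (ψ₉ ⊗ X) ⊗ (ψ₉ ⊗ X)))))))
      ∎)))))

  section-cong : ∀ k j {f g} → f ≈ g → section k j f ≈ section k j g
  section-cong k j eq n = eq (j ℕ.+ n ℕ.* suc k)

  -- Iterates `section-dilate-⊗`: the dilated factors leave the section undilated, and only the
  -- innermost factor `g` is really sectioned.
  section-product : ∀ {k j} → j ≤ k → ∀ fs g {s} → section k j g ≈ s →
                    section k j (foldr (λ f h → dilate k f ⊗ h) g fs) ≈ foldr _⊗_ s fs
  section-product j≤k []       g eq = eq
  section-product j≤k (f ∷ fs) g eq =
    trans (section-dilate-⊗ j≤k f (foldr (λ f h → dilate _ f ⊗ h) g fs))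
        (*-congˡ {f} (section-product j≤k fs g eq))

  monomial : ℕ → Series
  monomial zero    = 𝟙
  monomial (suc i) = X· monomial i

  X² : X ⊗ X ≈ monomial 2
  X² = X-⊗ X

  X³ : X ⊗ (X ⊗ X) ≈ monomial 3
  X³ = trans (*-congˡ X²) (X-⊗ (monomial 2))

  X⁴ : X ⊗ (X ⊗ (X ⊗ X)) ≈ monomial 4
  X⁴ = trans (*-congˡ X³) (X-⊗ (monomial 3))

  X⁵ : X ⊗ (X ⊗ (X ⊗ (X ⊗ X))) ≈ monomial 5
  X⁵ = trans (*-congˡ X⁴) (X-⊗ (monomial 4))

  double-cong : ∀ {f g} → f ≈ g → double f ≈ double g
  double-cong p = +-cong p p

  quintuple-cong : ∀ {f g} → f ≈ g → quintuple f ≈ quintuple g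
  quintuple-cong p = +-cong (+-cong (+-cong (+-cong p p) p) p) p

  treble-cong : ∀ {f g} → f ≈ g → treble f ≈ treble g
  treble-cong p = +-cong (+-cong p p) p

  θ₂ θ₄ φ₂ : Series
  θ₂ = dilate 1 θ
  θ₄ = dilate 1 θ₂
  φ₂ = dilate 1 φ

  φ-dissection : φ ≈ dilate 3 φ ⊕ X ⊗ dilate 3 θ₂
  φ-dissection = begin
    φ                                             ≈⟨ φ-parities ⟩
    gf (parity zero) ⊕ (gf (parity (suc zero)) ⊕ 𝟘) ≈⟨ +-cong (gf-affine 3 0 Squares)
        (λ n → ℤₚ.+-identityʳ _) ⟩
    dilate 3 φ ⊕ gf (parity (suc zero))           ≈⟨ +-congˡ {dilate 3 φ} odd ⟩
    dilate 3 φ ⊕ X ⊗ dilate 3 θ₂                  ∎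
    where
    odd : gf (parity (suc zero)) ≈ X ⊗ dilate 3 θ₂
    odd = begin
      gf (affine 3 1 (affine 1 0 Triangularsℤ))    ≈⟨ gf-affine 3 1 (affine 1 0 Triangularsℤ) ⟩
      spread 0ℤ 3 1 (gf (affine 1 0 Triangularsℤ)) ≈⟨ spread-cong 3 1 (gf-affine 1 0 Triangularsℤ) ⟩
      spread 0ℤ 3 1 θ₂                        ≈⟨ spread-suc 3 0 θ₂ ⟩
      X ⊗ dilate 3 θ₂                         ∎

  even-square-sum : dilate 3 φ ⊗ dilate 3 φ ⊕ (X ⊗ dilate 3 θ₂) ⊗ (X ⊗ dilate 3 θ₂) ≈ φ₂ ⊗ φ₂
  even-square-sum = begin
    dilate 3 φ ⊗ dilate 3 φ ⊕ (X ⊗ dilate 3 θ₂) ⊗ (X ⊗ dilate 3 θ₂)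
      ≈⟨ +-cong (*-cong even even) (*-cong odd odd) ⟨
    gf (parity zero) ⊗ gf (parity zero) ⊕ gf (parity (suc zero)) ⊗ gf (parity (suc zero))
      ≈⟨ (λ n → ≡.cong (λ z → (gf (parity zero) ⊗ gf (parity zero)) n ℤ.+ z) (ℤₚ.+-identityʳ _)) ⟨
    ∑ (λ s → gf (parity s) ⊗ gf (parity s))
      ≈⟨ ∑-cong (λ s → gf-⊠ (parity s) (parity s)) ⟨
    ∑ (λ s → gf (parity s ⊠ parity s))
      ≈⟨ gf-⨄ (λ s → parity s ⊠ parity s) ⟨
    gf equalParity
      ≈⟨ gf-↔ equalParity (affine 1 0 (Squares ⊠ Squares)) equalParity↔ℤ² equalParity-weight ⟩
    gf (affine 1 0 (Squares ⊠ Squares))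
      ≈⟨ gf-affine 1 0 (Squares ⊠ Squares) ⟩
    dilate 1 (gf (Squares ⊠ Squares))
      ≈⟨ trans (spread-cong 1 0 (gf-⊠ Squares Squares)) (dilate-⊗ 1 φ φ) ⟩
    φ₂ ⊗ φ₂ ∎
    where
    even : gf (parity zero) ≈ dilate 3 φ
    even = gf-affine 3 0 Squares
    odd : gf (parity (suc zero)) ≈ X ⊗ dilate 3 θ₂
    odd = trans (gf-affine 3 1 (affine 1 0 Triangularsℤ))
        (trans (spread-cong 3 1 (gf-affine 1 0 Triangularsℤ)) (spread-suc 3 0 θ₂))

  θ-square : θ ⊗ θ ≈ double (θ₂ ⊗ φ)
  θ-square = begin
    θ ⊗ θ                          ≈⟨ gf-⊠ Triangularsℤ Triangularsℤ ⟨
    gf (Triangularsℤ ⊠ Triangularsℤ)         ≈⟨ gf-↔ (⨄ trianglePairs)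
        (Triangularsℤ ⊠ Triangularsℤ) trianglePairs↔ℤ² trianglePairs-weight ⟨
    gf (⨄ trianglePairs)             ≈⟨ gf-⨄ trianglePairs ⟩
    pair ⊕ (pair ⊕ 𝟘)              ≈⟨ (λ n → ≡.cong (λ z → pair n ℤ.+ z) (ℤₚ.+-identityʳ (pair n))) ⟩
    double pair                    ≈⟨ double-cong (trans (gf-⊠ (affine 1 0 Triangularsℤ) Squares)
        (*-congʳ (gf-affine 1 0 Triangularsℤ))) ⟩
    double (θ₂ ⊗ φ)                ∎
    where
    pair = gf (affine 1 0 Triangularsℤ ⊠ Squares)

  dilate-pair : ∀ k {f g h} → f ⊗ f ≈ double (g ⊗ h) →
                dilate k f ⊗ dilate k f ≈ double (dilate k g ⊗ dilate k h)
  dilate-pair k {f} {g} {h} eq = begin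
    dilate k f ⊗ dilate k f              ≈⟨ dilate-⊗ k f f ⟨
    dilate k (f ⊗ f)                     ≈⟨ spread-cong k 0 eq ⟩
    dilate k (double (g ⊗ h))            ≈⟨ spread-⊕ k 0 (g ⊗ h) (g ⊗ h) ⟩
    double (dilate k (g ⊗ h))            ≈⟨ double-cong (dilate-⊗ k g h) ⟩
    double (dilate k g ⊗ dilate k h)     ∎

  -- As 8n + 5 = 4(2n + 1) + 1, the exponents 4m + 1 are taken first and the odd m afterwards. In
  -- the fifth power of φ(q⁴) + q θ(q⁸) only the powers q and q⁵ of the second summand's prefactor
  -- lie in the class of 1.
  section-fifth-power : section 3 1 (φ ⊗ (φ ⊗ (φ ⊗ (φ ⊗ φ)))) ≈
    quintuple (θ₂ ⊗ (φ ⊗ (φ ⊗ (φ ⊗ φ)))) ⊕ θ₂ ⊗ (θ₂ ⊗ (θ₂ ⊗ (θ₂ ⊗ (θ₂ ⊗ X))))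
  section-fifth-power = trans (section-cong 3 1 (trans
    (let d = φ-dissection in *-cong d (*-cong d (*-cong d (*-cong d d))))
    (fifth-power (dilate 3 φ) (dilate 3 θ₂) X))) (trans
    (+-cong (+-cong (+-cong (+-cong (+-cong
      (product (φ ∷ φ ∷ φ ∷ φ ∷ φ ∷ []) 𝟙 (λ _ → ≡.refl))
      (quintuple-cong (product (φ ∷ φ ∷ φ ∷ φ ∷ θ₂ ∷ []) X X-section)))
      (double-cong (quintuple-cong (product (φ ∷ φ ∷ φ ∷ θ₂ ∷ θ₂ ∷ []) (X ⊗ X)
          (trans (section-cong 3 1 X²) monomial₂)))))
      (double-cong (quintuple-cong (product (φ ∷ φ ∷ θ₂ ∷ θ₂ ∷ θ₂ ∷ []) (X ⊗ (X ⊗ X))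
          (trans (section-cong 3 1 X³) monomial₃)))))
      (quintuple-cong (product (φ ∷ θ₂ ∷ θ₂ ∷ θ₂ ∷ θ₂ ∷ []) (X ⊗ (X ⊗ (X ⊗ X)))
          (trans (section-cong 3 1 X⁴) monomial₄))))
      (product (θ₂ ∷ θ₂ ∷ θ₂ ∷ θ₂ ∷ θ₂ ∷ []) (X ⊗ (X ⊗ (X ⊗ (X ⊗ X))))
          (trans (section-cong 3 1 X⁵) monomial₅)))
    (fifth-power-section φ θ₂ X))
    where
    product = section-product {3} {1} (s≤s z≤n)
    X-section : section 3 1 X ≈ 𝟙
    X-section zero    = ≡.refl
    X-section (suc n) = ≡.refl
    monomial₂ : section 3 1 (monomial 2) ≈ 𝟘
    monomial₂ zero    = ≡.refl
    monomial₂ (suc n) = ≡.refl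
    monomial₃ : section 3 1 (monomial 3) ≈ 𝟘
    monomial₃ zero    = ≡.refl
    monomial₃ (suc n) = ≡.refl
    monomial₄ : section 3 1 (monomial 4) ≈ 𝟘
    monomial₄ zero    = ≡.refl
    monomial₄ (suc n) = ≡.refl
    monomial₅ : section 3 1 (monomial 5) ≈ X
    monomial₅ zero          = ≡.refl
    monomial₅ (suc zero)    = ≡.refl
    monomial₅ (suc (suc n)) = ≡.refl

  -- The even powers of q drop out, and the odd part of the doubled product is q θ(q²)⁵.
  section-fourth-power : double (section 1 1 (θ₂ ⊗ (φ ⊗ (φ ⊗ (φ ⊗ φ))))) ≈ θ ⊗ (θ ⊗ (θ ⊗ (θ ⊗ θ)))
  section-fourth-power = trans (section-cong 1 1 (trans
    (double-cong (*-congˡ (let d = dissection in *-cong d (*-cong d (*-cong d d)))))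
    (fourth-power-doubled {dilate 1 φ₂} {dilate 1 θ₄} {X} {φ₂} {θ₂} {θ₄} square-sum
      (dilate-pair 1 pair₂) pair₂ θ₂))) (trans
    (+-cong (+-cong (+-cong
      (double-cong (product (θ ∷ φ₂ ∷ φ₂ ∷ φ₂ ∷ φ₂ ∷ []) 𝟙 (λ _ → ≡.refl)))
      (double-cong (double-cong (treble-cong (product (θ ∷ φ₂ ∷ φ₂ ∷ θ₄ ∷ θ₄ ∷ []) (X ⊗ X)
          (trans (section-cong 1 1 X²) monomial₂))))))
      (double-cong (product (θ ∷ θ₄ ∷ θ₄ ∷ θ₄ ∷ θ₄ ∷ []) (X ⊗ (X ⊗ (X ⊗ X)))
          (trans (section-cong 1 1 X⁴) monomial₄))))
      (product (θ ∷ θ ∷ θ ∷ θ ∷ θ ∷ []) X X-section))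
    (fourth-power-section φ₂ θ θ₄))
    where
    product = section-product {1} {1} (s≤s z≤n)
    pair₂ = dilate-pair 1 θ-square
    φ₄ : dilate 1 φ₂ ≈ dilate 3 φ
    φ₄ = dilate-gf-double 1 1 3 Squares ≡.refl
    θ₈ : dilate 1 θ₄ ≈ dilate 3 θ₂
    θ₈ = begin
      dilate 1 (dilate 1 θ₂)  ≈⟨ spread-cong 1 0 (spread-cong 1 0 (gf-affine 1 0 Triangularsℤ)) ⟨
      dilate 1 (dilate 1 (gf (affine 1 0 Triangularsℤ)))
          ≈⟨ dilate-gf-double 1 1 3 (affine 1 0 Triangularsℤ) ≡.refl ⟩
      dilate 3 (gf (affine 1 0 Triangularsℤ)) ≈⟨ spread-cong 3 0 (gf-affine 1 0 Triangularsℤ) ⟩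
      dilate 3 θ₂ ∎
    dissection : φ ≈ dilate 1 φ₂ ⊕ X ⊗ dilate 1 θ₄
    dissection = trans φ-dissection (+-cong (sym φ₄) (*-congˡ (sym θ₈)))
    square-sum : dilate 1 φ₂ ⊗ dilate 1 φ₂ ⊕ (X ⊗ dilate 1 θ₄) ⊗ (X ⊗ dilate 1 θ₄) ≈ φ₂ ⊗ φ₂
    square-sum = trans (+-cong (*-cong φ₄ φ₄) (*-cong (*-congˡ θ₈) (*-congˡ θ₈))) even-square-sum
    X-section : section 1 1 X ≈ 𝟙
    X-section zero    = ≡.refl
    X-section (suc n) = ≡.refl
    monomial₂ : section 1 1 (monomial 2) ≈ 𝟘
    monomial₂ zero    = ≡.refl
    monomial₂ (suc n) = ≡.refl
    monomial₄ : section 1 1 (monomial 4) ≈ 𝟘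
    monomial₄ zero          = ≡.refl
    monomial₄ (suc zero)    = ≡.refl
    monomial₄ (suc (suc n)) = ≡.refl

  θ-fifth : Series
  θ-fifth = θ ⊗ (θ ⊗ (θ ⊗ (θ ⊗ θ)))

  ψ-fifth : Series
  ψ-fifth = ψ ⊗ ψ ⊗ ψ ⊗ ψ ⊗ ψ

  r₅-section : section 1 1 (section 3 1 (gf fiveSquares)) ≈
    (let w = double (double (double (double ψ-fifth))) in quintuple w ⊕ double w)
  r₅-section = double-cancel _ _ (begin
    double (section 1 1 (section 3 1 (gf fiveSquares)))
      ≈⟨ double-cong (section-cong 1 1 (section-cong 3 1 gf-fiveSquares)) ⟩
    double (section 1 1 (section 3 1 (φ ⊗ (φ ⊗ (φ ⊗ (φ ⊗ φ))))))
      ≈⟨ double-cong (section-cong 1 1 section-fifth-power) ⟩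
    double (quintuple u ⊕ section 1 1 (θ₂ ⊗ (θ₂ ⊗ (θ₂ ⊗ (θ₂ ⊗ (θ₂ ⊗ X))))))
      ≈⟨ double-cong {quintuple u ⊕ section 1 1 (θ₂ ⊗ (θ₂ ⊗ (θ₂ ⊗ (θ₂ ⊗ (θ₂ ⊗ X)))))}
           (+-congˡ {quintuple u} (trans (section-product {1} {1} (s≤s z≤n)
               (θ ∷ θ ∷ θ ∷ θ ∷ θ ∷ []) X X-section)
             (*-congˡ {θ} (*-congˡ {θ} (*-congˡ {θ} (*-congˡ {θ} (*-identityʳ θ))))))) ⟩
    double (quintuple u ⊕ θ-fifth)
      ≈⟨ double-quintuple u θ-fifth ⟩
    quintuple (double u) ⊕ double θ-fifth
      ≈⟨ +-congʳ (quintuple-cong section-fourth-power) ⟩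
    quintuple θ-fifth ⊕ double θ-fifth
      ≈⟨ +-cong (quintuple-cong fifth) (double-cong fifth) ⟩
    quintuple (s ⊗ (s ⊗ (s ⊗ (s ⊗ s)))) ⊕ double (s ⊗ (s ⊗ (s ⊗ (s ⊗ s))))
      ≈⟨ five-doubles ψ ⟩
    double (quintuple w ⊕ double w) ∎)
    where
    u = section 1 1 (θ₂ ⊗ (φ ⊗ (φ ⊗ (φ ⊗ φ))))
    w = double (double (double (double ψ-fifth)))
    s = double ψ
    fifth : θ-fifth ≈ s ⊗ (s ⊗ (s ⊗ (s ⊗ s)))
    fifth = let p = θ≈ψ⊕ψ in *-cong p (*-cong p (*-cong p (*-cong p p)))
    X-section : section 1 1 X ≈ 𝟙
    X-section zero    = ≡.refl
    X-section (suc n) = ≡.refl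
    gf-fiveSquares : gf fiveSquares ≈ φ ⊗ (φ ⊗ (φ ⊗ (φ ⊗ φ)))
    gf-fiveSquares = trans (gf-⊠ Squares (Squares ⊠ Squares ⊠ Squares ⊠ Squares))
      (*-congˡ {φ} (gf-⊠₄ Squares Squares Squares Squares))

  r₅≡112ψ⁵ : ∀ n → + r 5 (8 ℕ.* n ℕ.+ 5) ≡ + 112 ℤ.* ψ-fifth n
  r₅≡112ψ⁵ n = ≡.trans (≡.cong (λ m → + r 5 m) (index n))
    (≡.trans (r₅-gf (1 ℕ.+ (1 ℕ.+ n ℕ.* 2) ℕ.* 4)) (≡.trans (r₅-section n) (count (ψ-fifth n))))
    where
    index : ∀ n → 8 ℕ.* n ℕ.+ 5 ≡ 1 ℕ.+ (1 ℕ.+ n ℕ.* 2) ℕ.* 4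
    index = solveℕ-∀
    count : ∀ x → let d = λ y → y ℤ.+ y ; w = d (d (d (d x))) in
            w ℤ.+ w ℤ.+ w ℤ.+ w ℤ.+ w ℤ.+ (w ℤ.+ w) ≡ + 112 ℤ.* x
    count = solve-∀

  -- Fermat's congruence; the witnesses are (a³ - a)/3 expanded for a = 3q, 3q + 1 and 3q + 2.
  cube-mod-3 : ∀ a → ∃ λ y → a ℤ.* a ℤ.* a ≡ a ℤ.+ (y ℤ.+ y ℤ.+ y)
  cube-mod-3 a = ≡.subst (λ a → ∃ λ y → a ℤ.* a ℤ.* a ≡ a ℤ.+ (y ℤ.+ y ℤ.+ y)) (recompose-residue 3 a)
      (cubes (residue 3 a))
    where
    lemma₀ : ∀ q → let a = 0ℤ ℤ.+ q ℤ.* + 3 ; y = + 9 ℤ.* q ℤ.* q ℤ.* q ℤ.- q in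
             a ℤ.* a ℤ.* a ≡ a ℤ.+ (y ℤ.+ y ℤ.+ y)
    lemma₀ = solve-∀
    lemma₁ : ∀ q → let a = 1ℤ ℤ.+ q ℤ.* + 3 ; y = + 9 ℤ.* q ℤ.* q ℤ.* q ℤ.+ + 9 ℤ.* q ℤ.* q ℤ.+ + 2 ℤ.* q in
             a ℤ.* a ℤ.* a ≡ a ℤ.+ (y ℤ.+ y ℤ.+ y)
    lemma₁ = solve-∀
    lemma₂ : ∀ q → let a = + 2 ℤ.+ q ℤ.* + 3 ; y = + 9 ℤ.* q ℤ.* q ℤ.* q ℤ.+ + 18 ℤ.* q ℤ.* q ℤ.+ + 11 ℤ.* q ℤ.+ + 2 in
             a ℤ.* a ℤ.* a ≡ a ℤ.+ (y ℤ.+ y ℤ.+ y)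
    lemma₂ = solve-∀
    cubes : ∀ x → let a = recompose {3} x in ∃ λ y → a ℤ.* a ℤ.* a ≡ a ℤ.+ (y ℤ.+ y ℤ.+ y)
    cubes (zero , q)           = + 9 ℤ.* q ℤ.* q ℤ.* q ℤ.- q , lemma₀ q
    cubes (suc zero , q)       = + 9 ℤ.* q ℤ.* q ℤ.* q ℤ.+ + 9 ℤ.* q ℤ.* q ℤ.+ + 2 ℤ.* q , lemma₁ q
    cubes (suc (suc zero) , q) =
      + 9 ℤ.* q ℤ.* q ℤ.* q ℤ.+ + 18 ℤ.* q ℤ.* q ℤ.+ + 11 ℤ.* q ℤ.+ + 2 , lemma₂ q

  head-tail : ∀ f → f ≈ const (f 0) ⊕ X ⊗ (f ∘ suc)
  head-tail f zero    = ≡.sym (ℤₚ.+-identityʳ (f 0))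
  head-tail f (suc n) = ≡.sym (≡.trans (ℤₚ.+-identityˡ _) (X-⊗ (f ∘ suc) (suc n)))

  const-⊗-const : ∀ a b → const a ⊗ const b ≈ const (a ℤ.* b)
  const-⊗-const a b zero    = ≡.refl
  const-⊗-const a b (suc n) = ≡.trans (const-⊗ a (const b) (suc n)) (ℤₚ.*-zeroʳ a)

  -- The Frobenius congruence.  Writing f = a + q g gives f³ = a³ + q³ g³ + 3 a q g f.
  frobenius : ∀ f n → ∃ λ y → (f ⊗ f ⊗ f) n ≡ dilate 2 f n ℤ.+ (y ℤ.+ y ℤ.+ y)
  frobenius f n = extend (remainder n)
    where
    g = f ∘ suc
    cross : Series
    cross = const (f 0) ⊗ (X ⊗ g) ⊗ f
    expansion : f ⊗ f ⊗ f ≈ const (f 0 ℤ.* f 0 ℤ.* f 0) ⊕ X ⊗ (X ⊗ (X ⊗ (g ⊗ g ⊗ g))) ⊕ treble cross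
    expansion = begin
      f ⊗ f ⊗ f
        ≈⟨ *-cong (*-cong (head-tail f) (head-tail f)) (head-tail f) ⟩
      (c ⊕ X ⊗ g) ⊗ (c ⊕ X ⊗ g) ⊗ (c ⊕ X ⊗ g)
        ≈⟨ cube-of-sum c X g ⟩
      c ⊗ c ⊗ c ⊕ X ⊗ (X ⊗ (X ⊗ (g ⊗ g ⊗ g))) ⊕ treble (c ⊗ (X ⊗ g) ⊗ (c ⊕ X ⊗ g))
        ≈⟨ +-cong (+-congʳ {X ⊗ (X ⊗ (X ⊗ (g ⊗ g ⊗ g)))}
            (trans (*-congʳ {c} (const-⊗-const (f 0) (f 0))) (const-⊗-const (f 0 ℤ.* f 0) (f 0))))
             (treble-cong (*-congˡ {c ⊗ (X ⊗ g)} (sym (head-tail f)))) ⟩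
      const (f 0 ℤ.* f 0 ℤ.* f 0) ⊕ X ⊗ (X ⊗ (X ⊗ (g ⊗ g ⊗ g))) ⊕ treble cross ∎
      where
      c = const (f 0)
    X³-⊗ : ∀ h → X ⊗ (X ⊗ (X ⊗ h)) ≈ X· X· X· h
    X³-⊗ h = trans (*-congˡ {X} (trans (*-congˡ {X} (X-⊗ h)) (X-⊗ (X· h)))) (X-⊗ (X· X· h))
    remainder : ∀ n → ∃ λ y → (const (f 0 ℤ.* f 0 ℤ.* f 0) ⊕ X· X· X· (g ⊗ g ⊗ g)) n ≡
        dilate 2 f n ℤ.+ (y ℤ.+ y ℤ.+ y)
    remainder zero                = let y , eq = cube-mod-3 (f 0) in y , ≡.trans (ℤₚ.+-identityʳ _) eq
    remainder (suc zero)          = 0ℤ , ≡.refl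
    remainder (suc (suc zero))    = 0ℤ , ≡.refl
    -- Three degrees further on, both q³ g(q)³ and f(q³) are governed by the tail g, so the claim is
    -- the same congruence for g.
    remainder (suc (suc (suc n))) = let y , eq = frobenius g n in y , ≡.trans (ℤₚ.+-identityˡ _) eq
    extend : (∃ λ y → (const (f 0 ℤ.* f 0 ℤ.* f 0) ⊕ X· X· X· (g ⊗ g ⊗ g)) n ≡
        dilate 2 f n ℤ.+ (y ℤ.+ y ℤ.+ y)) →
             ∃ λ y → (f ⊗ f ⊗ f) n ≡ dilate 2 f n ℤ.+ (y ℤ.+ y ℤ.+ y)
    extend (y , eq) = y ℤ.+ cross n , ≡.trans (expansion n) (≡.trans
      (≡.cong (ℤ._+ treble cross n) (≡.trans (≡.cong (ℤ._+_ (const (f 0 ℤ.* f 0 ℤ.* f 0) n))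
          (X³-⊗ (g ⊗ g ⊗ g) n)) eq))
      (collect (dilate 2 f n) y (cross n)))
      where
      collect : ∀ d y c → d ℤ.+ (y ℤ.+ y ℤ.+ y) ℤ.+ (c ℤ.+ c ℤ.+ c) ≡
          d ℤ.+ (y ℤ.+ c ℤ.+ (y ℤ.+ c) ℤ.+ (y ℤ.+ c))
      collect = solve-∀

  module _ {P : Series} (inverse : P ⊗ ψ ≈ 𝟙) where

    dissected-inverse : ψ₃ ⊗ (ψ₃ ⊗ (ψ₃ ⊗ (ψ₃ ⊗ P))) ⊕ ψ₉ ⊗ (a₃ ⊗ (ψ₉ ⊗ X)) ≈
                        ψ₉ ⊗ (a₃ ⊗ (a₃ ⊗ 𝟙)) ⊕ ψ₉ ⊗ (ψ₉ ⊗ (ψ₉ ⊗ (X ⊗ X)))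
    dissected-inverse = multiply-inverse-cubes {P} {a₃} {ψ₉} {X} {ψ₃}
        (trans (*-congˡ {P} (sym ψ-dissection)) inverse) ψ₃-fourth

    section-inverse : ψ ⊗ (ψ ⊗ (ψ ⊗ (ψ ⊗ section 2 2 P))) ≈ ψ₃ ⊗ (ψ₃ ⊗ ψ₃)
    section-inverse = begin
      ψ ⊗ (ψ ⊗ (ψ ⊗ (ψ ⊗ U)))
        ≈⟨ drop-zero ψ₃ (gf Pentagonals) (ψ ⊗ (ψ ⊗ (ψ ⊗ (ψ ⊗ U)))) ⟨
      ψ ⊗ (ψ ⊗ (ψ ⊗ (ψ ⊗ U))) ⊕ ψ₃ ⊗ (gf Pentagonals ⊗ (ψ₃ ⊗ 𝟘))
        ≈⟨ +-cong (product (ψ ∷ ψ ∷ ψ ∷ ψ ∷ []) P refl)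
             (product (ψ₃ ∷ gf Pentagonals ∷ ψ₃ ∷ []) X (λ _ → ≡.refl)) ⟨
      section 2 2 (ψ₃ ⊗ (ψ₃ ⊗ (ψ₃ ⊗ (ψ₃ ⊗ P))) ⊕ ψ₉ ⊗ (a₃ ⊗ (ψ₉ ⊗ X)))
        ≈⟨ section-cong 2 2 dissected-inverse ⟩
      section 2 2 (ψ₉ ⊗ (a₃ ⊗ (a₃ ⊗ 𝟙)) ⊕ ψ₉ ⊗ (ψ₉ ⊗ (ψ₉ ⊗ (X ⊗ X))))
        ≈⟨ +-cong (product (ψ₃ ∷ gf Pentagonals ∷ gf Pentagonals ∷ []) 𝟙 (λ _ → ≡.refl))
             (product (ψ₃ ∷ ψ₃ ∷ ψ₃ ∷ []) (X ⊗ X) (trans (section-cong 2 2 X²) monomial₂)) ⟩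
      ψ₃ ⊗ (gf Pentagonals ⊗ (gf Pentagonals ⊗ 𝟘)) ⊕ ψ₃ ⊗ (ψ₃ ⊗ (ψ₃ ⊗ 𝟙))
        ≈⟨ collapse ψ₃ (gf Pentagonals) ⟩
      ψ₃ ⊗ (ψ₃ ⊗ ψ₃) ∎
      where
      U = section 2 2 P
      product = section-product {2} {2} (s≤s (s≤s z≤n))
      monomial₂ : section 2 2 (monomial 2) ≈ 𝟙
      monomial₂ zero    = ≡.refl
      monomial₂ (suc n) = ≡.refl

    ψ-fifth-mod-9 : ∀ n → ∃ λ z → ψ-fifth n ≡ P (2 ℕ.+ n ℕ.* 3) ℤ.+ + 9 ℤ.* z
    ψ-fifth-mod-9 n = z n , ≡.trans
      -- The witnesses of the Frobenius congruence, one per degree, form the series `y` with ψ³ =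
      -- ψ(q³) + 3y.
      (cube-lift {P} {ψ} {ψ₃} {y} {section 2 2 P} inverse (λ n → proj₂ (frobenius ψ n)) section-inverse n)
      (≡.cong (ℤ._+_ (P (2 ℕ.+ n ℕ.* 3))) (nine (z n)))
      where
      y z : Series
      y n = proj₁ (frobenius ψ n)
      z = P ⊗ P ⊗ P ⊗ P ⊗ (ψ₃ ⊗ ψ₃ ⊗ y ⊕ treble (ψ₃ ⊗ y ⊗ y) ⊕ treble (y ⊗ y ⊗ y))
      nine : ∀ z → (z ℤ.+ z ℤ.+ z) ℤ.+ (z ℤ.+ z ℤ.+ z) ℤ.+ (z ℤ.+ z ℤ.+ z) ≡ + 9 ℤ.* z
      nine = solve-∀

open Dissections

-- Partitions with distinct odd parts and bounded part size

module PodPartitions where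

  open import Data.Empty using (⊥-elim)
  open import Data.Integer.Tactic.RingSolver using (solve-∀)
  open import Data.List.Base using (List; []; _∷_; filter)
  open import Data.List.Membership.Propositional.Properties using (∈-filter⁺; ∈-filter⁻)
  open import Data.List.Properties using (filter-accept; filter-reject)
  open import Data.List.Relation.Unary.All as All using (All; []; _∷_)
  open import Data.List.Relation.Unary.AllPairs using ([]; _∷_)
  open import Data.List.Relation.Unary.Linked as Linked using (Linked; []; [-]; _∷_)
  open import Data.List.Relation.Unary.Linked.Properties using (Linked⇒AllPairs)
  open import Data.List.Relation.Unary.Unique.Propositional using (Unique)
  open import Data.Nat.Divisibility using (_∣_; divides; ∣m+n∣m⇒∣n; ∣⇒≤)
  open import Data.Sum.Base as Sum using (_⊎_; inj₁; inj₂)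
  open import Defs
    using (Enumeration; elements; unique; complete; count; enumerate-filter; isPartition; Odd; odd?;
        OddPartsDistinct; IsPodPartition; isPodPartition?; parts≤sum; podPartitions; pod)
  open import Relation.Binary.PropositionalEquality
  open import Relation.Nullary.Decidable using (yes; no; _×-dec_)
  open import Relation.Nullary.Negation using (¬_)

  shift : ℕ → Series → Series
  shift zero    f = f
  shift (suc k) f = X· shift k f

  shift-< : ∀ {k n} f → n < k → shift k f n ≡ 0ℤ
  shift-< {suc k} {zero}  f _         = refl
  shift-< {suc k} {suc n} f (s≤s n<k) = shift-< f n<k

  shift-+ : ∀ k f i → shift k f (k ℕ.+ i) ≡ f i
  shift-+ zero    f i = refl
  shift-+ (suc k) f i = shift-+ k f i

  monomial-⊗ : ∀ k f → monomial k ⊗ f ≈ shift k f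
  monomial-⊗ zero    f n       = trans (const-⊗ 1ℤ f n) (ℤₚ.*-identityˡ (f n))
  monomial-⊗ (suc k) f zero    = refl
  monomial-⊗ (suc k) f (suc n) = trans (ℤₚ.+-identityˡ _) (monomial-⊗ k f n)

  -- The bound on the parts replaces the infinite product by its partial products, each differing
  -- from the previous one by a single factor.
  IsPodBelow : ℕ → ℕ → List ℕ → Set
  IsPodBelow m n parts = IsPodPartition n parts × All (_≤ m) parts

  podsBelow : ∀ m n → Enumeration (IsPodBelow m n)
  podsBelow m n = enumerate-filter (λ parts → isPodPartition? n parts ×-dec All.all? (ℕₚ._≤? m) parts)
    (elements (podPartitions n)) (unique (podPartitions n)) (λ (p , _) → complete (podPartitions n) p)

  podBelow : ℕ → Series
  podBelow m n = + count (podsBelow m n)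

  parts≤ : ∀ {n parts} → IsPodPartition n parts → All (_≤ n) parts
  parts≤ {parts = parts} (isPartition _ _ refl , _) = parts≤sum parts

  podBelow-large : ∀ {m n} → n ≤ m → podBelow m n ≡ + pod n
  podBelow-large {m} {n} n≤m = cong +_ (count-⇔ (podsBelow m n) (podPartitions n) proj₁
    (λ p → p , All.map (λ x≤n → ℕₚ.≤-trans x≤n n≤m) (parts≤ p)))

  podBelow-zero : podBelow 0 ≈ 𝟙
  podBelow-zero zero    = refl
  podBelow-zero (suc n) = cong +_ (count-empty (podsBelow 0 (suc n)) none)
    where
    none : ∀ {parts} → ¬ IsPodBelow 0 (suc n) parts
    none ((isPartition _ (0<x ∷ _) _ , _) , x≤0 ∷ _) = ℕₚ.<⇒≱ 0<x x≤0

  Linked-∷ : ∀ {x l} → All (_≤ x) l → Linked _≥_ l → Linked _≥_ (x ∷ l)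
  Linked-∷ []        []       = [-]
  Linked-∷ (y≤x ∷ _) linked   = y≤x ∷ linked

  Linked-head : ∀ {x l} → Linked _≥_ (x ∷ l) → All (_≤ x) l
  Linked-head linked with x≥ ∷ _ ← Linked⇒AllPairs (λ i≥j j≥k → ℕₚ.≤-trans j≥k i≥j) linked = x≥

  -- After removing a largest part m + 1 the parts are bounded by m′, which is m if m + 1 is odd
  -- and m + 1 if it is even.
  module _ (m m′ : ℕ) (m′≤ : m′ ≤ suc m)
    (remove : ∀ {l} → OddPartsDistinct (suc m ∷ l) → All (_≤ suc m) l → OddPartsDistinct l × All (_≤ m′) l)
    (insert : ∀ {l} → OddPartsDistinct l → All (_≤ m′) l → OddPartsDistinct (suc m ∷ l)) where

    count-split : ∀ i → count (podsBelow (suc m) (suc m ℕ.+ i)) ≡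
                  count (podsBelow m (suc m ℕ.+ i)) ℕ.+ count (podsBelow m′ i)
    count-split i = trans
      (count-≡ {Q = Sum.[ IsPodBelow m (suc m ℕ.+ i) , IsPodBelow m′ i ]}
        (podsBelow (suc m) (suc m ℕ.+ i)) (disjointUnion (podsBelow m (suc m ℕ.+ i)) (podsBelow m′ i))
        to from from∘to to-sound (λ {y} → from-sound {y}) (λ {y} → to∘from {y}))
      (count-disjointUnion (podsBelow m (suc m ℕ.+ i)) (podsBelow m′ i))
      where
      to : List ℕ → List ℕ ⊎ List ℕ
      to []      = inj₁ []
      to (x ∷ l) with x ℕₚ.≟ suc m
      ... | yes _ = inj₂ l
      ... | no _  = inj₁ (x ∷ l)
      from : List ℕ ⊎ List ℕ → List ℕ
      from (inj₁ l) = l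
      from (inj₂ l) = suc m ∷ l
      from∘to : ∀ l → from (to l) ≡ l
      from∘to []      = refl
      from∘to (x ∷ l) with x ℕₚ.≟ suc m
      ... | yes refl = refl
      ... | no _     = refl
      to-sound : ∀ {l} → IsPodBelow (suc m) (suc m ℕ.+ i) l →
          Sum.[ IsPodBelow m (suc m ℕ.+ i) , IsPodBelow m′ i ] (to l)
      to-sound {[]} (p , []) = p , []
      to-sound {x ∷ l} (p@(isPartition dec (0<x ∷ pos) eq , distinct) , x≤ ∷ l≤) with x ℕₚ.≟ suc m
      ... | yes refl = let d , b = remove distinct l≤ in
                       (isPartition (Linked.tail dec) pos (ℕₚ.+-cancelˡ-≡ (suc m) _ _ eq) , d) , b
      -- In a decreasing list a head different from m + 1 bounds all the parts by m.
      ... | no x≢    = let x≤m = s≤s⁻¹ (ℕₚ.≤∧≢⇒< x≤ x≢) in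
                       p , x≤m ∷ All.map (λ y≤x → ℕₚ.≤-trans y≤x x≤m) (Linked-head dec)
      from-sound : ∀ {y} → Sum.[ IsPodBelow m (suc m ℕ.+ i) , IsPodBelow m′ i ] y →
          IsPodBelow (suc m) (suc m ℕ.+ i) (from y)
      from-sound {inj₁ l} (p , l≤) = p , All.map ℕₚ.m≤n⇒m≤1+n l≤
      from-sound {inj₂ l} ((isPartition dec pos eq , distinct) , l≤) =
        (isPartition (Linked-∷ l≤1+m dec) (s≤s z≤n ∷ pos) (cong (suc m ℕ.+_) eq) , insert distinct l≤) ,
            ℕₚ.≤-refl ∷ l≤1+m
        where
        l≤1+m = All.map (λ y≤ → ℕₚ.≤-trans y≤ m′≤) l≤
      to∘from : ∀ {y} → Sum.[ IsPodBelow m (suc m ℕ.+ i) , IsPodBelow m′ i ] y → to (from y) ≡ y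
      to∘from {inj₁ []}      _ = refl
      to∘from {inj₁ (x ∷ l)} (_ , x≤m ∷ _) with x ℕₚ.≟ suc m
      ... | yes refl = ⊥-elim (ℕₚ.1+n≰n x≤m)
      ... | no _     = refl
      to∘from {inj₂ l} _ with suc m ℕₚ.≟ suc m
      ... | yes _ = refl
      ... | no ≢  = ⊥-elim (≢ refl)

    podBelow-split : podBelow (suc m) ≈ podBelow m ⊕ shift (suc m) (podBelow m′)
    podBelow-split n with suc m ℕₚ.≤? n
    -- In degrees up to m neither bound restricts the partitions, and the shifted series has no
    -- terms yet.
    ... | no ≰ = trans (trans (podBelow-large {suc m} (ℕₚ.<⇒≤ n<)) (sym (podBelow-large {m} (s≤s⁻¹ n<))))
      (trans (sym (ℤₚ.+-identityʳ _)) (cong (ℤ._+_ (podBelow m n)) (sym (shift-< (podBelow m′) n<))))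
      where
      n< : n < suc m
      n< = ℕₚ.≰⇒> ≰
    ... | yes ≤ = subst (λ n → podBelow (suc m) n ≡ podBelow m n ℤ.+ shift (suc m) (podBelow m′) n)
        (ℕₚ.m+[n∸m]≡n ≤)
      (trans (cong +_ (count-split i))
        (cong (ℤ._+_ (podBelow m (suc m ℕ.+ i))) (sym (shift-+ (suc m) (podBelow m′) i))))
      where
      i = n ℕ.∸ suc m

  -- An odd largest part occurs only once, so the remaining parts are at most `m`: the factor 1 +
  -- q^(m+1).
  podBelow-odd : ∀ m → Odd (suc m) → podBelow (suc m) ≈ podBelow m ⊕ shift (suc m) (podBelow m)
  podBelow-odd m odd = podBelow-split m m (ℕₚ.n≤1+n m) remove insert
    where
    accept : ∀ l → filter odd? (suc m ∷ l) ≡ suc m ∷ filter odd? l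
    accept l = filter-accept odd? odd
    remove : ∀ {l} → OddPartsDistinct (suc m ∷ l) → All (_≤ suc m) l → OddPartsDistinct l × All (_≤ m) l
    remove {l} distinct l≤ with m∉ ∷ distinct′ ← subst Unique (accept l) distinct =
      distinct′ , All.tabulate λ {y} y∈ → s≤s⁻¹ (ℕₚ.≤∧≢⇒< (All.lookup l≤ y∈)
        λ { refl → All.lookup m∉ (∈-filter⁺ odd? y∈ odd) refl })
    insert : ∀ {l} → OddPartsDistinct l → All (_≤ m) l → OddPartsDistinct (suc m ∷ l)
    insert {l} distinct l≤ = subst Unique (sym (accept l))
      (All.tabulate (λ y∈ → λ { refl → ℕₚ.1+n≰n (All.lookup l≤ (proj₁ (∈-filter⁻ odd? {xs = l} y∈))) }) ∷
          distinct)

  -- An even largest part may recur, so the bound does not drop: the factor 1 / (1 - q^(m+1)).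
  podBelow-even : ∀ m → ¬ Odd (suc m) → podBelow (suc m) ≈ podBelow m ⊕ shift (suc m) (podBelow (suc m))
  podBelow-even m even = podBelow-split m (suc m) ℕₚ.≤-refl
    (λ {l} distinct l≤ → subst Unique (filter-reject odd? even) distinct , l≤)
    (λ {l} distinct l≤ → subst Unique (sym (filter-reject odd? even)) distinct)

  odd-1+2s : ∀ s → Odd (suc (s ℕ.* 2))
  odd-1+2s s 2∣ with ∣⇒≤ (∣m+n∣m⇒∣n {m = s ℕ.* 2} (subst (2 ∣_) (ℕₚ.+-comm 1 (s ℕ.* 2)) 2∣) (divides s refl))
  ... | s≤s ()

  even-2+2s : ∀ s → ¬ Odd (suc (suc (s ℕ.* 2)))
  even-2+2s s odd = odd (divides (suc s) refl)

  -- The substitution of -q for q.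
  twist : Series → Series
  twist f n = -1ℤ ℤ.^ n ℤ.* f n

  twist-shift : ∀ k f n → twist (shift k f) n ≡ -1ℤ ℤ.^ k ℤ.* shift k (twist f) n
  twist-shift zero    f n       = sym (ℤₚ.*-identityˡ _)
  twist-shift (suc k) f zero    = sym (ℤₚ.*-zeroʳ (-1ℤ ℤ.^ suc k))
  twist-shift (suc k) f (suc n) = trans (ℤₚ.*-assoc -1ℤ (-1ℤ ℤ.^ n) (shift k f n))
    (trans (cong (-1ℤ ℤ.*_) (twist-shift k f n)) (sym (ℤₚ.*-assoc -1ℤ (-1ℤ ℤ.^ k) (shift k (twist f) n))))

  -1^2s : ∀ s → -1ℤ ℤ.^ (s ℕ.* 2) ≡ 1ℤ
  -1^2s zero    = refl
  -1^2s (suc s) = cong (λ z → -1ℤ ℤ.* (-1ℤ ℤ.* z)) (-1^2s s)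

  signedPods : ℕ → Series
  signedPods s = twist (podBelow (s ℕ.* 2))

  -- One odd and one even factor are added. Under q ↦ -q the factor 1 + q^(2s+1) becomes 1 -
  -- q^(2s+1), whose negative term is moved to the left; the even factor is unchanged.
  signedPods-suc : ∀ s → signedPods (suc s) ⊕ shift (suc (s ℕ.* 2)) (signedPods s) ≈
                   signedPods s ⊕ shift (suc (suc (s ℕ.* 2))) (signedPods (suc s))
  signedPods-suc s n = begin
    ε ℤ.* p₂ n ℤ.+ shift k₁ (twist p₀) n
      ≡⟨ cong (λ z → ε ℤ.* z ℤ.+ shift k₁ (twist p₀) n) (trans (podBelow-even (suc (s ℕ.* 2)) (even-2+2s s) n)
           (cong (ℤ._+ shift (suc k₁) p₂ n) (podBelow-odd (s ℕ.* 2) (odd-1+2s s) n))) ⟩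
    ε ℤ.* (p₀ n ℤ.+ shift k₁ p₀ n ℤ.+ shift (suc k₁) p₂ n) ℤ.+ shift k₁ (twist p₀) n
      ≡⟨ distrib ε (p₀ n) (shift k₁ p₀ n) (shift (suc k₁) p₂ n) (shift k₁ (twist p₀) n) ⟩
    ε ℤ.* p₀ n ℤ.+ twist (shift k₁ p₀) n ℤ.+ twist (shift (suc k₁) p₂) n ℤ.+ shift k₁ (twist p₀) n
      ≡⟨ cong₂ (λ u v → ε ℤ.* p₀ n ℤ.+ u ℤ.+ v ℤ.+ shift k₁ (twist p₀) n)
           (trans (twist-shift k₁ p₀ n) (cong (λ z → -1ℤ ℤ.* z ℤ.* shift k₁ (twist p₀) n) (-1^2s s)))
           (trans (twist-shift (suc k₁) p₂ n) (cong (ℤ._* shift (suc k₁) (twist p₂) n) (-1^2s (suc s)))) ⟩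
    ε ℤ.* p₀ n ℤ.+ -1ℤ ℤ.* shift k₁ (twist p₀) n ℤ.+ 1ℤ ℤ.* shift (suc k₁) (twist p₂) n ℤ.+
      shift k₁ (twist p₀) n
      ≡⟨ cancel (ε ℤ.* p₀ n) (shift k₁ (twist p₀) n) (shift (suc k₁) (twist p₂) n) ⟩
    ε ℤ.* p₀ n ℤ.+ shift (suc k₁) (twist p₂) n ∎
    where
    open ≡-Reasoning
    ε = -1ℤ ℤ.^ n
    k₁ = suc (s ℕ.* 2)
    p₀ = podBelow (s ℕ.* 2)
    p₂ = podBelow (suc s ℕ.* 2)
    distrib : ∀ e a b c d → e ℤ.* (a ℤ.+ b ℤ.+ c) ℤ.+ d ≡ e ℤ.* a ℤ.+ e ℤ.* b ℤ.+ e ℤ.* c ℤ.+ d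
    distrib = solve-∀
    cancel : ∀ a b c → a ℤ.+ -1ℤ ℤ.* b ℤ.+ 1ℤ ℤ.* c ℤ.+ b ≡ a ℤ.+ c
    cancel = solve-∀

  signedPods-zero : signedPods 0 ≈ 𝟙
  signedPods-zero zero    = cong (1ℤ ℤ.*_) (podBelow-zero 0)
  signedPods-zero (suc n) = trans (cong (-1ℤ ℤ.^ suc n ℤ.*_) (podBelow-zero (suc n)))
      (ℤₚ.*-zeroʳ (-1ℤ ℤ.^ suc n))

open PodPartitions

-- The signed series as the inverse of ψ, and the conclusion

module GaussIdentity where

  open import Algebra.Properties.AbelianGroup ℤₚ.+-0-abelianGroup using (∙-cancelʳ)
  open import Data.Integer.Tactic.RingSolver using (solve-∀)
  open import Data.List.Base using ([]; _∷_; length)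
  open import Data.List.Properties using (filter-accept; filter-reject)
  open import Data.List.Relation.Unary.All using ([]; _∷_)
  open import Data.List.Relation.Unary.AllPairs using ([]; _∷_)
  open import Data.List.Relation.Unary.Any using (here)
  open import Data.Nat.Tactic.RingSolver using () renaming (solve-∀ to solveℕ-∀)
  open import Data.Sum.Base as Sum using (_⊎_; inj₁; inj₂)
  open import Data.Unit.Base using (⊤; tt)
  open import Defs using (Enumeration; count; enumerate-filter; pod; r)
  open import Function.Construct.Identity using (↔-id)
  open import Relation.Binary.PropositionalEquality as ≡ using (_≡_)
  open import Relation.Nullary.Decidable using (Dec; yes; no)
  open CommutativeSemiring seriesSemiring
    using (setoid; refl; sym; trans; +-cong; +-congˡ; +-congʳ; +-assoc; *-cong; *-congˡ; *-congʳ; *-assoc)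

  ⊕-cancel : ∀ f g h → f ⊕ h ≈ g ⊕ h → f ≈ g
  ⊕-cancel f g h eq n = ∙-cancelʳ (h n) (f n) (g n) (eq n)

  -- The factor 1 - q g is not a zero divisor.
  ⊕-unit-cancel : ∀ g f h → f ⊕ X ⊗ g ⊗ h ≈ h ⊕ X ⊗ g ⊗ f → f ≈ h
  ⊕-unit-cancel g f h eq n = below n ℕₚ.≤-refl
    where
    shifted : ∀ f → X ⊗ g ⊗ f ≈ X· (g ⊗ f)
    shifted f = trans (*-assoc X g f) (X-⊗ (g ⊗ f))
    eq′ : ∀ n → f n ℤ.+ (X· (g ⊗ h)) n ≡ h n ℤ.+ (X· (g ⊗ f)) n
    eq′ n = ≡.trans (≡.cong (ℤ._+_ (f n)) (≡.sym (shifted h n)))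
        (≡.trans (eq n) (≡.cong (ℤ._+_ (h n)) (shifted f n)))
    -- Degree i + 1 of q g h involves only coefficients of h up to degree i, where f and h are
    -- already known to agree.
    below : ∀ n {i} → i ≤ n → f i ≡ h i
    below n {zero} _ = ≡.trans (≡.sym (ℤₚ.+-identityʳ (f 0))) (≡.trans (eq′ 0) (ℤₚ.+-identityʳ (h 0)))
    below (suc n) {suc i} (s≤s i≤n) = ∙-cancelʳ ((g ⊗ h) i) (f (suc i)) (h (suc i))
      (≡.trans (eq′ (suc i)) (≡.cong (ℤ._+_ (h (suc i)))
          (⊗-local {g} {g} {f} {h} i (λ _ → ≡.refl) (λ j≤i → below n (ℕₚ.≤-trans j≤i i≤n)))))

  open ShanksIdentity.Telescoping seriesSemiring X ⊕-cancel ⊕-unit-cancel signedPods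

  monomial-+ : ∀ j k → monomial j ⊗ monomial k ≈ monomial (j ℕ.+ k)
  monomial-+ j k = trans (monomial-⊗ j (monomial k)) (shift-monomial j)
    where
    shift-monomial : ∀ j → shift j (monomial k) ≈ monomial (j ℕ.+ k)
    shift-monomial zero    n       = ≡.refl
    shift-monomial (suc j) zero    = ≡.refl
    shift-monomial (suc j) (suc n) = shift-monomial j n

  power-monomial : ∀ {f} k n → f ≈ monomial k → power f n ≈ monomial (n ℕ.* k)
  power-monomial k zero    eq = refl
  power-monomial {f} k (suc n) eq = trans (*-cong eq (power-monomial {f} k n eq)) (monomial-+ k (n ℕ.* k))

  oddPower-monomial : ∀ n → oddPower n ≈ monomial (suc (n ℕ.* 2))
  oddPower-monomial n = trans (*-congˡ {X} (power-monomial 2 n X²)) (X-⊗ (monomial (n ℕ.* 2)))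

  signedPods-step : ∀ s → signedPods (suc s) ⊕ oddPower s ⊗ signedPods s ≈
                    signedPods s ⊕ X ⊗ oddPower s ⊗ signedPods (suc s)
  signedPods-step s = trans (+-congˡ {signedPods (suc s)}
      (trans (*-congʳ {signedPods s} (oddPower-monomial s)) (monomial-⊗ (suc (s ℕ.* 2)) (signedPods s))))
    (trans (signedPods-suc s) (+-congˡ {signedPods s} (sym (trans
      (*-congʳ {signedPods (suc s)} (trans (*-congˡ {X} (oddPower-monomial s))
          (X-⊗ (monomial (suc (s ℕ.* 2))))))
      (monomial-⊗ (suc (suc (s ℕ.* 2))) (signedPods (suc s)))))))

  -- Every term after the first is a multiple of q^k.
  partialSum-low : ∀ {k x} m {n} → x ≈ monomial k → n < k → partialSum x m n ≡ signedPods 0 n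
  partialSum-low zero    eq n<k = ≡.refl
  partialSum-low {k} {x} (suc m) {n} eq n<k = ≡.trans
    (≡.cong₂ ℤ._+_ (partialSum-low {k} {x} m eq n<k) vanishes) (ℤₚ.+-identityʳ _)
    where
    h = power x m
    vanishes : (signedPods (suc m) ⊗ (x ⊗ h)) n ≡ 0ℤ
    vanishes = ≡.trans (⊗-comm (signedPods (suc m)) (x ⊗ h) n) (≡.trans
      (*-assoc x h (signedPods (suc m)) n) (≡.trans
      (*-congʳ {h ⊗ signedPods (suc m)} eq n) (≡.trans
      (monomial-⊗ k (h ⊗ signedPods (suc m)) n) (shift-< (h ⊗ signedPods (suc m)) n<k))))

  monomial-diagonal : ∀ n → monomial n n ≡ 1ℤ
  monomial-diagonal zero    = ≡.refl
  monomial-diagonal (suc n) = monomial-diagonal n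

  monomial-off : ∀ k n → k ≡.≢ n → monomial k n ≡ 0ℤ
  monomial-off zero    zero    k≢n with () ← k≢n ≡.refl
  monomial-off zero    (suc n) k≢n = ≡.refl
  monomial-off (suc k) zero    k≢n = ≡.refl
  monomial-off (suc k) (suc n) k≢n = monomial-off k n (k≢n ∘ ≡.cong suc)

  gf-weightedℕ : ∀ w bound bound′ → gf (weightedℕ w bound) ≈ monomial (w 0) ⊕ gf (weightedℕ (w ∘ suc) bound′)
  gf-weightedℕ w bound bound′ n = ≡.trans
    (≡.cong +_ (≡.trans (count-≡ {Q = Sum.[ (λ _ → w 0 ≡ n) , (λ s → w (suc s) ≡ n) ]}
        (fibre (weightedℕ w bound) n) (disjointUnion first (fibre (weightedℕ (w ∘ suc) bound′) n))
        to from (λ { zero → ≡.refl ; (suc _) → ≡.refl }) (λ { {zero} p → p ; {suc _} p → p })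
        (λ { {inj₁ _} p → p ; {inj₂ _} p → p }) (λ { {inj₁ _} _ → ≡.refl ; {inj₂ _} _ → ≡.refl }))
      (count-disjointUnion first (fibre (weightedℕ (w ∘ suc) bound′) n))))
    (≡.cong (ℤ._+ gf (weightedℕ (w ∘ suc) bound′) n) (count-first (w 0 ℕₚ.≟ n)))
    where
    to : ℕ → ⊤ ⊎ ℕ
    to zero    = inj₁ tt
    to (suc s) = inj₂ s
    from : ⊤ ⊎ ℕ → ℕ
    from (inj₁ _) = 0
    from (inj₂ s) = suc s
    first : Enumeration {A = ⊤} (λ _ → w 0 ≡ n)
    first = enumerate-filter (λ _ → w 0 ℕₚ.≟ n) (tt ∷ []) ([] ∷ []) (λ _ → here ≡.refl)
    count-first : Dec (w 0 ≡ n) → + count first ≡ monomial (w 0) n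
    count-first (yes w≡n) = ≡.trans (≡.cong (+_ ∘ length) (filter-accept (λ _ → w 0 ℕₚ.≟ n) {tt} {[]} w≡n))
      (≡.sym (≡.trans (≡.cong (λ k → monomial k n) w≡n) (monomial-diagonal n)))
    count-first (no w≢n)  = ≡.trans (≡.cong (+_ ∘ length) (filter-reject (λ _ → w 0 ℕₚ.≟ n) {tt} {[]} w≢n))
      (≡.sym (monomial-off (w 0) n w≢n))

  s≤triangle : ∀ m s → s ≤ triangle (s ℕ.+ m)
  s≤triangle m s = ℕₚ.≤-trans (ℕₚ.m≤m+n s m) (n≤triangle (s ℕ.+ m))

  laterTriangles : ℕ → Weighted
  laterTriangles m = weightedℕ (λ s → triangle (s ℕ.+ m)) (s≤triangle m)

  gf-laterTriangles : ∀ m → gf (laterTriangles m) ≈ monomial (triangle m) ⊕ gf (laterTriangles (suc m))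
  gf-laterTriangles m = trans (gf-weightedℕ (λ s → triangle (s ℕ.+ m)) (s≤triangle m) bound)
    (+-congˡ {monomial (triangle m)} (gf-↔ (weightedℕ (λ s → triangle (suc s ℕ.+ m)) bound)
        (laterTriangles (suc m)) (↔-id ℕ)
      (λ s → ≡.cong triangle (ℕₚ.+-suc s m))))
    where
    bound : ∀ s → s ≤ triangle (suc s ℕ.+ m)
    bound s = ℕₚ.≤-trans (ℕₚ.≤-trans (ℕₚ.n≤1+n s) (ℕₚ.m≤m+n (suc s) m)) (n≤triangle (suc s ℕ.+ m))

  triangle-mono : ∀ m s → triangle m ≤ triangle (s ℕ.+ m)
  triangle-mono m zero    = ℕₚ.≤-refl
  triangle-mono m (suc s) = ℕₚ.≤-trans (triangle-mono m s) (ℕₚ.m≤n+m _ (suc s ℕ.+ m))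

  laterTriangles-low : ∀ m {n} → n < m → gf (laterTriangles m) n ≡ 0ℤ
  laterTriangles-low m {n} n<m = ≡.cong +_ (count-empty (fibre (laterTriangles m) n)
    (λ { {s} ≡.refl → ℕₚ.<⇒≱ n<m (ℕₚ.≤-trans (n≤triangle m) (triangle-mono m s)) }))

  triangle-double : ∀ n → triangle (n ℕ.* 2) ≡ n ℕ.* suc (n ℕ.* 2)
  triangle-double zero    = ≡.refl
  triangle-double (suc n) = ≡.trans (≡.cong (λ t → suc (suc (n ℕ.* 2)) ℕ.+ (suc (n ℕ.* 2) ℕ.+ t))
      (triangle-double n)) (lemma n)
    where
    lemma : ∀ n → suc (suc (n ℕ.* 2)) ℕ.+ (suc (n ℕ.* 2) ℕ.+ n ℕ.* suc (n ℕ.* 2)) ≡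
        suc n ℕ.* suc (suc n ℕ.* 2)
    lemma = solveℕ-∀

  -- Each step moves the triangular numbers of index 2n and 2n + 1 from the tail into the finite
  -- sum.
  triangularSum-ψ : ∀ n → ψ ≈ triangularSum signedPods-step n ⊕ gf (laterTriangles (n ℕ.* 2))
  triangularSum-ψ zero = trans (gf-↔ Triangularsℕ (laterTriangles 0) (↔-id ℕ)
      (λ s → ≡.cong triangle (ℕₚ.+-identityʳ s)))
    (λ n → ≡.sym (ℤₚ.+-identityˡ _))
  triangularSum-ψ (suc n) = begin
    ψ
      ≈⟨ triangularSum-ψ n ⟩
    t ⊕ gf (laterTriangles (n ℕ.* 2))
      ≈⟨ +-congˡ {t} (trans (gf-laterTriangles (n ℕ.* 2))
          (+-congˡ {monomial (triangle (n ℕ.* 2))} (gf-laterTriangles (suc (n ℕ.* 2))))) ⟩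
    t ⊕ (monomial (triangle (n ℕ.* 2)) ⊕ (monomial (triangle (suc (n ℕ.* 2))) ⊕ later))
      ≈⟨ +-congˡ {t} (+-cong (sym even) (+-congʳ {later} (sym odd))) ⟩
    t ⊕ (power x n ⊕ (x ⊗ power x n ⊕ later))
      ≈⟨ +-congˡ {t} (+-assoc (power x n) (x ⊗ power x n) later) ⟨
    t ⊕ (power x n ⊕ x ⊗ power x n ⊕ later)
      ≈⟨ +-assoc t (power x n ⊕ x ⊗ power x n) later ⟨
    t ⊕ (power x n ⊕ x ⊗ power x n) ⊕ later ∎
    where
    open import Relation.Binary.Reasoning.Setoid setoid
    t = triangularSum signedPods-step n
    x = oddPower n
    later = gf (laterTriangles (suc n ℕ.* 2))
    even : power x n ≈ monomial (triangle (n ℕ.* 2))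
    even = trans (power-monomial {x} (suc (n ℕ.* 2)) n (oddPower-monomial n))
      (λ i → ≡.cong (λ k → monomial k i) (≡.sym (triangle-double n)))
    odd : x ⊗ power x n ≈ monomial (triangle (suc (n ℕ.* 2)))
    odd = trans (*-cong (oddPower-monomial n) even) (monomial-+ (suc (n ℕ.* 2)) (triangle (n ℕ.* 2)))

  signedPod : Series
  signedPod n = -1ℤ ℤ.^ n ℤ.* + pod n

  -- The coefficient of degree n is read off from Shanks' identity for N = n + 1. As n < 2N, the
  -- tail of ψ is invisible, parts bounded by 2N are no restriction, and the right side reduces to
  -- its first term 1.
  signedPod-⊗-ψ : signedPod ⊗ ψ ≈ 𝟙
  signedPod-⊗-ψ n = begin
    (signedPod ⊗ ψ) n
      ≡⟨ ⊗-comm signedPod ψ n ⟩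
    (ψ ⊗ signedPod) n
      ≡⟨ ⊗-local {ψ} {triangularSum signedPods-step N} {signedPod} {signedPods N} n
           (λ {i} i≤n → ≡.trans (triangularSum-ψ N i) (≡.trans
             (≡.cong (ℤ._+_ (triangularSum signedPods-step N i))
                 (laterTriangles-low (N ℕ.* 2) (ℕₚ.≤-<-trans i≤n n<2N)))
             (ℤₚ.+-identityʳ _)))
           (λ {i} i≤n → ≡.cong (-1ℤ ℤ.^ i ℤ.*_) (≡.sym (podBelow-large {N ℕ.* 2}
               (ℕₚ.≤-trans i≤n (ℕₚ.<⇒≤ n<2N))))) ⟩
    (triangularSum signedPods-step N ⊗ signedPods N) n
      ≡⟨ triangularSum-* signedPods-step N n ⟩
    partialSum (oddPower N) n n
      ≡⟨ partialSum-low {suc (N ℕ.* 2)} {oddPower N} n (oddPower-monomial N) (ℕₚ.m≤n⇒m≤1+n n<2N) ⟩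
    signedPods 0 n
      ≡⟨ signedPods-zero n ⟩
    𝟙 n ∎
    where
    open ≡.≡-Reasoning
    N = suc n
    n<2N : n < N ℕ.* 2
    n<2N = s≤s (ℕₚ.≤-trans (ℕₚ.m≤m*n n 2) (ℕₚ.n≤1+n _))

  -1^-square : ∀ n → -1ℤ ℤ.^ n ℤ.* -1ℤ ℤ.^ n ≡ 1ℤ
  -1^-square zero    = ≡.refl
  -1^-square (suc n) = ≡.trans (lemma (-1ℤ ℤ.^ n)) (-1^-square n)
    where
    lemma : ∀ e → -1ℤ ℤ.* e ℤ.* (-1ℤ ℤ.* e) ≡ e ℤ.* e
    lemma = solve-∀

  -- 3n + 2 and n have the same parity.
  -1^-3n+2 : ∀ n → -1ℤ ℤ.^ (2 ℕ.+ n ℕ.* 3) ≡ -1ℤ ℤ.^ n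
  -1^-3n+2 zero    = ≡.refl
  -1^-3n+2 (suc n) = ≡.trans (≡.cong (λ e → -1ℤ ℤ.* (-1ℤ ℤ.* (-1ℤ ℤ.* e))) (-1^-3n+2 n)) (lemma (-1ℤ ℤ.^ n))
    where
    lemma : ∀ e → -1ℤ ℤ.* (-1ℤ ℤ.* (-1ℤ ℤ.* e)) ≡ -1ℤ ℤ.* e
    lemma = solve-∀

  -- With ε = (-1)ⁿ, t the coefficient of ψ⁵ and p = pod(3n+2), the congruence gives ε p = t - 9z.
  -- The difference is therefore ε (t - 9z) + 224 ε t, where 224 = 2 · 112, and this is 9 ε (25t -
  -- z).
  quotient : ℕ → ℤ
  quotient n = -1ℤ ℤ.^ n ℤ.* (+ 25 ℤ.* ψ-fifth n ℤ.- proj₁ (ψ-fifth-mod-9 signedPod-⊗-ψ n))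

  pod-difference : ∀ n →
    + pod (3 ℕ.* n ℕ.+ 2) ℤ.- + 2 ℤ.* -1ℤ ℤ.^ (n ℕ.+ 1) ℤ.* + r 5 (8 ℕ.* n ℕ.+ 5) ≡ quotient n ℤ.* + 9
  pod-difference n = begin
    + pod (3 ℕ.* n ℕ.+ 2) ℤ.- + 2 ℤ.* -1ℤ ℤ.^ (n ℕ.+ 1) ℤ.* + r 5 (8 ℕ.* n ℕ.+ 5)
      ≡⟨ ≡.cong₂ ℤ._-_ (≡.cong (λ m → + pod m) (index n))
           (≡.cong₂ (λ u v → + 2 ℤ.* u ℤ.* v) (≡.cong (-1ℤ ℤ.^_) (ℕₚ.+-comm n 1)) (r₅≡112ψ⁵ n)) ⟩
    p ℤ.- + 2 ℤ.* (-1ℤ ℤ.* ε) ℤ.* (+ 112 ℤ.* t)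
      -- Inserting ε² = 1 makes ε a common factor, so that ε p appears and can be replaced.
      ≡⟨ ≡.cong (ℤ._- + 2 ℤ.* (-1ℤ ℤ.* ε) ℤ.* (+ 112 ℤ.* t))
          (≡.trans (≡.sym (ℤₚ.*-identityˡ p)) (≡.cong (ℤ._* p) (≡.sym (-1^-square n)))) ⟩
    ε ℤ.* ε ℤ.* p ℤ.- + 2 ℤ.* (-1ℤ ℤ.* ε) ℤ.* (+ 112 ℤ.* t)
      ≡⟨ lemma ε p t z (≡.trans (proj₂ (ψ-fifth-mod-9 signedPod-⊗-ψ n))
          (≡.cong (λ e → e ℤ.* p ℤ.+ + 9 ℤ.* z) (-1^-3n+2 n))) ⟩
    quotient n ℤ.* + 9 ∎
    where
    open ≡.≡-Reasoning
    ε = -1ℤ ℤ.^ n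
    t = ψ-fifth n
    z = proj₁ (ψ-fifth-mod-9 signedPod-⊗-ψ n)
    p = + pod (2 ℕ.+ n ℕ.* 3)
    index : ∀ n → 3 ℕ.* n ℕ.+ 2 ≡ 2 ℕ.+ n ℕ.* 3
    index = solveℕ-∀
    lemma : ∀ ε p t z → t ≡ ε ℤ.* p ℤ.+ + 9 ℤ.* z →
            ε ℤ.* ε ℤ.* p ℤ.- + 2 ℤ.* (-1ℤ ℤ.* ε) ℤ.* (+ 112 ℤ.* t) ≡ ε ℤ.* (+ 25 ℤ.* t ℤ.- z) ℤ.* + 9
    lemma ε p t z eq = ≡.trans (rearrange′ ε p t z) (≡.trans
      (≡.cong (λ u → ε ℤ.* (u ℤ.+ + 224 ℤ.* t ℤ.- + 9 ℤ.* z)) (≡.sym eq)) (collect ε t z))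
      where
      rearrange′ : ∀ ε p t z → ε ℤ.* ε ℤ.* p ℤ.- + 2 ℤ.* (-1ℤ ℤ.* ε) ℤ.* (+ 112 ℤ.* t) ≡
        ε ℤ.* (ε ℤ.* p ℤ.+ + 9 ℤ.* z ℤ.+ + 224 ℤ.* t ℤ.- + 9 ℤ.* z)
      rearrange′ = solve-∀
      collect : ∀ ε t z → ε ℤ.* (t ℤ.+ + 224 ℤ.* t ℤ.- + 9 ℤ.* z) ≡ ε ℤ.* (+ 25 ℤ.* t ℤ.- z) ℤ.* + 9
      collect = solve-∀

open GaussIdentity

open import Defs using (pod; r)
open import Data.Nat using (ℕ; _+_; _*_)
open import Data.Integer using (+_; -1ℤ; _-_; _^_) renaming (_*_ to _*ᶻ_)
open import Data.Integer.Divisibility using (_∣_)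
open import Data.Integer.Divisibility.Signed using (divides; ∣⇒∣ᵤ)

theorem1 : (n : ℕ) →
    + 9 ∣ + pod (3 * n + 2) - + 2 *ᶻ -1ℤ ^ (n + 1) *ᶻ + r 5 (8 * n + 5)
theorem1 n = ∣⇒∣ᵤ (divides (quotient n) (pod-difference n))
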